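{- Let $\lambda:\mathbb N\to\mathbb N$ be any function with $\lambda(n)\to\infty$. For every $\gamma>0$ there exists $\rho>0$ such that for every $\lambda$-well-behaved feasible degree sequence $\mathcal D$ of length $n$, the probability that $G(\mathcal D)$ has a component of order at least $\gamma n$ and $H(\mathcal D)$ has no component of size at least $\rho M_{\mathcal D}$ is $o(1)$ (as $n\to\infty$, uniformly in such $\mathcal D$).
   Context: A degree sequence $\mathcal D=(d_1,\dots,d_n)$ consists of positive integers (no zero entries) and is feasible if some simple graph on $\{1,\dots,n\}$ has vertex $i$ of degree $d_i$; $G(\mathcal D)$ is a uniformly random simple graph on $\{1,\dots,n\}$ with vertex $i$ of degree $d_i$. $M_{\mathcal D}=\sum_{i:d_i\ne 2}d_i$, and $\mathcal D$ is $\lambda$-well-behaved if $M_{\mathcal D}\ge\lambda(n)$. A component is cyclic if it is a cycle. $H(\mathcal D)$ is the multigraph obtained from $G(\mathcal D)$ by deleting all cyclic components and then suppressing every vertex of degree 2 (deleting it and joining its two neighbours by an edge, possibly creating loops and multiple edges). The order of a (multi)graph is its number of vertices and its size is its number of edges. -}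

module Defs where

open import Data.Nat using (ℕ; zero; suc; _+_; _≡ᵇ_; _<ᵇ_)
open import Data.Bool using (Bool; true; false; _∧_; _∨_; not; if_then_else_)
open import Data.Fin using (Fin; toℕ; _≟_)
import Data.Fin as F
open import Data.Fin.Subset using (Subset; _∈_; ∣_∣)
open import Data.List using (List; []; _∷_; [_]; length; lookup; allFin; concatMap)
open import Data.List.Relation.Unary.All using (All)
open import Data.List.Relation.Unary.Any using (Any)
open import Data.List.Relation.Unary.AllPairs using (AllPairs)
open import Data.List.Relation.Binary.Permutation.Propositional using (_↭_)
open import Data.Product using (Σ; _×_; _,_; proj₁; proj₂; ∃)
open import Data.Sum using (_⊎_)
open import Function using (_∘_)
open import Relation.Nullary using (¬_; does)
open import Relation.Binary.PropositionalEquality using (_≡_; _≢_)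
open import Relation.Binary.Construct.Closure.ReflexiveTransitive using (Star)
open import Data.Integer using (+_)
open import Data.Rational using (ℚ; _/_; _≤_; _*_)

anyF : ∀ {n} → (Fin n → Bool) → Bool
anyF {zero}  f = false
anyF {suc n} f = f F.zero ∨ anyF (f ∘ F.suc)

countF : ∀ {n} → (Fin n → Bool) → ℕ
countF {zero}  f = 0
countF {suc n} f = (if f F.zero then 1 else 0) + countF (f ∘ F.suc)

sumF : ∀ {n} → (Fin n → ℕ) → ℕ
sumF {zero}  f = 0
sumF {suc n} f = f F.zero + sumF (f ∘ F.suc)

iterate : {A : Set} → ℕ → (A → A) → A → A
iterate zero    f x = x
iterate (suc k) f x = f (iterate k f x)

toℚ : ℕ → ℚ
toℚ m = (+ m) / 1

record Graph (n : ℕ) : Set where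
  field
    adj    : Fin n → Fin n → Bool
    sym    : ∀ i j → adj i j ≡ adj j i
    irrefl : ∀ i → adj i i ≡ false
open Graph public

SameGraph : ∀ {n} → Graph n → Graph n → Set
SameGraph G H = ∀ i j → adj G i j ≡ adj H i j

degree : ∀ {n} → Graph n → Fin n → ℕ
degree G i = countF (adj G i)

DegSeq : ℕ → Set
DegSeq n = Fin n → ℕ

HasDegSeq : ∀ {n} → DegSeq n → Graph n → Set
HasDegSeq D G = ∀ i → degree G i ≡ D i

Feasible : ∀ {n} → DegSeq n → Set
Feasible {n} D = Σ (Graph n) (HasDegSeq D)

M : ∀ {n} → DegSeq n → ℕ
M D = sumF (λ i → if D i ≡ᵇ 2 then 0 else D i)

reachStep : ∀ {n} → Graph n → (Fin n → Bool) → (Fin n → Bool)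
reachStep G S j = S j ∨ anyF (λ i → S i ∧ adj G i j)

component : ∀ {n} → Graph n → Fin n → (Fin n → Bool)
component {n} G v = iterate n (reachStep G) (λ u → does (u ≟ v))

compOrder : ∀ {n} → Graph n → Fin n → ℕ
compOrder G v = countF (component G v)

-- the component of v is NOT cyclic (not a cycle = not connected 2-regular):
-- it contains a vertex of degree ≠ 2
nonCyclic : ∀ {n} → Graph n → Fin n → Bool
nonCyclic G v = anyF (λ u → component G v u ∧ not (degree G u ≡ᵇ 2))

-- Multigraphs (loops and multiple edges allowed) whose vertex set is a
-- subset of Fin n; edges form a list (multiset) of endpoint pairs.

record MGraph (n : ℕ) : Set where
  field
    present : Fin n → Bool
    edges   : List (Fin n × Fin n)
open MGraph public

-- degree in a multigraph (a loop contributes 2)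
mdeg : ∀ {n} → MGraph n → Fin n → ℕ
mdeg H v = go (edges H)
  where
  go : List _ → ℕ
  go []             = 0
  go ((x , y) ∷ es) = (if does (x ≟ v) then 1 else 0)
                    + (if does (y ≟ v) then 1 else 0) + go es

deleteCyclic : ∀ {n} → Graph n → MGraph n
deleteCyclic {n} G = record
  { present = nonCyclic G
  ; edges   = concatMap (λ i → concatMap (λ j →
                if adj G i j ∧ (toℕ i <ᵇ toℕ j) ∧ nonCyclic G i
                then [ (i , j) ] else []) (allFin n)) (allFin n)
  }

data Incident {n} (v : Fin n) : Fin n → Fin n × Fin n → Set where
  left  : ∀ a → Incident v a (v , a)
  right : ∀ a → Incident v a (a , v)

NotIncident : ∀ {n} → Fin n → Fin n × Fin n → Set
NotIncident v e = (proj₁ e ≢ v) × (proj₂ e ≢ v)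

record Suppress {n} (H H' : MGraph n) : Set where
  field
    v a b     : Fin n
    e₁ e₂     : Fin n × Fin n
    rest      : List (Fin n × Fin n)
    v-present : present H v ≡ true
    a≢v       : a ≢ v
    b≢v       : b ≢ v
    inc₁      : Incident v a e₁
    inc₂      : Incident v b e₂
    perm      : edges H ↭ (e₁ ∷ e₂ ∷ rest)
    rest-ok   : All (NotIncident v) rest
    edges'    : edges H' ≡ (a , b) ∷ rest
    present'  : ∀ u → present H' u ≡ (present H u ∧ not (does (u ≟ v)))

NoDeg2 : ∀ {n} → MGraph n → Set
NoDeg2 H = ∀ v → present H v ≡ true → ¬ (mdeg H v ≡ 2)

IsH : ∀ {n} → Graph n → MGraph n → Set
IsH G H = Star Suppress (deleteCyclic G) H × NoDeg2 H

MAdj : ∀ {n} → MGraph n → Fin n → Fin n → Set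
MAdj H x y = Any (λ e → (e ≡ (x , y)) ⊎ (e ≡ (y , x))) (edges H)

HasCompOfSizeAtLeast : ∀ {n} → MGraph n → ℚ → Set
HasCompOfSizeAtLeast H r =
  Σ _ λ v → present H v ≡ true ×
  Σ (Subset (length (edges H))) λ S →
    (∀ p → p ∈ S → Star (MAdj H) v (proj₁ (lookup (edges H) p))) ×
    r ≤ toℚ ∣ S ∣

HasCompOfOrderAtLeast : ∀ {n} → Graph n → ℚ → Set
HasCompOfOrderAtLeast G r = ∃ λ v → r ≤ toℚ (compOrder G v)

BadEvent : ∀ {n} → ℚ → ℚ → DegSeq n → Graph n → Set
BadEvent {n} γ ρ D G =
  HasDegSeq D G ×
  HasCompOfOrderAtLeast G (γ * toℚ n) ×
  ∃ λ H → IsH G H × ¬ HasCompOfSizeAtLeast H (ρ * toℚ (M D))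

-- Probability under the uniform distribution on graphs with degree
-- sequence D is at most ε:  #(bad graphs) ≤ ε · #(graphs with degree seq D).
-- Counting is expressed via duplicate-free lists: every duplicate-free list of
-- bad graphs has length ≤ ε · |T| where T is a duplicate-free enumeration of
-- all graphs with degree sequence D.

Distinct : ∀ {n} → Graph n → Graph n → Set
Distinct G H = ¬ SameGraph G H

IsEnumeration : ∀ {n} → DegSeq n → List (Graph n) → Set
IsEnumeration D T =
  AllPairs Distinct T × All (HasDegSeq D) T ×
  (∀ G → HasDegSeq D G → Any (SameGraph G) T)

ProbAtMost : ∀ {n} → DegSeq n → (Graph n → Set) → ℚ → Set
ProbAtMost {n} D E ε =
  (T : List (Graph n)) → IsEnumeration D T →
  (L : List (Graph n)) → AllPairs Distinct L → All E L →
  toℚ (length L) ≤ ε * toℚ (length T)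

{-# OPTIONS --safe #-}
module Submission where

open import Defs hiding (sym)
open import Algebra.Properties.CommutativeSemigroup using (interchange)
open import Data.Bool using (Bool; true; false; _∧_; _∨_; not; if_then_else_)
import Data.Bool as B
open import Data.Bool.Properties using (∧-conicalˡ; ∧-conicalʳ; ∨-zeroʳ; ∧-zeroʳ; ∨-comm; ¬-not)
open import Data.Empty using (⊥-elim)
open import Data.Fin using (Fin; _≟_; toℕ; fromℕ<)
import Data.Fin as F
import Data.Fin.Properties as FP
open import Data.Fin.Subset using (Subset; ∣_∣) renaming (_∈_ to _∈ₛ_)
open import Data.Fin.Subset.Properties using (anySubset?)
import Data.Integer as ℤ
import Data.Integer.Properties as ℤP
open import Data.List using (List; []; _∷_; [_]; _++_; length; lookup; concatMap; allFin)
import Data.List as List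
open import Data.List.Membership.Propositional.Properties using (∈-lookup)
open import Data.List.Relation.Binary.Permutation.Propositional using (_↭_; ↭-sym)
import Data.List.Relation.Binary.Permutation.Propositional as Perm
open import Data.List.Relation.Binary.Permutation.Propositional.Properties using (Any-resp-↭)
open import Data.List.Relation.Unary.All using (All; []; _∷_)
import Data.List.Relation.Unary.All as All
open import Data.List.Relation.Unary.AllPairs using (AllPairs; []; _∷_)
open import Data.List.Relation.Unary.Any using (Any; here; there)
import Data.List.Relation.Unary.Any as Any
open import Data.List.Relation.Unary.Any.Properties using (concatMap⁺; concatMap⁻; tabulate⁺; tabulate⁻; lookup-index)
open import Data.Nat using (ℕ; zero; suc; _+_; _*_; _∸_; _^_; _/_; _%_; _≤_; _<_; _≡ᵇ_; _<ᵇ_; z≤n; s≤s; s≤s⁻¹; NonZero; >-nonZero)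
import Data.Nat as ℕ
open import Data.Nat.DivMod using (m≡m%n+[m/n]*n; m%n<n; m/n*n≤m; /-monoˡ-≤; m*n/n≡m; m≥n⇒m/n>0)
open import Data.Nat.Properties hiding (_≟_)
open import Data.Nat.Tactic.RingSolver using (solve-∀)
open import Data.Product using (Σ; _×_; _,_; proj₁; proj₂; ∃)
open import Data.Product.Properties using (≡-dec)
open import Data.Rational using (ℚ; 0ℚ; mkℚ; toℚᵘ; fromℚᵘ)
import Data.Rational as ℚ
import Data.Rational.Properties as ℚP
open import Data.Rational.Unnormalised using (mkℚᵘ; *≤*; *<*; _≃_)
import Data.Rational.Unnormalised as ℚᵘ
import Data.Rational.Unnormalised.Properties as ℚᵘP
open import Data.Sum using (_⊎_; inj₁; inj₂; [_,_]′)
open import Data.Vec using (tabulate)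
import Data.Vec as V
open import Data.Vec.Properties using (lookup∘tabulate)
open import Function using (_∘_)
open import Relation.Binary using (DecidableEquality; tri<; tri≈; tri>)
open import Relation.Binary.Construct.Closure.ReflexiveTransitive using (Star; _◅_; _◅◅_)
open import Relation.Binary.PropositionalEquality hiding ([_]; J)
open import Relation.Nullary using (¬_; does; yes; no; Dec; contradiction)
open import Relation.Nullary.Decidable using (dec-false; _×-dec_; ¬?)

-- The component of a vertex of degree ≠ 2 contributes half of its mass, the sum of the degrees ≠ 2,
-- to the size of H.  So it suffices to bound the number of graphs with a component K of order at least
-- n / g and mass at most 2 M / R, where R = 1024 g².  This is done by switchings that replace edges
-- vw, xy by vy, xw, counted through injections from tuples (graph, switching, marked vertices).
--
-- If M ≥ 16 n, switch an edge xy of K with an edge vw outside K that lies in no edge cut of size at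
-- most 2; all but O(n) edges qualify.  The new graph, the edge xw and a vertex on the y-side of xy
-- determine the switching, which bounds the probability by O(1 / n).
--
-- If M ≤ 16 n, the same argument with v of degree ≠ 2 bounds the probability of a large cyclic component
-- by O(1 / M), and a switching in the middle of a long run of vertices of degree 2 does so for long runs.
-- Otherwise most of K consists of short runs.  Moving an initial piece of such a run to the front of a run
-- outside K changes the order of K only a little, and can be done in at least twice as many ways as it
-- can be undone, because K has so few runs.  Repeating this r times gains a factor 2^r.

bit : Bool → ℕ
bit b = if b then 1 else 0

data Code : Set where
  fin : ℕ → Code
  _⊗_ : Code → Code → Code

infixr 6 _⊗_

El : Code → Set
El (fin n) = Fin n
El (c ⊗ d) = El c × El d

_≟El_ : ∀ {c} → DecidableEquality (El c)
_≟El_ {fin n} = F._≟_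
_≟El_ {c ⊗ d} = ≡-dec (_≟El_ {c}) (_≟El_ {d})

∑ : (c : Code) → (El c → ℕ) → ℕ
∑ (fin n) f = sumF f
∑ (c ⊗ d) f = ∑ c λ x → ∑ d λ y → f (x , y)

# : (c : Code) → (El c → Bool) → ℕ
# c P = ∑ c (bit ∘ P)

∑-cong : ∀ c {f g : El c → ℕ} → (∀ x → f x ≡ g x) → ∑ c f ≡ ∑ c g
∑-cong (fin zero)    e = refl
∑-cong (fin (suc n)) e = cong₂ _+_ (e F.zero) (∑-cong (fin n) (e ∘ F.suc))
∑-cong (c ⊗ d)       e = ∑-cong c λ x → ∑-cong d λ y → e (x , y)

∑-mono : ∀ c {f g : El c → ℕ} → (∀ x → f x ≤ g x) → ∑ c f ≤ ∑ c g
∑-mono (fin zero)    e = z≤n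
∑-mono (fin (suc n)) e = +-mono-≤ (e F.zero) (∑-mono (fin n) (e ∘ F.suc))
∑-mono (c ⊗ d)       e = ∑-mono c λ x → ∑-mono d λ y → e (x , y)

∑-+ : ∀ c (f g : El c → ℕ) → ∑ c (λ x → f x + g x) ≡ ∑ c f + ∑ c g
∑-+ (fin zero)    f g = refl
∑-+ (fin (suc n)) f g = trans (cong₂ _+_ refl (∑-+ (fin n) (f ∘ F.suc) (g ∘ F.suc)))
                              (interchange +-commutativeSemigroup (f F.zero) (g F.zero) _ _)
∑-+ (c ⊗ d)       f g = trans (∑-cong c λ x → ∑-+ d _ _) (∑-+ c _ _)

∑-* : ∀ c (f : El c → ℕ) k → ∑ c (λ x → f x * k) ≡ ∑ c f * k
∑-* (fin zero)    f k = refl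
∑-* (fin (suc n)) f k = trans (cong₂ _+_ refl (∑-* (fin n) (f ∘ F.suc) k)) (sym (*-distribʳ-+ k (f F.zero) _))
∑-* (c ⊗ d)       f k = trans (∑-cong c λ x → ∑-* d _ k) (∑-* c _ k)

∑-0 : ∀ c → ∑ c (λ _ → 0) ≡ 0
∑-0 (fin zero)    = refl
∑-0 (fin (suc n)) = ∑-0 (fin n)
∑-0 (c ⊗ d)       = trans (∑-cong c λ _ → ∑-0 d) (∑-0 c)

∑-swap : ∀ c d (f : El c → El d → ℕ) → ∑ c (λ x → ∑ d (f x)) ≡ ∑ d (λ y → ∑ c (λ x → f x y))
∑-swap (fin zero)    d f = sym (∑-0 d)
∑-swap (fin (suc n)) d f = trans (cong₂ _+_ refl (∑-swap (fin n) d (f ∘ F.suc))) (sym (∑-+ d _ _))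
∑-swap (c ⊗ c')      d f = trans (∑-cong c λ x → ∑-swap c' d _) (∑-swap c d _)

∑-term : ∀ c (f : El c → ℕ) x → f x ≤ ∑ c f
∑-term (fin (suc n)) f F.zero    = m≤m+n _ _
∑-term (fin (suc n)) f (F.suc x) = ≤-trans (∑-term (fin n) (f ∘ F.suc) x) (m≤n+m _ _)
∑-term (c ⊗ d)       f (x , y)   = ≤-trans (∑-term d (λ y → f (x , y)) y) (∑-term c _ x)

sumF-pos : ∀ n (f : Fin n → ℕ) → 0 < sumF f → ∃ λ x → 0 < f x
sumF-pos (suc n) f p with f F.zero in e
... | suc k = F.zero , subst (0 <_) (sym e) (s≤s z≤n)
... | zero  = let (x , q) = sumF-pos n (f ∘ F.suc) p in F.suc x , q

∑-pos : ∀ c (f : El c → ℕ) → 0 < ∑ c f → ∃ λ x → 0 < f x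
∑-pos (fin n) = sumF-pos n
∑-pos (c ⊗ d) f p = let (x , q) = ∑-pos c _ p ; (y , r) = ∑-pos d _ q in (x , y) , r

sumF-unique : ∀ n (f : Fin n → ℕ) → (∀ x → f x ≤ 1) →
              (∀ x y → 0 < f x → 0 < f y → x ≡ y) → sumF f ≤ 1
sumF-unique zero    f b u = z≤n
sumF-unique (suc n) f b u with f F.zero in e
... | zero  = sumF-unique n (f ∘ F.suc) (b ∘ F.suc) λ x y p q → FP.suc-injective (u _ _ p q)
... | suc k with sumF (f ∘ F.suc) in e'
...   | zero  = subst (_≤ 1) (trans e (sym (+-identityʳ _))) (b F.zero)
...   | suc _ = let (x , q) = sumF-pos n (f ∘ F.suc) (subst (0 <_) (sym e') (s≤s z≤n))
                in contradiction (u F.zero (F.suc x) (subst (0 <_) (sym e) (s≤s z≤n)) q) FP.0≢1+n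

∑-unique : ∀ c (f : El c → ℕ) → (∀ x → f x ≤ 1) →
           (∀ x y → 0 < f x → 0 < f y → x ≡ y) → ∑ c f ≤ 1
∑-unique (fin n) = sumF-unique n
∑-unique (c ⊗ d) f b u = ∑-unique c _
  (λ x → ∑-unique d _ (λ y → b (x , y)) λ y y' p q → cong proj₂ (u _ _ p q))
  (λ x x' p p' → let (y , q) = ∑-pos d _ p ; (y' , q') = ∑-pos d _ p' in cong proj₁ (u (x , y) (x' , y') q q'))

bit≤1 : ∀ b → bit b ≤ 1
bit≤1 true  = ≤-refl
bit≤1 false = z≤n

bit-pos : ∀ {b} → 0 < bit b → b ≡ true
bit-pos {true} _ = refl

bit-∧ : ∀ a b → bit (a ∧ b) ≡ bit a * bit b
bit-∧ true  b = sym (+-identityʳ _)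
bit-∧ false b = refl

bit-mono : ∀ {a b} → (a ≡ true → b ≡ true) → bit a ≤ bit b
bit-mono {false} h = z≤n
bit-mono {true}  h rewrite h refl = ≤-refl

does-true : ∀ {a} {A : Set a} (d : Dec A) → does d ≡ true → A
does-true (yes x) _ = x

true-does : ∀ {a} {A : Set a} (d : Dec A) → A → does d ≡ true
true-does (yes _) _ = refl
true-does (no ¬x) x = ⊥-elim (¬x x)

#-unique : ∀ c (P : El c → Bool) → (∀ x y → P x ≡ true → P y ≡ true → x ≡ y) → # c P ≤ 1
#-unique c P u = ∑-unique c _ (bit≤1 ∘ P) λ x y p q → u x y (bit-pos p) (bit-pos q)

#-mono : ∀ c {P Q : El c → Bool} → (∀ x → P x ≡ true → Q x ≡ true) → # c P ≤ # c Q
#-mono c h = ∑-mono c λ x → bit-mono (h x)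

#-singleton : ∀ c (y : El c) → # c (λ x → does (_≟El_ {c} y x)) ≡ 1
#-singleton c y = ≤-antisym
  (#-unique c _ λ x x' p q → trans (sym (does-true (_≟El_ {c} y x) p)) (does-true (_≟El_ {c} y x') q))
  (≤-trans (≤-reflexive (cong bit (sym (true-does (_≟El_ {c} y y) refl)))) (∑-term c _ y))

#-injection : ∀ c d (P : El c → Bool) (Q : El d → Bool) (f : ∀ x → P x ≡ true → El d) →
  (∀ x p → Q (f x p) ≡ true) → (∀ x y p q → f x p ≡ f y q → x ≡ y) → # c P ≤ # d Q
#-injection c d P Q f into inj = begin
  # c P                      ≤⟨ ∑-mono c (λ x → row x (P x) refl) ⟩
  ∑ c (λ x → ∑ d (r x))      ≡⟨ ∑-swap c d r ⟩
  ∑ d (λ y → ∑ c (λ x → r x y)) ≤⟨ ∑-mono d col ⟩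
  # d Q                      ∎
  where
  open ≤-Reasoning
  h : ∀ x b → P x ≡ b → El d → ℕ
  h x true  p y = bit (does (_≟El_ {d} (f x p) y))
  h x false p y = 0
  r : El c → El d → ℕ
  r x y = h x (P x) refl y
  row : ∀ x b (p : P x ≡ b) → bit b ≤ ∑ d (h x b p)
  row x true  p = ≤-reflexive (sym (#-singleton d (f x p)))
  row x false p = z≤n
  h≤1 : ∀ x b p y → h x b p y ≤ 1
  h≤1 x true  p y = bit≤1 _
  h≤1 x false p y = z≤n
  hpos : ∀ x b p y → 0 < h x b p y → Σ (P x ≡ true) λ q → f x q ≡ y
  hpos x true p y 0< = p , does-true (_≟El_ {d} (f x p) y) (bit-pos 0<)
  col : ∀ y → ∑ c (λ x → r x y) ≤ bit (Q y)
  col y with Q y in e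
  ... | true  = ∑-unique c _ (λ x → h≤1 x (P x) refl y) λ x x' 0< 0<' →
                  let (p , a) = hpos x (P x) refl y 0< ; (p' , a') = hpos x' (P x') refl y 0<' in inj x x' p p' (trans a (sym a'))
  ... | false with ∑ c (λ x → r x y) in e'
  ...   | zero  = z≤n
  ...   | suc _ = let (x , 0<) = ∑-pos c (λ x → r x y) (subst (0 <_) (sym e') (s≤s z≤n))
                      (p , a)  = hpos x (P x) refl y 0<
                  in ⊥-elim (t≢f (trans (sym (into x p)) (trans (cong Q a) e)))
    where t≢f : ¬ (true ≡ false)
          t≢f ()

true≢false : ¬ true ≡ false
true≢false ()

not-true : ∀ {b} → not b ≡ true → b ≡ false
not-true {false} _ = refl

not-false : ∀ {b} → not b ≡ false → b ≡ true
not-false {true} _ = refl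

∨-true : ∀ a {b} → a ∨ b ≡ true → a ≡ true ⊎ b ≡ true
∨-true true  _ = inj₁ refl
∨-true false e = inj₂ e

∨-introˡ : ∀ {a} b → a ≡ true → a ∨ b ≡ true
∨-introˡ b refl = refl

∨-introʳ : ∀ a {b} → b ≡ true → a ∨ b ≡ true
∨-introʳ a refl = ∨-zeroʳ a

∧-intro : ∀ {a b} → a ≡ true → b ≡ true → a ∧ b ≡ true
∧-intro refl refl = refl

true⇔ : ∀ {a b} → (a ≡ true → b ≡ true) → (b ≡ true → a ≡ true) → a ≡ b
true⇔ {true}          f g = sym (f refl)
true⇔ {false} {true}  f g = g refl
true⇔ {false} {false} f g = refl

anyF-elim : ∀ {n} (f : Fin n → Bool) → anyF f ≡ true → ∃ λ x → f x ≡ true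
anyF-elim {suc n} f e with ∨-true (f F.zero) e
... | inj₁ p = F.zero , p
... | inj₂ p = let (x , q) = anyF-elim (f ∘ F.suc) p in F.suc x , q

anyF-intro : ∀ {n} (f : Fin n → Bool) x → f x ≡ true → anyF f ≡ true
anyF-intro f F.zero    p = ∨-introˡ _ p
anyF-intro f (F.suc x) p = ∨-introʳ (f F.zero) (anyF-intro (f ∘ F.suc) x p)

countF≡# : ∀ {n} (f : Fin n → Bool) → countF f ≡ # (fin n) f
countF≡# {zero}  f = refl
countF≡# {suc n} f = cong (bit (f F.zero) +_) (countF≡# (f ∘ F.suc))

∑-const : ∀ n k → ∑ (fin n) (λ _ → k) ≡ n * k
∑-const zero    k = refl
∑-const (suc n) k = cong (k +_) (∑-const n k)

#≤ : ∀ n (P : Fin n → Bool) → # (fin n) P ≤ n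
#≤ n P = ≤-trans (∑-mono (fin n) {g = λ _ → 1} λ x → bit≤1 (P x))
                 (≤-reflexive (trans (∑-const n 1) (*-identityʳ n)))

#-strict : ∀ n (P Q : Fin n → Bool) x → (∀ y → P y ≡ true → Q y ≡ true) →
           P x ≡ false → Q x ≡ true → # (fin n) P < # (fin n) Q
#-strict n P Q x sub px qx = begin
  suc (# (fin n) P)                          ≡⟨ +-comm 1 _ ⟩
  # (fin n) P + 1                            ≡⟨ cong (# (fin n) P +_) (sym (#-singleton (fin n) x)) ⟩
  # (fin n) P + # (fin n) (λ y → does (x ≟ y)) ≡⟨ sym (∑-+ (fin n) _ _) ⟩
  ∑ (fin n) (λ y → bit (P y) + bit (does (x ≟ y))) ≤⟨ ∑-mono (fin n) pw ⟩
  # (fin n) Q ∎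
  where
  open ≤-Reasoning
  pw : ∀ y → bit (P y) + bit (does (x ≟ y)) ≤ bit (Q y)
  pw y with x ≟ y
  ... | yes refl rewrite px | qx = ≤-refl
  ... | no _     = subst (_≤ bit (Q y)) (sym (+-identityʳ _)) (bit-mono (sub y))

degree≡# : ∀ {n} (G : Graph n) p → degree G p ≡ # (fin n) (adj G p)
degree≡# G p = countF≡# (adj G p)

-- Components and vertices of degree 2

module _ {n : ℕ} (G : Graph n) where

  comp-refl-at : ∀ k v → iterate k (reachStep G) (λ u → does (u ≟ v)) v ≡ true
  comp-refl-at zero    v = true-does (v ≟ v) refl
  comp-refl-at (suc k) v = ∨-introˡ _ (comp-refl-at k v)

  comp-refl : ∀ v → component G v v ≡ true
  comp-refl = comp-refl-at n

  comp-ind : ∀ {ℓ} (P : Fin n → Set ℓ) v → P v → (∀ p q → P p → adj G p q ≡ true → P q) →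
             ∀ u → component G v u ≡ true → P u
  comp-ind P v pv step = go n
    where
    go : ∀ k u → iterate k (reachStep G) (λ u → does (u ≟ v)) u ≡ true → P u
    go zero    u e = subst P (sym (does-true (u ≟ v) e)) pv
    go (suc k) u e with ∨-true (iterate k (reachStep G) (λ u → does (u ≟ v)) u) e
    ... | inj₁ h = go k u h
    ... | inj₂ h = let (i , h') = anyF-elim _ h
                   in step i u (go k i (∧-conicalˡ _ _ h')) (∧-conicalʳ _ _ h')

  Closed : (Fin n → Bool) → Set
  Closed S = ∀ p q → S p ≡ true → adj G p q ≡ true → S q ≡ true

  comp-closed : ∀ v → Closed (component G v)
  comp-closed v = [ (λ c → c) , (λ b → ⊥-elim (<⇒≱ b (#≤ n _))) ]′ (saturate n)
    where
    S : ℕ → Fin n → Bool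
    S k = iterate k (reachStep G) (λ u → does (u ≟ v))
    shrink : ∀ k → Closed (S k) → ∀ j → S (suc k) j ≡ true → S k j ≡ true
    shrink k c j e with ∨-true (S k j) e
    ... | inj₁ h = h
    ... | inj₂ h = let (i , h') = anyF-elim _ h in c i j (∧-conicalˡ _ _ h') (∧-conicalʳ _ _ h')
    saturate : ∀ k → Closed (S k) ⊎ suc k ≤ # (fin n) (S k)
    saturate zero = inj₂ (≤-trans (≤-reflexive (cong bit (sym (comp-refl-at zero v))))
                                  (∑-term (fin n) (bit ∘ S 0) v))
    saturate (suc k) with saturate k
    ... | inj₁ c = inj₁ λ p q sp a → ∨-introˡ _ (c p q (shrink k c p sp) a)
    ... | inj₂ b with FP.any? (λ j → (S k j B.≟ false) ×-dec (S (suc k) j B.≟ true))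
    ...   | yes (j , old , new) = inj₂ (≤-trans (s≤s b)
              (#-strict n (S k) (S (suc k)) j (λ y → ∨-introˡ _) old new))
    ...   | no none = inj₁ λ p q sp a → ∨-introˡ _ (c p q (shrink k c p sp) a)
      where
      c : Closed (S k)
      c p q sp a = ¬-not λ sq → none (q , sq , ∨-introʳ (S k q) (anyF-intro _ p (∧-intro sp a)))

  comp-trans : ∀ u v w → component G u v ≡ true → component G v w ≡ true → component G u w ≡ true
  comp-trans u v w uv vw = comp-ind (λ x → component G u x ≡ true) v uv
    (λ p q → comp-closed u p q) w vw

  comp-sym : ∀ u v → component G u v ≡ true → component G v u ≡ true
  comp-sym u v = comp-ind (λ x → component G x u ≡ true) u (comp-refl u)
    (λ p q pu a → comp-trans q p u (comp-closed q q p (comp-refl q) (trans (Graph.sym G q p) a)) pu) v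

  comp-least : ∀ S v → Closed S → S v ≡ true → ∀ u → component G v u ≡ true → S u ≡ true
  comp-least S v c sv = comp-ind (λ x → S x ≡ true) v sv c

  adj-distinct : ∀ {p q} → adj G p q ≡ true → p ≢ q
  adj-distinct {p} a refl = true≢false (trans (sym a) (irrefl G p))

  adj-flip : ∀ {p q t} → adj G p q ≡ t → adj G q p ≡ t
  adj-flip a = trans (Graph.sym G _ _) a

  other? : ∀ p q → Dec (∃ λ r → adj G q r ≡ true × r ≢ p)
  other? p q = FP.any? λ r → (adj G q r B.≟ true) ×-dec (¬? (r ≟ p))

  other : Fin n → Fin n → Fin n
  other p q with other? p q
  ... | yes (r , _) = r
  ... | no _        = q

  other-spec : ∀ p q → degree G q ≡ 2 → adj G q (other p q) ≡ true × other p q ≢ p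
  other-spec p q d with other? p q
  ... | yes (_ , s) = s
  ... | no none     = ⊥-elim (<⇒≱ (≤-refl {2}) (subst (_≤ 1) (trans (sym (degree≡# G q)) d)
        (#-unique (fin n) (adj G q) λ r s ar as → trans (only r ar) (sym (only s as)))))
    where
    only : ∀ r → adj G q r ≡ true → r ≡ p
    only r a with r ≟ p
    ... | yes e = e
    ... | no ne = ⊥-elim (none (r , a , ne))

  deg2-unique : ∀ {p q r s} → degree G q ≡ 2 → adj G q p ≡ true → adj G q r ≡ true → adj G q s ≡ true →
                r ≢ p → s ≢ p → r ≡ s
  deg2-unique {p} {q} {r} {s} d ap ar as rp sp with r ≟ s
  ... | yes e = e
  ... | no rs = ⊥-elim (<⇒≱ (≤-refl {3}) (begin
      3 ≡⟨ cong₂ _+_ (cong₂ _+_ (sym (#-singleton (fin n) p)) (sym (#-singleton (fin n) r))) (sym (#-singleton (fin n) s)) ⟩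
      ∑ (fin n) (δ p) + ∑ (fin n) (δ r) + ∑ (fin n) (δ s)
        ≡⟨ cong (_+ ∑ (fin n) (δ s)) (sym (∑-+ (fin n) (δ p) (δ r))) ⟩
      ∑ (fin n) (λ y → δ p y + δ r y) + ∑ (fin n) (δ s) ≡⟨ sym (∑-+ (fin n) _ (δ s)) ⟩
      ∑ (fin n) (λ y → δ p y + δ r y + δ s y) ≤⟨ ∑-mono (fin n) pw ⟩
      # (fin n) (adj G q) ≡⟨ trans (sym (degree≡# G q)) d ⟩
      2 ∎))
    where
    open ≤-Reasoning
    δ : Fin n → Fin n → ℕ
    δ x y = bit (does (x ≟ y))
    pw : ∀ y → δ p y + δ r y + δ s y ≤ bit (adj G q y)
    pw y with p ≟ y | r ≟ y | s ≟ y
    ... | yes refl | yes e    | _        = ⊥-elim (rp e)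
    ... | yes refl | no _     | yes e    = ⊥-elim (sp e)
    ... | yes refl | no _     | no _     rewrite ap = ≤-refl
    ... | no _     | yes refl | yes e    = ⊥-elim (rs (sym e))
    ... | no _     | yes refl | no _     rewrite ar = ≤-refl
    ... | no _     | no _     | yes refl rewrite as = ≤-refl
    ... | no _     | no _     | no _     = z≤n

comp-same : ∀ {n} (G H : Graph n) → SameGraph G H → ∀ v u → component G v u ≡ true → component H v u ≡ true
comp-same G H e v = comp-least G (component H v) v
  (λ p q hp a → comp-closed H v p q hp (trans (sym (e p q)) a)) (comp-refl H v)

-- Switchings

pr : ∀ {n} → Fin n → Fin n → Fin n → Fin n → Bool
pr a b p q = (does (p ≟ a) ∧ does (q ≟ b)) ∨ (does (p ≟ b) ∧ does (q ≟ a))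

module _ {n : ℕ} where

  pr-true : ∀ (a b p q : Fin n) → pr a b p q ≡ true → (p ≡ a × q ≡ b) ⊎ (p ≡ b × q ≡ a)
  pr-true a b p q e with ∨-true (does (p ≟ a) ∧ does (q ≟ b)) e
  ... | inj₁ h = inj₁ (does-true (p ≟ a) (∧-conicalˡ _ _ h) , does-true (q ≟ b) (∧-conicalʳ (does (p ≟ a)) _ h))
  ... | inj₂ h = inj₂ (does-true (p ≟ b) (∧-conicalˡ _ _ h) , does-true (q ≟ a) (∧-conicalʳ (does (p ≟ b)) _ h))

  pr-hit : ∀ (a b : Fin n) → pr a b a b ≡ true
  pr-hit a b = ∨-introˡ _ (∧-intro (true-does (a ≟ a) refl) (true-does (b ≟ b) refl))

  pr-hit′ : ∀ (a b : Fin n) → pr a b b a ≡ true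
  pr-hit′ a b = ∨-introʳ (does (b ≟ a) ∧ does (a ≟ b)) (∧-intro (true-does (b ≟ b) refl) (true-does (a ≟ a) refl))

  pr-miss : ∀ (a b p q : Fin n) → ¬ (p ≡ a × q ≡ b) → ¬ (p ≡ b × q ≡ a) → pr a b p q ≡ false
  pr-miss a b p q h h' = ¬-not λ e → [ h , h' ]′ (pr-true a b p q e)

  pr-swap : ∀ (a b p q : Fin n) → pr a b p q ≡ pr b a p q
  pr-swap a b p q = ∨-comm (does (p ≟ a) ∧ does (q ≟ b)) _

  pr-flip : ∀ (a b p q : Fin n) → pr a b p q ≡ pr a b q p
  pr-flip a b p q = true⇔ (f p q) (f q p)
    where
    f : ∀ p q → pr a b p q ≡ true → pr a b q p ≡ true
    f p q e with pr-true a b p q e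
    ... | inj₁ (refl , refl) = pr-hit′ a b
    ... | inj₂ (refl , refl) = pr-hit a b

  pr-adj : ∀ (G : Graph n) {a b t} p q → adj G a b ≡ t → pr a b p q ≡ true → adj G p q ≡ t
  pr-adj G {a} {b} p q h e with pr-true a b p q e
  ... | inj₁ (refl , refl) = h
  ... | inj₂ (refl , refl) = adj-flip G h

  cut : Graph n → Fin n → Fin n → Graph n
  cut G x y = record
    { adj    = λ p q → adj G p q ∧ not (pr x y p q)
    ; sym    = λ p q → cong₂ (λ a b → a ∧ not b) (Graph.sym G p q) (pr-flip x y p q)
    ; irrefl = λ p → cong (_∧ _) (irrefl G p)
    }

  removes adds : (v w x y p q : Fin n) → Bool
  removes v w x y p q = pr v w p q ∨ pr x y p q
  adds    v w x y p q = pr v y p q ∨ pr x w p q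

  sw : Graph n → (v w x y : Fin n) → Graph n
  sw G v w x y = record
    { adj    = λ p q → not (does (p ≟ q)) ∧ (adds v w x y p q ∨ (not (removes v w x y p q) ∧ adj G p q))
    ; sym    = λ p q → cong₂ (λ a b → not a ∧ b)
                 (true⇔ (λ e → true-does (q ≟ p) (sym (does-true (p ≟ q) e)))
                        (λ e → true-does (p ≟ q) (sym (does-true (q ≟ p) e))))
                 (cong₂ _∨_ (cong₂ _∨_ (pr-flip v y p q) (pr-flip x w p q))
                   (cong₂ (λ a b → not a ∧ b) (cong₂ _∨_ (pr-flip v w p q) (pr-flip x y p q)) (Graph.sym G p q)))
    ; irrefl = λ p → cong (λ b → not b ∧ (adds v w x y p p ∨ (not (removes v w x y p p) ∧ adj G p p)))
                 (true-does (p ≟ p) refl)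
    }

  record Switchable (G : Graph n) (v w x y : Fin n) : Set where
    field
      vw  : adj G v w ≡ true
      xy  : adj G x y ≡ true
      ¬vy : adj G v y ≡ false
      ¬xw : adj G x w ≡ false
      v≢x : v ≢ x
      w≢y : w ≢ y
      v≢y : v ≢ y
      x≢w : x ≢ w
    v≢w : v ≢ w
    v≢w = adj-distinct G vw

  sw-new : ∀ (G : Graph n) v w x y p q → adj (sw G v w x y) p q ≡ true →
           adj G p q ≡ true ⊎ pr v y p q ≡ true ⊎ pr x w p q ≡ true
  sw-new G v w x y p q e
    with ∨-true (adds v w x y p q) (∧-conicalʳ (not (does (p ≟ q))) _ e)
  ... | inj₁ h = inj₂ (∨-true (pr v y p q) h)
  ... | inj₂ h = inj₁ (∧-conicalʳ (not (removes v w x y p q)) _ h)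

  distinct-bit : ∀ {p q : Fin n} → p ≢ q → not (does (p ≟ q)) ≡ true
  distinct-bit {p} {q} ne = cong not (dec-false (p ≟ q) ne)

  sw-kept : ∀ (G : Graph n) v w x y p q → adj G p q ≡ true →
            ¬ (pr v w p q ≡ true) → ¬ (pr x y p q ≡ true) → adj (sw G v w x y) p q ≡ true
  sw-kept G v w x y p q a h h' = ∧-intro (distinct-bit (adj-distinct G a))
    (∨-introʳ (adds v w x y p q) (∧-intro (cong not (cong₂ _∨_ (¬-not h) (¬-not h'))) a))

  sw-old : ∀ (G : Graph n) v w x y p q → adj G p q ≡ true →
           adj (sw G v w x y) p q ≡ true ⊎ pr v w p q ≡ true ⊎ pr x y p q ≡ true
  sw-old G v w x y p q a with pr v w p q B.≟ true | pr x y p q B.≟ true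
  ... | yes h | _      = inj₂ (inj₁ h)
  ... | no _  | yes h  = inj₂ (inj₂ h)
  ... | no h  | no h'  = inj₁ (sw-kept G v w x y p q a h h')

  module _ {G : Graph n} {v w x y : Fin n} (s : Switchable G v w x y) where
    open Switchable s

    sw-vy : adj (sw G v w x y) v y ≡ true
    sw-vy = ∧-intro (distinct-bit v≢y) (∨-introˡ _ (∨-introˡ _ (pr-hit v y)))

    sw-xw : adj (sw G v w x y) x w ≡ true
    sw-xw = ∧-intro (distinct-bit x≢w) (∨-introˡ _ (∨-introʳ (pr v y x w) (pr-hit x w)))

    sw-¬vw : adj (sw G v w x y) v w ≡ false
    sw-¬vw = trans (cong (not (does (v ≟ w)) ∧_) (cong₂ (λ a b → a ∨ (not b ∧ adj G v w))
      (cong₂ _∨_ (pr-miss v y v w (λ e → w≢y (proj₂ e)) (λ e → v≢y (proj₁ e)))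
                 (pr-miss x w v w (λ e → v≢x (proj₁ e)) (λ e → v≢w (proj₁ e))))
      (∨-introˡ _ (pr-hit v w)))) (∧-zeroʳ _)

    sw-untouched : ∀ p q → adds v w x y p q ≡ false → removes v w x y p q ≡ false →
                   adj (sw G v w x y) p q ≡ adj G p q
    sw-untouched p q e e' with p ≟ q
    ... | yes refl = sym (irrefl G p)
    ... | no _     = cong₂ (λ a b → a ∨ (not b ∧ adj G p q)) e e'

    row-outside : ∀ p → p ≢ v → p ≢ w → p ≢ x → p ≢ y → ∀ q → adj (sw G v w x y) p q ≡ adj G p q
    row-outside p pv pw px py q = sw-untouched p q
      (cong₂ _∨_ (pr-miss v y p q (pv ∘ proj₁) (py ∘ proj₁)) (pr-miss x w p q (px ∘ proj₁) (pw ∘ proj₁)))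
      (cong₂ _∨_ (pr-miss v w p q (pv ∘ proj₁) (pw ∘ proj₁)) (pr-miss x y p q (px ∘ proj₁) (py ∘ proj₁)))

  #-exchange : ∀ (f g : Fin n → Bool) a b → f a ≡ true → f b ≡ false → g a ≡ false → g b ≡ true →
               (∀ z → z ≢ a → z ≢ b → f z ≡ g z) → # (fin n) f ≡ # (fin n) g
  #-exchange f g a b fa fb ga gb e = +-cancelʳ-≡ 1 _ _ (begin
    # (fin n) f + 1                               ≡⟨ plus f b ⟩
    ∑ (fin n) (λ z → bit (f z) + bit (does (b ≟ z))) ≡⟨ ∑-cong (fin n) pw ⟩
    ∑ (fin n) (λ z → bit (g z) + bit (does (a ≟ z))) ≡⟨ sym (plus g a) ⟩
    # (fin n) g + 1                               ∎)
    where
    open ≡-Reasoning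
    plus : ∀ h c → # (fin n) h + 1 ≡ ∑ (fin n) (λ z → bit (h z) + bit (does (c ≟ z)))
    plus h c = trans (cong (# (fin n) h +_) (sym (#-singleton (fin n) c))) (sym (∑-+ (fin n) _ _))
    pw : ∀ z → bit (f z) + bit (does (b ≟ z)) ≡ bit (g z) + bit (does (a ≟ z))
    pw z with b ≟ z | a ≟ z
    ... | yes refl | yes refl = contradiction (trans (sym fa) fb) true≢false
    ... | yes refl | no _     rewrite fb | gb = refl
    ... | no _     | yes refl rewrite fa | ga = refl
    ... | no bz    | no az    rewrite e z (az ∘ sym) (bz ∘ sym) = refl

  row-v : ∀ {G : Graph n} {v w x y} → Switchable G v w x y →
          # (fin n) (adj G v) ≡ # (fin n) (adj (sw G v w x y) v)
  row-v {G} {v} {w} {x} {y} s = #-exchange (adj G v) (adj (sw G v w x y) v) w y vw ¬vy (sw-¬vw s) (sw-vy s)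
    λ z zw zy → sym (sw-untouched s v z
      (cong₂ _∨_ (pr-miss v y v z (zy ∘ proj₂) (v≢y ∘ proj₁)) (pr-miss x w v z (v≢x ∘ proj₁) (v≢w ∘ proj₁)))
      (cong₂ _∨_ (pr-miss v w v z (zw ∘ proj₂) (v≢w ∘ proj₁)) (pr-miss x y v z (v≢x ∘ proj₁) (v≢y ∘ proj₁))))
    where open Switchable s

  flip-switchable : ∀ {G : Graph n} {v w x y} → Switchable G v w x y → Switchable G w v y x
  flip-switchable {G} s = record
    { vw = adj-flip G vw ; xy = adj-flip G xy ; ¬vy = adj-flip G ¬xw ; ¬xw = adj-flip G ¬vy
    ; v≢x = w≢y ; w≢y = v≢x ; v≢y = x≢w ∘ sym ; x≢w = v≢y ∘ sym }
    where open Switchable s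

  swap-switchable : ∀ {G : Graph n} {v w x y} → Switchable G v w x y → Switchable G x y v w
  swap-switchable {G} s = record
    { vw = xy ; xy = vw ; ¬vy = ¬xw ; ¬xw = ¬vy
    ; v≢x = v≢x ∘ sym ; w≢y = w≢y ∘ sym ; v≢y = x≢w ; x≢w = v≢y }
    where open Switchable s

  sw-flip : ∀ (G : Graph n) v w x y → SameGraph (sw G v w x y) (sw G w v y x)
  sw-flip G v w x y p q = cong (not (does (p ≟ q)) ∧_) (cong₂ (λ a b → a ∨ (not b ∧ adj G p q))
    (trans (∨-comm (pr v y p q) _) (cong₂ _∨_ (pr-swap x w p q) (pr-swap v y p q)))
    (cong₂ _∨_ (pr-swap v w p q) (pr-swap x y p q)))

  sw-swap : ∀ (G : Graph n) v w x y → SameGraph (sw G v w x y) (sw G x y v w)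
  sw-swap G v w x y p q = cong (not (does (p ≟ q)) ∧_) (cong₂ (λ a b → a ∨ (not b ∧ adj G p q))
    (∨-comm (pr v y p q) _) (∨-comm (pr v w p q) _))

  sw-¬xy : ∀ {G : Graph n} {v w x y} → Switchable G v w x y → adj (sw G v w x y) x y ≡ false
  sw-¬xy {G} {v} {w} {x} {y} s = trans (sw-swap G v w x y x y) (sw-¬vw (swap-switchable s))

  sw-degree : ∀ {G : Graph n} {v w x y} → Switchable G v w x y →
              ∀ p → degree (sw G v w x y) p ≡ degree G p
  sw-degree {G} {v} {w} {x} {y} s p = trans (degree≡# (sw G v w x y) p) (trans (rows (p ≟ v) (p ≟ w) (p ≟ x) (p ≟ y)) (sym (degree≡# G p)))
    where
    same : ∀ {H K : Graph n} → SameGraph H K → # (fin n) (adj H p) ≡ # (fin n) (adj K p)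
    same e = ∑-cong (fin n) λ q → cong bit (e p q)
    rows : Dec (p ≡ v) → Dec (p ≡ w) → Dec (p ≡ x) → Dec (p ≡ y) →
           # (fin n) (adj (sw G v w x y) p) ≡ # (fin n) (adj G p)
    rows (yes refl) _ _ _ = sym (row-v s)
    rows _ (yes refl) _ _ = trans (same {sw G v w x y} {sw G w v y x} (sw-flip G v w x y)) (sym (row-v (flip-switchable s)))
    rows _ _ (yes refl) _ = trans (same {sw G v w x y} {sw G x y v w} (sw-swap G v w x y)) (sym (row-v (swap-switchable s)))
    rows _ _ _ (yes refl) = trans (same {sw G v w x y} {sw G y x w v}
      λ i j → trans (sw-swap G v w x y i j) (sw-flip G x y v w i j)) (sym (row-v (flip-switchable (swap-switchable s))))
    rows (no a) (no b) (no c) (no d) = ∑-cong (fin n) λ q → cong bit (row-outside s p a b c d q)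

  sw-injective : ∀ {G H : Graph n} {v w x y} → Switchable G v w x y → Switchable H v w x y →
                 SameGraph (sw G v w x y) (sw H v w x y) → SameGraph G H
  sw-injective {G} {H} {v} {w} {x} {y} s t e p q
    with removes v w x y p q in er | adds v w x y p q in ea
  ... | true  | _     = trans (old G s (∨-true (pr v w p q) er)) (sym (old H t (∨-true (pr v w p q) er)))
    where
    old : ∀ K → Switchable K v w x y → pr v w p q ≡ true ⊎ pr x y p q ≡ true → adj K p q ≡ true
    old K u (inj₁ h) = pr-adj K p q (Switchable.vw u) h
    old K u (inj₂ h) = pr-adj K p q (Switchable.xy u) h
  ... | false | true  = trans (new G s (∨-true (pr v y p q) ea)) (sym (new H t (∨-true (pr v y p q) ea)))
    where
    new : ∀ K → Switchable K v w x y → pr v y p q ≡ true ⊎ pr x w p q ≡ true → adj K p q ≡ false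
    new K u (inj₁ h) = pr-adj K p q (Switchable.¬vy u) h
    new K u (inj₂ h) = pr-adj K p q (Switchable.¬xw u) h
  ... | false | false = trans (sym (sw-untouched s p q ea er)) (trans (e p q) (sw-untouched t p q ea er))

#-product : ∀ c d (A : El c → Bool) (B : El d → Bool) →
            # (c ⊗ d) (λ (a , b) → A a ∧ B b) ≡ # c A * # d B
#-product c d A B = trans (∑-cong c λ a → trans (∑-cong d λ b → trans (bit-∧ (A a) (B b)) (*-comm (bit (A a)) _))
                                                (trans (∑-* d (bit ∘ B) (bit (A a))) (*-comm _ (bit (A a)))))
                          (∑-* c (bit ∘ A) _)

#-lower : ∀ N c d (C : Fin N → Bool) (A : Fin N → El c → Bool) (B : Fin N → El d → Bool) k l α β →
  (∀ i → C i ≡ true → α ≤ k * # c (A i)) → (∀ i → C i ≡ true → β ≤ l * # d (B i)) →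
  # (fin N) C * (α * β) ≤ k * l * # (fin N ⊗ c ⊗ d) (λ (i , a , b) → C i ∧ (A i a ∧ B i b))
#-lower N c d C A B k l α β hα hβ = begin
  # (fin N) C * (α * β)                         ≡⟨ sym (∑-* (fin N) (bit ∘ C) (α * β)) ⟩
  ∑ (fin N) (λ i → bit (C i) * (α * β))         ≤⟨ ∑-mono (fin N) (λ i → step i (C i) refl) ⟩
  ∑ (fin N) (λ i → inner i * (k * l))                 ≡⟨ ∑-* (fin N) inner (k * l) ⟩
  ∑ (fin N) inner * (k * l)                           ≡⟨ *-comm (∑ (fin N) inner) (k * l) ⟩
  k * l * ∑ (fin N) inner ∎
  where
  open ≤-Reasoning
  inner : Fin N → ℕ
  inner i = ∑ c λ a → ∑ d λ b → bit (C i ∧ (A i a ∧ B i b))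
  step : ∀ i b → C i ≡ b → bit b * (α * β) ≤ inner i * (k * l)
  step i false e = z≤n
  step i true  e = begin
    1 * (α * β)                            ≡⟨ *-identityˡ _ ⟩
    α * β                                  ≤⟨ *-mono-≤ (hα i e) (hβ i e) ⟩
    (k * # c (A i)) * (l * # d (B i))      ≡⟨ [m*n]*[o*p]≡[m*o]*[n*p] k _ l _ ⟩
    k * l * (# c (A i) * # d (B i))        ≡⟨ *-comm (k * l) _ ⟩
    # c (A i) * # d (B i) * (k * l)        ≡⟨ cong (_* (k * l)) (sym (#-product c d (A i) (B i))) ⟩
    ∑ c (λ a → ∑ d λ b → bit (true ∧ (A i a ∧ B i b))) * (k * l)
      ≡⟨ cong (λ t → ∑ c (λ a → ∑ d λ b → bit (t ∧ (A i a ∧ B i b))) * (k * l)) (sym e) ⟩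
    inner i * (k * l) ∎

#-upper-scaled : ∀ N c d (A : Fin N → El c → Bool) (B : Fin N → El d → Bool) (C : Fin N → Bool) l α β →
  (∀ i → # c (A i) ≤ α) → (∀ i → l * # d (B i) ≤ β) →
  l * # (fin N ⊗ c ⊗ d) (λ (i , a , b) → C i ∧ (A i a ∧ B i b)) ≤ # (fin N) C * (α * β)
#-upper-scaled N c d A B C l α β hα hβ = begin
  l * # (fin N ⊗ c ⊗ d) (λ (i , a , b) → C i ∧ (A i a ∧ B i b)) ≡⟨ *-comm l _ ⟩
  ∑ (fin N) inner * l                           ≡⟨ sym (∑-* (fin N) inner l) ⟩
  ∑ (fin N) (λ i → inner i * l)                 ≤⟨ ∑-mono (fin N) (λ i → step i (C i)) ⟩
  ∑ (fin N) (λ i → bit (C i) * (α * β))         ≡⟨ ∑-* (fin N) (bit ∘ C) (α * β) ⟩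
  # (fin N) C * (α * β) ∎
  where
  open ≤-Reasoning
  inner : Fin N → ℕ
  inner i = ∑ c λ a → ∑ d λ b → bit (C i ∧ (A i a ∧ B i b))
  step : ∀ i t → ∑ c (λ a → ∑ d λ b → bit (t ∧ (A i a ∧ B i b))) * l ≤ bit t * (α * β)
  step i false = ≤-reflexive (cong (_* l) (trans (∑-cong c λ _ → ∑-0 d) (∑-0 c)))
  step i true  = begin
    ∑ c (λ a → ∑ d λ b → bit (A i a ∧ B i b)) * l ≡⟨ cong (_* l) (#-product c d (A i) (B i)) ⟩
    # c (A i) * # d (B i) * l                     ≡⟨ *-assoc (# c (A i)) _ l ⟩
    # c (A i) * (# d (B i) * l)                   ≡⟨ cong (# c (A i) *_) (*-comm _ l) ⟩
    # c (A i) * (l * # d (B i))                   ≤⟨ *-mono-≤ (hα i) (hβ i) ⟩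
    α * β                                         ≡⟨ sym (*-identityˡ _) ⟩
    1 * (α * β) ∎

#-upper : ∀ N c d (A : Fin N → El c → Bool) (B : Fin N → El d → Bool) (C : Fin N → Bool) α β →
  (∀ i → # c (A i) ≤ α) → (∀ i → # d (B i) ≤ β) →
  # (fin N ⊗ c ⊗ d) (λ (i , a , b) → C i ∧ (A i a ∧ B i b)) ≤ # (fin N) C * (α * β)
#-upper N c d A B C α β hα hβ = ≤-trans (≤-reflexive (sym (*-identityˡ _)))
  (#-upper-scaled N c d A B C 1 α β hα λ i → ≤-trans (≤-reflexive (*-identityˡ _)) (hβ i))

module _ {n : ℕ} where

  darts : Graph n → (Fin n → Bool) → ℕ
  darts G S = # (fin n ⊗ fin n) (λ (x , y) → S x ∧ adj G x y)

  ∑-darts : ∀ {D : DegSeq n} (G : Graph n) → HasDegSeq D G → (S : Fin n → Bool) →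
            darts G S ≡ ∑ (fin n) (λ x → bit (S x) * D x)
  ∑-darts {D} G h S = ∑-cong (fin n) λ x → row x (S x)
    where
    row : ∀ x t → ∑ (fin n) (λ y → bit (t ∧ adj G x y)) ≡ bit t * D x
    row x true  = trans (sym (degree≡# G x)) (trans (h x) (sym (*-identityˡ _)))
    row x false = ∑-0 (fin n)

  big-darts : ∀ {D : DegSeq n} (G : Graph n) → HasDegSeq D G → (∀ i → 1 ≤ D i) → ∀ S → # (fin n) S ≤ darts G S
  big-darts G h pos S = ≤-trans (∑-mono (fin n) λ x → ≤-trans (≤-reflexive (sym (*-identityʳ _))) (*-monoʳ-≤ (bit (S x)) (pos x)))
                              (≤-reflexive (sym (∑-darts G h S)))

  side-cover : ∀ (G : Graph n) x y → adj G x y ≡ true → ∀ u → component G x u ≡ true →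
    component (cut G x y) y u ≡ true ⊎ component (cut G y x) x u ≡ true
  side-cover G x y a u cu = ∨-true (component (cut G x y) y u) (comp-least G S x closed
      (∨-introʳ (component (cut G x y) y x) (comp-refl (cut G y x) x)) u cu)
    where
    S : Fin n → Bool
    S u = component (cut G x y) y u ∨ component (cut G y x) x u
    closed : Closed G S
    closed p q sp pq with pr x y p q in e
    ... | true with pr-true x y p q e
    ...   | inj₁ (refl , refl) = ∨-introˡ _ (comp-refl (cut G x y) y)
    ...   | inj₂ (refl , refl) = ∨-introʳ (component (cut G x y) y x) (comp-refl (cut G y x) x)
    closed p q sp pq | false with ∨-true (component (cut G x y) y p) sp
    ...   | inj₁ h = ∨-introˡ _ (comp-closed (cut G x y) y p q h (∧-intro pq (cong not e)))
    ...   | inj₂ h = ∨-introʳ (component (cut G x y) y q) (comp-closed (cut G y x) x p q h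
                       (∧-intro pq (cong not (trans (pr-swap y x p q) e))))

  sides : Graph n → (Fin n → Bool) → (Fin n × Fin n) × Fin n → Bool
  sides G S ((x , y) , u) = (S x ∧ adj G x y) ∧ component (cut G x y) y u

  sides-lower : ∀ {D : DegSeq n} (G : Graph n) → HasDegSeq D G → (∀ i → 1 ≤ D i) → ∀ z t →
    t ≤ # (fin n) (component G z) →
    t * t ≤ 2 * # ((fin n ⊗ fin n) ⊗ fin n) (sides G (component G z))
  sides-lower {D} G h pos z t t≤ = begin
    t * t                                 ≤⟨ *-mono-≤ (≤-trans t≤ (big-darts G h pos S)) t≤ ⟩
    darts G S * # (fin n) S               ≡⟨ sym (∑-* (fin n ⊗ fin n) (λ (x , y) → bit (S x ∧ adj G x y)) (# (fin n) S)) ⟩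
    ∑ (fin n) (λ x → ∑ (fin n) λ y → bit (S x ∧ adj G x y) * # (fin n) S)
      ≤⟨ ∑-mono (fin n ⊗ fin n) (λ (x , y) → pair x y (S x ∧ adj G x y) refl) ⟩
    ∑ (fin n) (λ x → ∑ (fin n) λ y → f x y + f y x)
      ≡⟨ ∑-+ (fin n ⊗ fin n) (λ (x , y) → f x y) (λ (x , y) → f y x) ⟩
    F + ∑ (fin n) (λ x → ∑ (fin n) λ y → f y x) ≡⟨ cong (F +_) (sym (∑-swap (fin n) (fin n) f)) ⟩
    F + F                                 ≡⟨ cong (F +_) (sym (+-identityʳ F)) ⟩
    2 * F ∎
    where
    open ≤-Reasoning
    S : Fin n → Bool
    S = component G z
    f : Fin n → Fin n → ℕ
    f x y = # (fin n) λ u → sides G S ((x , y) , u)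
    F : ℕ
    F = ∑ (fin n) λ x → ∑ (fin n) (f x)
    pair : ∀ x y b → S x ∧ adj G x y ≡ b → bit b * # (fin n) S ≤ f x y + f y x
    pair x y false e = z≤n
    pair x y true  e = ≤-trans (≤-reflexive (*-identityˡ _))
      (≤-trans (∑-mono (fin n) cover) (≤-reflexive (∑-+ (fin n) _ _)))
      where
      sx : S x ≡ true
      sx = ∧-conicalˡ _ _ e
      axy : adj G x y ≡ true
      axy = ∧-conicalʳ (S x) _ e
      cover : ∀ u → bit (S u) ≤ bit (sides G S ((x , y) , u)) + bit (sides G S ((y , x) , u))
      cover u with S u in su
      ... | false = z≤n
      ... | true with side-cover G x y axy u (comp-trans G x z u (comp-sym G z x sx) su)
      ...   | inj₁ h = ≤-trans (≤-reflexive (cong bit (sym (∧-intro e h)))) (m≤m+n _ _)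
      ...   | inj₂ h = ≤-trans (≤-reflexive (cong bit (sym (∧-intro (∧-intro (comp-closed G z x y sx axy) (adj-flip G axy)) h))))
                               (m≤n+m _ _)

  boundary : ∀ {G : Graph n} {S} v w x y → Closed G S → S v ≡ false → S w ≡ false →
    ∀ p q → S p ≡ true → S q ≡ false → adj (sw G v w x y) p q ≡ true → (p ≡ y × q ≡ v) ⊎ (p ≡ x × q ≡ w)
  boundary {G} {S} v w x y c sv sw′ p q sp sq a with sw-new G v w x y p q a
  ... | inj₁ h = contradiction (trans (sym (c p q sp h)) sq) true≢false
  ... | inj₂ (inj₁ h) with pr-true v y p q h
  ...   | inj₁ (refl , _) = contradiction (trans (sym sp) sv) true≢false
  ...   | inj₂ e = inj₁ e
  boundary {G} {S} v w x y c sv sw′ p q sp sq a | inj₂ (inj₂ h) with pr-true x w p q h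
  ...   | inj₁ e = inj₂ e
  ...   | inj₂ (refl , _) = contradiction (trans (sym sp) sw′) true≢false

  record Across (G : Graph n) (S : Fin n → Bool) (v w x y : Fin n) : Set where
    field
      sx : S x ≡ true
      xy : adj G x y ≡ true
      sv : S v ≡ false
      vw : adj G v w ≡ true

  module _ {G : Graph n} {S} {v w x y} (c : Closed G S) (o : Across G S v w x y) where
    open Across o

    across-y : S y ≡ true
    across-y = c x y sx xy

    across-w : S w ≡ false
    across-w = ¬-not λ h → true≢false (trans (sym (c w v h (adj-flip G vw))) sv)

    private
      apart : ∀ {p q} → S p ≡ true → S q ≡ false → p ≢ q
      apart sp sq refl = true≢false (trans (sym sp) sq)

    across-switchable : Switchable G v w x y
    across-switchable = record
      { vw = vw ; xy = xy
      ; ¬vy = ¬-not λ h → true≢false (trans (sym (c y v across-y (adj-flip G h))) sv)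
      ; ¬xw = ¬-not λ h → true≢false (trans (sym (c x w sx h)) across-w)
      ; v≢x = apart sx sv ∘ sym
      ; w≢y = apart across-y across-w ∘ sym
      ; v≢y = apart across-y sv ∘ sym
      ; x≢w = apart sx across-w }

  -- If y lay outside S′, then S ∩ S′ would be closed in G − xy, so together with u it would contain y.
  merge-unique : ∀ {G H : Graph n} {S S′} {v v′ w x y y′} → Closed G S → Closed H S′ →
    Across G S v w x y → Across H S′ v′ w x y′ → S′ v ≡ false → S v′ ≡ false →
    SameGraph (sw G v w x y) (sw H v′ w x y′) → ∀ u →
    component (cut G x y) y u ≡ true → component (cut H x y′) y′ u ≡ true → y ≡ y′ × v ≡ v′
  merge-unique {G} {H} {S} {S′} {v} {v′} {w} {x} {y} {y′} c c′ o o′ s′v sv′ e u cu cu′ with S′ y in s′y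
  ... | true with boundary {H} v′ w x y′ c′ (Across.sv o′) (across-w {H} c′ o′) y v s′y s′v
                    (trans (sym (e y v)) (adj-flip (sw G v w x y) {v} {y} (sw-vy (across-switchable {G} c o))))
  ...   | inj₁ r = r
  ...   | inj₂ (y≡x , _) = contradiction (sym y≡x) (adj-distinct G (Across.xy o))
  merge-unique {G} {H} {S} {S′} {v} {v′} {w} {x} {y} {y′} c c′ o o′ s′v sv′ e u cu cu′ | false =
    contradiction (trans (sym (∧-conicalʳ (S y) _ Iy)) s′y) true≢false
    where
    within : ∀ {K : Graph n} {T} {a b} → Closed K T → T b ≡ true → component (cut K a b) b u ≡ true → T u ≡ true
    within {K} {T} {a} {b} ct tb = comp-least (cut K a b) T b (λ p q tp pq → ct p q tp (∧-conicalˡ _ _ pq)) tb u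
    I : Fin n → Bool
    I p = S p ∧ S′ p
    closed : Closed (cut G x y) I
    closed p q ip pq = ∧-intro sq (¬-not out)
      where
      sp : S p ≡ true
      sp = ∧-conicalˡ _ _ ip
      apq : adj G p q ≡ true
      apq = ∧-conicalˡ _ _ pq
      sq : S q ≡ true
      sq = c p q sp apq
      out : ¬ S′ q ≡ false
      out s′q with boundary {H} v′ w x y′ c′ (Across.sv o′) (across-w {H} c′ o′) p q (∧-conicalʳ (S p) _ ip) s′q
                     (trans (sym (e p q)) (sw-kept G v w x y p q apq ¬vw
                       λ h → true≢false (trans (sym h) (not-true (∧-conicalʳ (adj G p q) _ pq)))))
        where
        ¬vw : ¬ pr v w p q ≡ true
        ¬vw h with pr-true v w p q h
        ... | inj₁ (refl , _) = true≢false (trans (sym sp) (Across.sv o))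
        ... | inj₂ (_ , refl) = true≢false (trans (sym sq) (Across.sv o))
      ... | inj₁ (_ , refl) = true≢false (trans (sym sq) sv′)
      ... | inj₂ (_ , refl) = true≢false (trans (sym sq) (across-w {G} c o))
    Iy : I y ≡ true
    Iy = comp-least (cut G x y) I u closed
      (∧-intro (within {G} c (across-y c o) cu) (within {H} c′ (across-y c′ o′) cu′)) y (comp-sym (cut G x y) y u cu)

-- Edge cuts of size at most 2

module _ {n : ℕ} (G : Graph n) where

  crossing : (U T : Fin n → Bool) → Fin n → Fin n → Bool
  crossing U T p q = (U p ∧ U q) ∧ ((T p ∧ not (T q)) ∧ adj G p q)

  crossings : (U T : Fin n → Bool) → ℕ
  crossings U T = # (fin n ⊗ fin n) (λ (p , q) → crossing U T p q)

  Separated : (U T : Fin n → Bool) → Fin n → Fin n → Set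
  Separated U T v w = T v ≡ true × T w ≡ false × crossings U T ≤ 2

  abstract
    separable? : ∀ U v w → Dec (∃ λ (s : Subset n) → Separated U (V.lookup s) v w)
    separable? U v w = anySubset? λ s →
      (V.lookup s v B.≟ true) ×-dec ((V.lookup s w B.≟ false) ×-dec (crossings U (V.lookup s) ≤? 2))

    separable : (U : Fin n → Bool) → Fin n → Fin n → Bool
    separable U v w = does (separable? U v w)

    separable-elim : ∀ U v w → separable U v w ≡ true → ∃ λ (s : Subset n) → Separated U (V.lookup s) v w
    separable-elim U v w = does-true (separable? U v w)

    separable-intro : ∀ U T v w → Separated U T v w → separable U v w ≡ true
    separable-intro U T v w (tv , tw , c) = true-does (separable? U v w)
      (tabulate T , trans (lookup∘tabulate T v) tv , trans (lookup∘tabulate T w) tw ,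
       ≤-trans (≤-reflexive (∑-cong (fin n ⊗ fin n) λ (p , q) →
         cong₂ (λ a b → bit ((U p ∧ U q) ∧ ((a ∧ not b) ∧ adj G p q))) (lookup∘tabulate T p) (lookup∘tabulate T q))) c)

  weak : (U : Fin n → Bool) → Fin n × Fin n → Bool
  weak U (v , w) = (U v ∧ U w) ∧ (adj G v w ∧ separable U v w)

  private
    dd = fin n ⊗ fin n

  module _ (U T : Fin n → Bool) where

    part₁ part₂ : Fin n → Bool
    part₁  p = U p ∧ T p
    part₂ p = U p ∧ not (T p)

    size-split : # (fin n) U ≡ # (fin n) part₁ + # (fin n) part₂
    size-split = trans (∑-cong (fin n) λ p → pw (U p) (T p)) (∑-+ (fin n) (bit ∘ part₁) (bit ∘ part₂))
      where
      pw : ∀ a b → bit a ≡ bit (a ∧ b) + bit (a ∧ not b)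
      pw false _    = refl
      pw true true  = refl
      pw true false = refl

    weak-split : # dd (weak U) ≤ (# dd (weak part₁) + # dd (weak part₂)) + (crossings U T + crossings U T)
    weak-split = begin
      # dd (weak U) ≤⟨ ∑-mono dd (λ (p , q) → classify p q _ _ _ refl refl refl) ⟩
      ∑ dd (λ (p , q) → (bit (weak part₁ (p , q)) + bit (weak part₂ (p , q)))
                        + (bit (crossing U T p q) + bit (crossing U T q p)))
        ≡⟨ ∑-+ dd (λ e → bit (weak part₁ e) + bit (weak part₂ e)) (λ (p , q) → bit (crossing U T p q) + bit (crossing U T q p)) ⟩
      ∑ dd (λ e → bit (weak part₁ e) + bit (weak part₂ e)) + ∑ dd (λ (p , q) → bit (crossing U T p q) + bit (crossing U T q p))
        ≡⟨ cong₂ _+_ (∑-+ dd (bit ∘ weak part₁) (bit ∘ weak part₂))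
                     (∑-+ dd (λ (p , q) → bit (crossing U T p q)) (λ (p , q) → bit (crossing U T q p))) ⟩
      (# dd (weak part₁) + # dd (weak part₂)) + (crossings U T + # dd (λ (p , q) → crossing U T q p))
        ≡⟨ cong (λ a → (# dd (weak part₁) + # dd (weak part₂)) + (crossings U T + a))
                (∑-swap (fin n) (fin n) λ p q → bit (crossing U T q p)) ⟩
      (# dd (weak part₁) + # dd (weak part₂)) + (crossings U T + crossings U T) ∎
      where
      open ≤-Reasoning
      restrict : ∀ R → (∀ p → R p ≡ true → U p ≡ true) → ∀ p q → R p ≡ true → R q ≡ true →
                 weak U (p , q) ≡ true → weak R (p , q) ≡ true
      restrict R sub p q vp vq e = ∧-intro (∧-intro vp vq) (∧-intro (∧-conicalˡ _ _ e′) (separable-intro R (V.lookup (proj₁ s₀)) p q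
          (proj₁ s , proj₁ (proj₂ s) , ≤-trans (#-mono dd λ (a , c) h →
            ∧-intro (∧-intro (sub a (∧-conicalˡ _ _ (∧-conicalˡ _ _ h))) (sub c (∧-conicalʳ (R a) _ (∧-conicalˡ _ _ h))))
                    (∧-conicalʳ (R a ∧ R c) _ h)) (proj₂ (proj₂ s)))))
        where
        e′ : adj G p q ∧ separable U p q ≡ true
        e′ = ∧-conicalʳ (U p ∧ U q) _ e
        s₀ = separable-elim U p q (∧-conicalʳ (adj G p q) _ e′)
        s = proj₂ s₀
      at : ∀ {b} k → b ≡ true → 1 + k ≡ bit b + k
      at k refl = refl
      classify : ∀ p q t a b → weak U (p , q) ≡ t → T p ≡ a → T q ≡ b → bit t ≤
        (bit (weak part₁ (p , q)) + bit (weak part₂ (p , q))) + (bit (crossing U T p q) + bit (crossing U T q p))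
      classify p q false a b e tp tq = z≤n
      classify p q true a b e tp tq = go a b tp tq
        where
        up : U p ≡ true
        up = ∧-conicalˡ _ _ (∧-conicalˡ _ _ e)
        uq : U q ≡ true
        uq = ∧-conicalʳ (U p) _ (∧-conicalˡ _ _ e)
        a′ : adj G p q ≡ true
        a′ = ∧-conicalˡ _ _ (∧-conicalʳ (U p ∧ U q) _ e)
        I O X Y : ℕ
        I = bit (weak part₁ (p , q))
        O = bit (weak part₂ (p , q))
        X = bit (crossing U T p q)
        Y = bit (crossing U T q p)
        one : ∀ {b} → b ≡ true → 1 ≤ bit b
        one refl = ≤-refl
        go : ∀ a b → T p ≡ a → T q ≡ b → 1 ≤ (I + O) + (X + Y)
        go true true tp tq = ≤-trans (one (restrict part₁ (λ r → ∧-conicalˡ _ _) p q (∧-intro up tp) (∧-intro uq tq) e))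
          (≤-trans (m≤m+n I O) (m≤m+n _ _))
        go false false tp tq = ≤-trans (one (restrict part₂ (λ r → ∧-conicalˡ _ _) p q
            (∧-intro up (cong not tp)) (∧-intro uq (cong not tq)) e))
          (≤-trans (m≤n+m O I) (m≤m+n _ _))
        go true false tp tq = ≤-trans (one {crossing U T p q} (∧-intro (∧-intro up uq) (∧-intro (∧-intro tp (cong not tq)) a′)))
          (≤-trans (m≤m+n X Y) (m≤n+m _ (I + O)))
        go false true tp tq = ≤-trans (one {crossing U T q p} (∧-intro (∧-intro uq up) (∧-intro (∧-intro tq (cong not tp)) (adj-flip G a′))))
          (≤-trans (m≤n+m Y X) (m≤n+m _ (I + O)))

  -- A cut of size at most 2 splits U into two nonempty parts, and every dart counted in U
  -- crosses the cut or is counted in one of the parts.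
  weak-bound : ∀ k U → # (fin n) U ≤ k → 1 ≤ # (fin n) U → # dd (weak U) + 4 ≤ 4 * # (fin n) U
  weak-bound zero    U b p = contradiction p (<⇒≱ (s≤s b))
  weak-bound (suc k) U b p = go (# dd (weak U)) refl
    where
    via : ∀ v w → weak U (v , w) ≡ true → ∀ T → Separated U T v w → # dd (weak U) + 4 ≤ 4 * # (fin n) U
    via v w e T (tv , tw , c) = begin
      # dd (weak U) + 4                         ≤⟨ +-monoˡ-≤ 4 (≤-trans (weak-split U T) (+-monoʳ-≤ (W₁ + W₂) (+-mono-≤ c c))) ⟩
      (W₁ + W₂) + 4 + 4                         ≡⟨ rearrange W₁ W₂ ⟩
      (W₁ + 4) + (W₂ + 4)                       ≤⟨ +-mono-≤
        (weak-bound k U₁ (s≤s⁻¹ (≤-trans (≤-trans (≤-reflexive (+-comm 1 _)) (+-monoʳ-≤ n₁ pos₂)) fits)) pos₁)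
        (weak-bound k U₂ (s≤s⁻¹ (≤-trans (+-monoˡ-≤ n₂ pos₁) fits)) pos₂) ⟩
      4 * n₁ + 4 * n₂                           ≡⟨ sym (*-distribˡ-+ 4 n₁ n₂) ⟩
      4 * (n₁ + n₂)                             ≡⟨ cong (4 *_) (sym (size-split U T)) ⟩
      4 * # (fin n) U ∎
      where
      open ≤-Reasoning
      U₁ U₂ : Fin n → Bool
      U₁ = part₁ U T
      U₂ = part₂ U T
      W₁ W₂ n₁ n₂ : ℕ
      W₁ = # dd (weak U₁)
      W₂ = # dd (weak U₂)
      n₁ = # (fin n) U₁
      n₂ = # (fin n) U₂
      one : ∀ R {p} → R p ≡ true → 1 ≤ # (fin n) R
      one R {p} vp = ≤-trans (≤-reflexive (cong bit (sym vp))) (∑-term (fin n) (bit ∘ R) p)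
      pos₁ : 1 ≤ n₁
      pos₁ = one U₁ {v} (∧-intro (∧-conicalˡ _ _ (∧-conicalˡ _ _ e)) tv)
      pos₂ : 1 ≤ n₂
      pos₂ = one U₂ {w} (∧-intro (∧-conicalʳ (U v) _ (∧-conicalˡ _ _ e)) (cong not tw))
      fits : n₁ + n₂ ≤ suc k
      fits = ≤-trans (≤-reflexive (sym (size-split U T))) b
      rearrange : ∀ a b → a + b + 4 + 4 ≡ (a + 4) + (b + 4)
      rearrange = solve-∀
    go : ∀ m → # dd (weak U) ≡ m → # dd (weak U) + 4 ≤ 4 * # (fin n) U
    go zero    none = ≤-trans (≤-reflexive (cong (_+ 4) none)) (*-monoʳ-≤ 4 p)
    go (suc m) some =
      let ((v , w) , h) = ∑-pos dd (bit ∘ weak U) (subst (0 <_) (sym some) (s≤s z≤n))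
          e = bit-pos h
          (s , sep) = separable-elim U v w (∧-conicalʳ (adj G v w) _ (∧-conicalʳ (U v ∧ U w) _ e))
      in via v w e (V.lookup s) sep

  everywhere : Fin n → Bool
  everywhere _ = true

  weak-total : # dd (weak everywhere) ≤ 4 * n
  weak-total with # (fin n) everywhere in e
  ... | zero  = ≤-trans (≤-trans (∑-mono dd {g = λ _ → 0} λ (p , q) →
                  ⊥-elim (<⇒≱ (∑-term (fin n) (bit ∘ everywhere) p) (≤-reflexive e)))
                  (≤-reflexive (∑-0 dd))) z≤n
  ... | suc m = ≤-trans (m≤m+n _ 4) (≤-trans (weak-bound n everywhere (#≤ n everywhere)
                  (subst (1 ≤_) (sym e) (s≤s z≤n))) (*-monoʳ-≤ 4 (#≤ n everywhere)))

module _ {n : ℕ} (D : DegSeq n) where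

  branch : Fin n → Bool
  branch v = not (D v ≡ᵇ 2)

  mass : (Fin n → Bool) → ℕ
  mass S = ∑ (fin n) λ x → bit (S x) * (if D x ≡ᵇ 2 then 0 else D x)

  branch-degree : ∀ x → bit (branch x) * D x ≡ (if D x ≡ᵇ 2 then 0 else D x)
  branch-degree x with D x ≡ᵇ 2
  ... | true  = refl
  ... | false = *-identityˡ _

  degree-split : ∀ x → D x ≡ (if D x ≡ᵇ 2 then 0 else D x) + 2 * bit (D x ≡ᵇ 2)
  degree-split x with D x ≡ᵇ 2 in e
  ... | true  = ≡ᵇ⇒≡ (D x) 2 (subst B.T (sym e) _)
  ... | false = sym (+-identityʳ _)

  degree-sum : ∑ (fin n) D ≡ M D + 2 * # (fin n) (λ x → D x ≡ᵇ 2)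
  degree-sum = trans (∑-cong (fin n) degree-split) (trans (∑-+ (fin n) _ _)
    (cong (M D +_) (trans (∑-cong (fin n) λ x → *-comm 2 (bit (D x ≡ᵇ 2))) (trans (∑-* (fin n) (λ x → bit (D x ≡ᵇ 2)) 2) (*-comm (# (fin n) λ x → D x ≡ᵇ 2) 2)))))

  degree-sum-≤ : ∑ (fin n) D ≤ M D + 2 * n
  degree-sum-≤ = ≤-trans (≤-reflexive degree-sum) (+-monoʳ-≤ (M D) (*-monoʳ-≤ 2 (#≤ n _)))

  degree-sum-in : ∀ S → ∑ (fin n) (λ x → bit (S x) * D x) ≤ mass S + 2 * # (fin n) (λ x → D x ≡ᵇ 2)
  degree-sum-in S = ≤-trans (∑-mono (fin n) pw) (≤-reflexive (trans (∑-+ (fin n) _ (λ x → bit (D x ≡ᵇ 2) * 2))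
    (cong (mass S +_) (trans (∑-* (fin n) (λ x → bit (D x ≡ᵇ 2)) 2) (*-comm (# (fin n) λ x → D x ≡ᵇ 2) 2)))))
    where
    pw : ∀ x → bit (S x) * D x ≤ bit (S x) * (if D x ≡ᵇ 2 then 0 else D x) + bit (D x ≡ᵇ 2) * 2
    pw x with S x
    ... | false = z≤n
    ... | true  = ≤-reflexive (trans (*-identityˡ _) (trans (degree-split x)
                    (cong₂ _+_ (sym (*-identityˡ (if D x ≡ᵇ 2 then 0 else D x))) (*-comm 2 (bit (D x ≡ᵇ 2))))))

  branch-darts : ∀ {G} → HasDegSeq D G → # (fin n ⊗ fin n) (λ (v , w) → branch v ∧ adj G v w) ≡ M D
  branch-darts {G} h = trans (∑-darts G h branch) (∑-cong (fin n) branch-degree)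

  branch-in : ∀ S → mass S ≢ 0 → ∃ λ a → S a ≡ true × branch a ≡ true
  branch-in S ne with ∑-pos (fin n) (λ x → bit (S x) * (if D x ≡ᵇ 2 then 0 else D x)) (n≢0⇒n>0 ne)
  ... | a , p = a , go (S a) (D a ≡ᵇ 2) p
    where
    go : ∀ s d → 0 < bit s * (if d then 0 else D a) → s ≡ true × not d ≡ true
    go true false _ = refl , refl

record Space {n : ℕ} (D : DegSeq n) : Set where
  field
    size       : ℕ
    graph      : Fin size → Graph n
    degrees    : ∀ i → HasDegSeq D (graph i)
    index      : ∀ G → HasDegSeq D G → Fin size
    index-same : ∀ G h → SameGraph G (graph (index G h))
    distinct   : ∀ i j → SameGraph (graph i) (graph j) → i ≡ j

module _ {n : ℕ} {D : DegSeq n} (pos : ∀ i → 1 ≤ D i) (Ω : Space D) where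
  open Space Ω

  index-≡ : ∀ {G H h k} → index G h ≡ index H k → SameGraph G H
  index-≡ {G} {H} {h} {k} e p q = trans (index-same G h p q)
    (trans (cong (λ i → adj (graph i) p q) e) (sym (index-same H k p q)))

  sw-degseq : ∀ i {v w x y} → Switchable (graph i) v w x y → HasDegSeq D (sw (graph i) v w x y)
  sw-degseq i s p = trans (sw-degree s p) (degrees i p)

  module Merge (C : Fin size → Bool) (z : Fin size → Fin n) (out : Fin size → Fin n × Fin n → Bool) where

    S : Fin size → Fin n → Bool
    S i = component (graph i) (z i)

    closed : ∀ i → Closed (graph i) (S i)
    closed i = comp-closed (graph i) (z i)

    Outside Apart : Set
    Outside = ∀ i v w → C i ≡ true → out i (v , w) ≡ true → S i v ≡ false × adj (graph i) v w ≡ true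
    Apart = ∀ i j v w x y v′ y′ → C i ≡ true → C j ≡ true → out i (v , w) ≡ true → out j (v′ , w) ≡ true →
      Across (graph i) (S i) v w x y → Across (graph j) (S j) v′ w x y′ →
      SameGraph (sw (graph i) v w x y) (sw (graph j) v′ w x y′) → S j v ≡ false

    merge-bound : Outside → Apart → ∀ g l β →
      (∀ i → C i ≡ true → n ≤ g * # (fin n) (S i)) → (∀ i → C i ≡ true → β ≤ l * # (fin n ⊗ fin n) (out i)) →
      # (fin size) C * (n * n * β) ≤ g * g * 2 * l * (size * ((M D + 2 * n) * n))
    merge-bound outside apart g l β big many = begin
      # (fin size) C * (n * n * β)        ≤⟨ #-lower size ((fin n ⊗ fin n) ⊗ fin n) (fin n ⊗ fin n)
                                               C (λ i → sides (graph i) (S i)) out (g * g * 2) l (n * n) β sides≥ many ⟩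
      g * g * 2 * l * # source P          ≤⟨ *-monoʳ-≤ (g * g * 2 * l) (#-injection source target P Q f f-in f-inj) ⟩
      g * g * 2 * l * # target Q          ≤⟨ *-monoʳ-≤ (g * g * 2 * l) (#-upper size (fin n ⊗ fin n) (fin n)
                                               (λ j (x , w) → adj (graph j) x w) (λ _ _ → true) (λ _ → true)
                                               (M D + 2 * n) n darts≤ (λ _ → #≤ n _)) ⟩
      g * g * 2 * l * (# (fin size) (λ _ → true) * ((M D + 2 * n) * n))
        ≤⟨ *-monoʳ-≤ (g * g * 2 * l) (*-monoˡ-≤ _ (#≤ size _)) ⟩
      g * g * 2 * l * (size * ((M D + 2 * n) * n)) ∎
      where
      open ≤-Reasoning
      source target : Code
      source = fin size ⊗ ((fin n ⊗ fin n) ⊗ fin n) ⊗ (fin n ⊗ fin n)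
      target = fin size ⊗ (fin n ⊗ fin n) ⊗ fin n
      P : El source → Bool
      P (i , a , b) = C i ∧ (sides (graph i) (S i) a ∧ out i b)
      Q : El target → Bool
      Q (j , (x , w) , u) = true ∧ (adj (graph j) x w ∧ true)
      sides≥ : ∀ i → C i ≡ true → n * n ≤ g * g * 2 * # ((fin n ⊗ fin n) ⊗ fin n) (sides (graph i) (S i))
      sides≥ i c = begin
        n * n                                           ≤⟨ *-mono-≤ (big i c) (big i c) ⟩
        g * # (fin n) (S i) * (g * # (fin n) (S i))     ≡⟨ [m*n]*[o*p]≡[m*o]*[n*p] g _ g _ ⟩
        g * g * (# (fin n) (S i) * # (fin n) (S i))     ≤⟨ *-monoʳ-≤ (g * g) (sides-lower (graph i) (degrees i) pos (z i) _ ≤-refl) ⟩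
        g * g * (2 * # ((fin n ⊗ fin n) ⊗ fin n) (sides (graph i) (S i)))
          ≡⟨ sym (*-assoc (g * g) 2 (# ((fin n ⊗ fin n) ⊗ fin n) (sides (graph i) (S i)))) ⟩
        g * g * 2 * # ((fin n ⊗ fin n) ⊗ fin n) (sides (graph i) (S i)) ∎
      darts≤ : ∀ j → # (fin n ⊗ fin n) (λ (x , w) → adj (graph j) x w) ≤ M D + 2 * n
      darts≤ j = ≤-trans (≤-reflexive (trans (∑-darts (graph j) (degrees j) (λ _ → true)) (∑-cong (fin n) λ x → *-identityˡ _)))
                         (degree-sum-≤ D)
      across : ∀ i x y u v w → P (i , ((x , y) , u) , (v , w)) ≡ true → Across (graph i) (S i) v w x y
      across i x y u v w p = record
        { sx = ∧-conicalˡ _ _ xy∈ ; xy = ∧-conicalʳ (S i x) _ xy∈ ; sv = proj₁ vw∈ ; vw = proj₂ vw∈ }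
        where
        ab : sides (graph i) (S i) ((x , y) , u) ∧ out i (v , w) ≡ true
        ab = ∧-conicalʳ (C i) _ p
        xy∈ : S i x ∧ adj (graph i) x y ≡ true
        xy∈ = ∧-conicalˡ _ _ (∧-conicalˡ _ _ ab)
        vw∈ : S i v ≡ false × adj (graph i) v w ≡ true
        vw∈ = outside i v w (∧-conicalˡ _ _ p) (∧-conicalʳ (sides (graph i) (S i) ((x , y) , u)) _ ab)
      switch : ∀ i x y u v w → P (i , ((x , y) , u) , (v , w)) ≡ true → Switchable (graph i) v w x y
      switch i x y u v w p = across-switchable {G = graph i} (closed i) (across i x y u v w p)
      f : ∀ e → P e ≡ true → El target
      f (i , ((x , y) , u) , (v , w)) p =
        index (sw (graph i) v w x y) (sw-degseq i (switch i x y u v w p)) , (x , w) , u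
      f-in : ∀ e p → Q (f e p) ≡ true
      f-in (i , ((x , y) , u) , (v , w)) p =
        ∧-intro (trans (sym (index-same (sw (graph i) v w x y) _ x w)) (sw-xw (switch i x y u v w p))) refl
      f-inj : ∀ e e′ p p′ → f e p ≡ f e′ p′ → e ≡ e′
      f-inj (i , ((x , y) , u) , (v , w)) (j , ((x′ , y′) , u′) , (v′ , w′)) p p′ eq
        with cong (proj₁ ∘ proj₁ ∘ proj₂) eq | cong (proj₂ ∘ proj₁ ∘ proj₂) eq | cong (proj₂ ∘ proj₂) eq
           | index-≡ (cong proj₁ eq)
      ... | refl | refl | refl | same
        with merge-unique {G = graph i} {H = graph j} (closed i) (closed j) ai aj
               (apart i j v w x y v′ y′ ci cj oi oj ai aj same)
               (apart j i v′ w x y′ v y cj ci oj oi aj ai (λ p q → sym (same p q)))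
               same u (side i p) (side j p′)
        where
        ai : Across (graph i) (S i) v w x y
        ai = across i x y u v w p
        aj : Across (graph j) (S j) v′ w x y′
        aj = across j x y′ u v′ w p′
        ci : C i ≡ true
        ci = ∧-conicalˡ _ _ p
        cj : C j ≡ true
        cj = ∧-conicalˡ _ _ p′
        oi : out i (v , w) ≡ true
        oi = ∧-conicalʳ (sides (graph i) (S i) ((x , y) , u)) _ (∧-conicalʳ (C i) _ p)
        oj : out j (v′ , w) ≡ true
        oj = ∧-conicalʳ (sides (graph j) (S j) ((x , y′) , u)) _ (∧-conicalʳ (C j) _ p′)
        side : ∀ i {y v} → P (i , ((x , y) , u) , (v , w)) ≡ true → component (cut (graph i) x y) y u ≡ true
        side i {y} p = ∧-conicalʳ (S i x ∧ adj (graph i) x y) _ (∧-conicalˡ _ _ (∧-conicalʳ (C i) _ p))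
      ... | refl , refl
        with distinct i j (sw-injective (switch i x y u v w p) (switch j x y u v w p′) same)
      ... | refl = refl

module _ {n : ℕ} where

  choose : Fin n → (Fin n → Bool) → Fin n
  choose o P with FP.any? (λ x → P x B.≟ true)
  ... | yes (x , _) = x
  ... | no _        = o

  choose-spec : ∀ o P → anyF P ≡ true → P (choose o P) ≡ true
  choose-spec o P e with FP.any? (λ x → P x B.≟ true)
  ... | yes (x , p) = p
  ... | no none     = contradiction (anyF-elim P e) none

module _ {n : ℕ} (D : DegSeq n) where

  big : ℕ → Graph n → Fin n → Bool
  big g G z = does (n ≤? g * # (fin n) (component G z))

  bigLight : ℕ → ℕ → Graph n → Fin n → Bool
  bigLight g R G z = big g G z ∧ does (R * mass D (component G z) ≤? 2 * M D)

  bigCyclic : ℕ → Graph n → Fin n → Bool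
  bigCyclic g G z = big g G z ∧ does (mass D (component G z) ℕ.≟ 0)

  mass-term : ∀ S v → S v ≡ true → branch D v ≡ true → D v ≤ mass D S
  mass-term S v sv bv = ≤-trans (≤-reflexive (trans (sym (*-identityˡ (D v)))
      (trans (cong (λ b → bit b * D v) (sym bv)) (trans (branch-degree D v) (trans (sym (*-identityˡ _))
        (cong (λ b → bit b * (if D v ≡ᵇ 2 then 0 else D v)) (sym sv)))))))
    (∑-term (fin n) (λ x → bit (S x) * (if D x ≡ᵇ 2 then 0 else D x)) v)

module _ {n : ℕ} {D : DegSeq n} (pos : ∀ i → 1 ≤ D i) (o : Fin n) (Ω : Space D) where
  open Space Ω

  cyclic-bound : ∀ g → # (fin size) (λ i → anyF (bigCyclic D g (graph i))) * (n * n * M D)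
                     ≤ g * g * 2 * 1 * (size * ((M D + 2 * n) * n))
  cyclic-bound g = merge-bound outside apart g 1 (M D)
      (λ i c → does-true (_ ≤? _) (∧-conicalˡ _ _ (spec i c)))
      (λ i c → ≤-reflexive (trans (sym (branch-darts D {graph i} (degrees i))) (sym (*-identityˡ _))))
    where
    C : Fin size → Bool
    C i = anyF (bigCyclic D g (graph i))
    z : Fin size → Fin n
    z i = choose o (bigCyclic D g (graph i))
    out : Fin size → Fin n × Fin n → Bool
    out i (v , w) = branch D v ∧ adj (graph i) v w
    open Merge pos Ω C z out
    spec : ∀ i → C i ≡ true → bigCyclic D g (graph i) (z i) ≡ true
    spec i = choose-spec o (bigCyclic D g (graph i))
    no-branch : ∀ i v → C i ≡ true → branch D v ≡ true → S i v ≡ false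
    no-branch i v c bv = ¬-not λ sv → <⇒≱ (pos v) (≤-trans (mass-term D (S i) v sv bv)
      (≤-reflexive (does-true (_ ℕ.≟ 0) (∧-conicalʳ (big D g (graph i) (z i)) _ (spec i c)))))
    outside : Outside
    outside i v w c h = no-branch i v c (∧-conicalˡ _ _ h) , ∧-conicalʳ (branch D v) _ h
    apart : Apart
    apart i j v w x y v′ y′ ci cj oi oj _ _ _ = no-branch j v cj (∧-conicalˡ _ _ oi)

  dense-bound : ∀ g R → 16 ≤ R → 16 * n ≤ M D →
    # (fin size) (λ i → anyF (bigLight D g R (graph i))) * (n * n * M D)
      ≤ g * g * 2 * 2 * (size * ((M D + 2 * n) * n))
  dense-bound g R R≥16 dense = merge-bound outside apart g 2 (M D)
      (λ i c → does-true (_ ≤? _) (∧-conicalˡ _ _ (spec i c))) many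
    where
    C : Fin size → Bool
    C i = anyF (bigLight D g R (graph i))
    z : Fin size → Fin n
    z i = choose o (bigLight D g R (graph i))
    out : Fin size → Fin n × Fin n → Bool
    out i (v , w) = not (component (graph i) (z i) v) ∧ (adj (graph i) v w ∧ not (separable (graph i) (everywhere (graph i)) v w))
    open Merge pos Ω C z out
    spec : ∀ i → C i ≡ true → bigLight D g R (graph i) (z i) ≡ true
    spec i = choose-spec o (bigLight D g R (graph i))
    all : Fin n → Bool
    all _ = true
    outside : Outside
    outside i v w c h = not-true (∧-conicalˡ _ _ h) , ∧-conicalˡ _ _ (∧-conicalʳ (not (S i v)) _ h)
    light : ∀ i → C i ≡ true → 8 * mass D (S i) ≤ M D
    light i c = *-cancelˡ-≤ 2 (≤-trans (≤-reflexive (sym (*-assoc 2 8 (mass D (S i)))))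
      (≤-trans (*-monoˡ-≤ (mass D (S i)) R≥16)
        (does-true (_ ≤? _) (∧-conicalʳ (big D g (graph i) (z i)) _ (spec i c)))))
    many : ∀ i → C i ≡ true → M D ≤ 2 * # (fin n ⊗ fin n) (out i)
    many i c = +-cancelʳ-≤ (M D) (M D) _ (begin
        M D + M D                            ≡⟨ double (M D) ⟩
        2 * M D                              ≤⟨ *-monoʳ-≤ 2 counted ⟩
        2 * (O + (m + 4 * n))                ≡⟨ *-distribˡ-+ 2 O _ ⟩
        2 * O + 2 * (m + 4 * n)              ≤⟨ +-monoʳ-≤ (2 * O) (*-cancelˡ-≤ 4 small) ⟩
        2 * O + M D ∎)
      where
      open ≤-Reasoning
      G : Graph n
      G = graph i
      O m t : ℕ
      O = # (fin n ⊗ fin n) (out i)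
      m = mass D (S i)
      t = # (fin n) (λ x → D x ≡ᵇ 2)
      double : ∀ a → a + a ≡ 2 * a
      double = solve-∀
      small : 4 * (2 * (m + 4 * n)) ≤ 4 * M D
      small = begin
        4 * (2 * (m + 4 * n))  ≡⟨ expand m n ⟩
        8 * m + 2 * (16 * n)   ≤⟨ +-mono-≤ (light i c) (*-monoʳ-≤ 2 dense) ⟩
        M D + 2 * M D          ≤⟨ m≤m+n _ (M D) ⟩
        M D + 2 * M D + M D    ≡⟨ collect (M D) ⟩
        4 * M D ∎
        where
        expand : ∀ m n → 4 * (2 * (m + 4 * n)) ≡ 8 * m + 2 * (16 * n)
        expand = solve-∀
        collect : ∀ a → a + 2 * a + a ≡ 4 * a
        collect = solve-∀
      bits : ∀ s a b → bit (true ∧ a) ≤ (bit (not s ∧ (a ∧ not b)) + bit (s ∧ a)) + bit ((true ∧ true) ∧ (a ∧ b))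
      bits s     false b     = z≤n
      bits true  true  b     = s≤s z≤n
      bits false true  true  = s≤s z≤n
      bits false true  false = s≤s z≤n
      counted : M D ≤ O + (m + 4 * n)
      counted = +-cancelʳ-≤ (2 * t) (M D) _ (begin
        M D + 2 * t                          ≡⟨ sym (degree-sum D) ⟩
        ∑ (fin n) D                          ≡⟨ ∑-cong (fin n) (λ x → sym (*-identityˡ (D x))) ⟩
        ∑ (fin n) (λ x → bit (all x) * D x)  ≡⟨ sym (∑-darts G (degrees i) all) ⟩
        darts G all                          ≤⟨ ∑-mono (fin n ⊗ fin n) (λ (v , w) → bits (S i v) (adj G v w) (separable G (everywhere G) v w)) ⟩
        ∑ (fin n ⊗ fin n) (λ (v , w) → (bit (out i (v , w)) + bit (S i v ∧ adj G v w)) + bit (weak G (everywhere G) (v , w)))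
          ≡⟨ trans (∑-+ (fin n ⊗ fin n) (λ (v , w) → bit (out i (v , w)) + bit (S i v ∧ adj G v w)) (bit ∘ weak G (everywhere G)))
                   (cong (_+ W) (∑-+ (fin n ⊗ fin n) (bit ∘ out i) (λ (v , w) → bit (S i v ∧ adj G v w)))) ⟩
        (O + darts G (S i)) + W              ≤⟨ +-mono-≤ (+-monoʳ-≤ O (≤-trans (≤-reflexive (∑-darts G (degrees i) (S i)))
                                                   (degree-sum-in D (S i)))) (weak-total G) ⟩
        (O + (m + 2 * t)) + 4 * n            ≡⟨ shuffle O m (2 * t) (4 * n) ⟩
        O + (m + 4 * n) + 2 * t ∎)
        where
        W : ℕ
        W = # (fin n ⊗ fin n) (weak G (everywhere G))
        shuffle : ∀ a b c d → (a + (b + c)) + d ≡ a + (b + d) + c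
        shuffle = solve-∀
    -- If v lay in S j, the edges vw and v′y′ alone would separate S i ∪ S j from the rest.
    apart : Apart
    apart i j v w x y v′ y′ ci cj oi oj ai aj same = ¬-not λ sv →
        true≢false (trans (sym (separable-intro G (everywhere G) T v w
            (∨-introʳ (S i v) sv , cong₂ _∨_ (across-w {G = G} (closed i) ai) (across-w {G = H} (closed j) aj) , few)))
          (not-true (∧-conicalʳ (adj G v w) _ (∧-conicalʳ (not (S i v)) _ oi))))
      where
      G H : Graph n
      G = graph i
      H = graph j
      T : Fin n → Bool
      T p = S i p ∨ S j p
      δ : Fin n × Fin n → Fin n × Fin n → Bool
      δ e f = does (_≟El_ {fin n ⊗ fin n} e f)
      only : ∀ p q → T p ≡ true → S i q ≡ false → S j q ≡ false → adj G p q ≡ true →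
             (y′ , v′) ≡ (p , q) ⊎ (v , w) ≡ (p , q)
      only p q tp si sj a = from (sw-old G v w x y p q a)
        where
        pi : S i p ≡ false
        pi = ¬-not λ h → true≢false (trans (sym (closed i p q h a)) si)
        pj : S j p ≡ true
        pj = [ (λ h → contradiction (trans (sym h) pi) true≢false) , (λ h → h) ]′ (∨-true (S i p) tp)
        from : adj (sw G v w x y) p q ≡ true ⊎ pr v w p q ≡ true ⊎ pr x y p q ≡ true →
               (y′ , v′) ≡ (p , q) ⊎ (v , w) ≡ (p , q)
        from (inj₁ h) with boundary {G = H} v′ w x y′ (closed j) (Across.sv aj) (across-w {G = H} (closed j) aj)
                             p q pj sj (trans (sym (same p q)) h)
        ... | inj₁ (refl , refl) = inj₁ refl
        ... | inj₂ (refl , refl) = contradiction (trans (sym (Across.sx ai)) pi) true≢false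
        from (inj₂ (inj₁ h)) with pr-true v w p q h
        ... | inj₁ (refl , refl) = inj₂ refl
        ... | inj₂ (refl , refl) = contradiction (trans (sym pj) (across-w {G = H} (closed j) aj)) true≢false
        from (inj₂ (inj₂ h)) with pr-true x y p q h
        ... | inj₁ (refl , refl) = contradiction (trans (sym (Across.sx ai)) pi) true≢false
        ... | inj₂ (refl , refl) = contradiction (trans (sym (across-y {G = G} (closed i) ai)) pi) true≢false
      not-∨ : ∀ a {b} → not (a ∨ b) ≡ true → a ≡ false × b ≡ false
      not-∨ false {false} _ = refl , refl
      few : crossings G (everywhere G) T ≤ 2
      few = begin
        crossings G (everywhere G) T ≤⟨ ∑-mono (fin n ⊗ fin n) (λ (p , q) → pw p q _ refl) ⟩
        ∑ (fin n ⊗ fin n) (λ e → bit (δ (y′ , v′) e) + bit (δ (v , w) e)) ≡⟨ ∑-+ (fin n ⊗ fin n) (bit ∘ δ (y′ , v′)) (bit ∘ δ (v , w)) ⟩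
        # (fin n ⊗ fin n) (δ (y′ , v′)) + # (fin n ⊗ fin n) (δ (v , w)) ≡⟨ cong₂ _+_ (#-singleton (fin n ⊗ fin n) (y′ , v′)) (#-singleton (fin n ⊗ fin n) (v , w)) ⟩
        2 ∎
        where
        open ≤-Reasoning
        hit : ∀ e f → e ≡ f → 1 ≤ bit (δ e f)
        hit e f r = ≤-reflexive (cong bit (sym (true-does (_≟El_ {fin n ⊗ fin n} e f) r)))
        pw : ∀ p q b → crossing G (everywhere G) T p q ≡ b → bit b ≤ bit (δ (y′ , v′) (p , q)) + bit (δ (v , w) (p , q))
        pw p q false _ = z≤n
        pw p q true  e = 
          let (si , sj) = not-∨ (S i q) (∧-conicalʳ (T p) _ (∧-conicalˡ _ _ e))
          in [ (λ r → ≤-trans (hit (y′ , v′) (p , q) r) (m≤m+n _ _)) , (λ r → ≤-trans (hit (v , w) (p , q) r) (m≤n+m _ (bit (δ (y′ , v′) (p , q))))) ]′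
             (only p q (∧-conicalˡ _ _ (∧-conicalˡ _ _ e)) si sj (∧-conicalʳ (T p ∧ not (T q)) _ e))

-- Runs of vertices of degree 2

module _ {n : ℕ} (D : DegSeq n) where

  branch-elim : ∀ v → branch D v ≡ true → D v ≢ 2
  branch-elim v b e = true≢false (trans (sym b) (cong not (true-does (_ ℕ.≟ 2) e)))

  deg2-elim : ∀ v → (D v ≡ᵇ 2) ≡ true → D v ≡ 2
  deg2-elim v e = ≡ᵇ⇒≡ (D v) 2 (subst B.T (sym e) _)

  deg2-intro : ∀ v → D v ≡ 2 → (D v ≡ᵇ 2) ≡ true
  deg2-intro v e = true-does (_ ℕ.≟ 2) e

  deg2-darts : ∀ G → HasDegSeq D G → # (fin n ⊗ fin n) (λ (v , w) → (D v ≡ᵇ 2) ∧ adj G v w) ≤ 2 * n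
  deg2-darts G h = begin
    # (fin n ⊗ fin n) (λ (v , w) → (D v ≡ᵇ 2) ∧ adj G v w) ≡⟨ ∑-darts G h (λ v → D v ≡ᵇ 2) ⟩
    ∑ (fin n) (λ v → bit (D v ≡ᵇ 2) * D v)                  ≤⟨ ∑-mono (fin n) (λ v → two v (D v ≡ᵇ 2) refl) ⟩
    ∑ (fin n) (λ _ → 2)                                     ≡⟨ trans (∑-const n 2) (*-comm n 2) ⟩
    2 * n ∎
    where
    open ≤-Reasoning
    two : ∀ v b → (D v ≡ᵇ 2) ≡ b → bit b * D v ≤ 2
    two v false e = z≤n
    two v true  e = ≤-reflexive (trans (*-identityˡ _) (deg2-elim v e))

  module Walk (G : Graph n) (h : HasDegSeq D G) (a a′ : Fin n) where

    abstract
      walk : ℕ → Fin n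
      walk zero          = a
      walk (suc zero)    = a′
      walk (suc (suc i)) = other G (walk i) (walk (suc i))

      walk-zero : walk 0 ≡ a
      walk-zero = refl

      walk-one : walk 1 ≡ a′
      walk-one = refl

      walk-step : ∀ i → walk (suc (suc i)) ≡ other G (walk i) (walk (suc i))
      walk-step i = refl

    run : ℕ → Bool
    run zero    = true
    run (suc k) = run k ∧ (D (walk (suc k)) ≡ᵇ 2)

    run-deg : ∀ k i → run k ≡ true → suc i ≤ k → D (walk (suc i)) ≡ 2
    run-deg (suc k) i r le with m≤n⇒m<n∨m≡n le
    ... | inj₁ lt   = run-deg k i (∧-conicalˡ _ _ r) (s≤s⁻¹ lt)
    ... | inj₂ refl = deg2-elim (walk (suc k)) (∧-conicalʳ (run k) _ r)

    run-prefix : ∀ k i → run k ≡ true → i ≤ k → run i ≡ true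
    run-prefix k i r le with m≤n⇒m<n∨m≡n le
    ... | inj₂ refl = r
    run-prefix (suc k) i r le | inj₁ lt = run-prefix k i (∧-conicalˡ _ _ r) (s≤s⁻¹ lt)

    module _ (start : adj G a a′ ≡ true) (k : ℕ) (r : run k ≡ true) where

      private
        deg2 : ∀ i → suc i ≤ k → degree G (walk (suc i)) ≡ 2
        deg2 i le = trans (h (walk (suc i))) (run-deg k i r le)

      walk-adj : ∀ i → i ≤ k → adj G (walk i) (walk (suc i)) ≡ true
      walk-adj zero    _  = subst₂ (λ p q → adj G p q ≡ true) (sym walk-zero) (sym walk-one) start
      walk-adj (suc i) le = subst (λ q → adj G (walk (suc i)) q ≡ true) (sym (walk-step i)) (proj₁ (other-spec G (walk i) (walk (suc i)) (deg2 i le)))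

      walk-forward : ∀ i → suc i ≤ k → walk (suc (suc i)) ≢ walk i
      walk-forward i le e = proj₂ (other-spec G (walk i) (walk (suc i)) (deg2 i le)) (trans (sym (walk-step i)) e)

      walk-neighbour : ∀ i → suc i ≤ k → ∀ q → adj G (walk (suc i)) q ≡ true →
                       q ≡ walk i ⊎ q ≡ walk (suc (suc i))
      walk-neighbour i le q aq with q ≟ walk i
      ... | yes e = inj₁ e
      ... | no ne = inj₂ (deg2-unique G (deg2 i le) (adj-flip G (walk-adj i (≤-trans (n≤1+n i) le))) aq
                           (walk-adj (suc i) le) ne (walk-forward i le))

      module _ (ba : branch D a ≡ true) where

        walk-distinct : ∀ j i → i < j → j ≤ k → walk i ≢ walk j
        walk-distinct (suc j) zero    _  le e = branch-elim a ba (trans (cong D (trans (sym walk-zero) e)) (run-deg k j r le))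
        walk-distinct (suc j) (suc i) lt le e
          with walk-neighbour i (≤-trans (≤-trans (n≤1+n (suc i)) lt) le) (walk j)
                 (adj-flip G (subst (λ q → adj G (walk j) q ≡ true) (sym e) (walk-adj j (≤-trans (n≤1+n j) le))))
        ... | inj₁ e′ = walk-distinct j i (s≤s⁻¹ lt) (≤-trans (n≤1+n j) le) (sym e′)
        ... | inj₂ e′ with <-cmp (suc (suc i)) j
        ...   | tri< l _ _    = walk-distinct j (suc (suc i)) l (≤-trans (n≤1+n j) le) (sym e′)
        ...   | tri≈ _ refl _ = walk-forward (suc i) (≤-trans (n≤1+n _) le) (sym e)
        ...   | tri> _ _ g with ≤-antisym (s≤s⁻¹ g) (s≤s⁻¹ lt)
        ...     | refl = adj-distinct G (walk-adj (suc i) (≤-trans (n≤1+n _) le)) e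

        walk-injective : ∀ i j → i ≤ k → j ≤ k → walk i ≡ walk j → i ≡ j
        walk-injective i j li lj e with <-cmp i j
        ... | tri< l _ _ = contradiction e (walk-distinct j i l lj)
        ... | tri≈ _ p _ = p
        ... | tri> _ _ l = contradiction (sym e) (walk-distinct i j l li)

  -- Here p → q is the j-th dart of the non-backtracking walk starting with v → y.
  data Trail (H : Graph n) (v y : Fin n) : ℕ → Fin n → Fin n → Set where
    here : adj H v y ≡ true → Trail H v y 0 v y
    next : ∀ {j p q r} → Trail H v y j p q → D q ≡ 2 → adj H q r ≡ true → r ≢ p → Trail H v y (suc j) q r

  trail-same : ∀ {H K} → SameGraph H K → ∀ {v y j p q} → Trail H v y j p q → Trail K v y j p q
  trail-same e (here a)       = here (trans (sym (e _ _)) a)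
  trail-same e (next t d a f) = next (trail-same e t) d (trans (sym (e _ _)) a) f

  trail-adj : ∀ {H v y j p q} → Trail H v y j p q → adj H p q ≡ true
  trail-adj (here a)       = a
  trail-adj (next _ _ a _) = a

  trail-unique : ∀ {H} → HasDegSeq D H → ∀ {v y v′ y′ j j′ p q} → D v ≢ 2 → D v′ ≢ 2 →
    Trail H v y j p q → Trail H v′ y′ j′ p q → (v ≡ v′ × y ≡ y′) × j ≡ j′
  trail-unique h b b′ (here _)       (here _)       = (refl , refl) , refl
  trail-unique h b b′ (here _)       (next _ d _ _) = contradiction d b
  trail-unique h b b′ (next _ d _ _) (here _)       = contradiction d b′
  trail-unique {H} h b b′ (next {p = p} {q} t d a f) (next {p = p′} t′ d′ a′ f′)
    with deg2-unique H (trans (h q) d) a (adj-flip H (trail-adj t)) (adj-flip H (trail-adj t′)) (f ∘ sym) (f′ ∘ sym)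
  ... | refl with trail-unique h b b′ t t′
  ...   | e , refl = e , refl

  before : Fin n → (ℕ → Fin n) → ℕ → Fin n
  before v f zero    = v
  before v f (suc j) = f j

  trail-along : ∀ H v (f : ℕ → Fin n) j → adj H v (f 0) ≡ true →
    (∀ i → i < j → D (f i) ≡ 2 × adj H (f i) (f (suc i)) ≡ true × f (suc i) ≢ before v f i) →
    Trail H v (f 0) j (before v f j) (f j)
  trail-along H v f zero    a c = here a
  trail-along H v f (suc j) a c = let (d , e , g) = c j ≤-refl in
    next (trail-along H v f j a λ i l → c i (≤-trans l (n≤1+n j))) d e g

module _ {n : ℕ} {D : DegSeq n} (pos : ∀ i → 1 ≤ D i) (o : Fin n) (Ω : Space D) where
  open Space Ω

  longRun : ℕ → Fin size → Fin n → Fin n → Bool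
  longRun k i a a′ = branch D a ∧ (adj (graph i) a a′ ∧ Walk.run D (graph i) (degrees i) a a′ k)

  hasLongRun : ℕ → Fin size → Bool
  hasLongRun k i = anyF λ a → anyF λ a′ → longRun k i a a′

  long-run-count : ∀ m (C : Fin size → Bool) (a₀ a₁ : Fin size → Fin n) →
    (∀ i → C i ≡ true → longRun (2 * m + 3) i (a₀ i) (a₁ i) ≡ true) →
    # (fin size) C * (m * m * M D) ≤ size * ((2 * n) * (2 * n))
  long-run-count m C a₀ a₁ spec = begin
    # (fin size) C * (m * m * M D)  ≤⟨ #-lower size (fin m ⊗ fin m) (fin n ⊗ fin n) C (λ _ _ → true) B 1 1 (m * m) (M D)
                                        (λ _ _ → ≤-reflexive (sym all)) (λ i _ → ≤-reflexive (sym (trans (*-identityˡ _) (branch-darts D {graph i} (degrees i))))) ⟩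
    1 * 1 * # source P              ≡⟨ *-identityˡ _ ⟩
    # source P                      ≤⟨ #-injection source target P Q f f-in f-inj ⟩
    # target Q                      ≤⟨ #-upper size (fin n ⊗ fin n) (fin n ⊗ fin n) T T (λ _ → true) (2 * n) (2 * n) T≤ T≤ ⟩
    # (fin size) (λ _ → true) * ((2 * n) * (2 * n)) ≤⟨ *-monoˡ-≤ _ (#≤ size _) ⟩
    size * ((2 * n) * (2 * n)) ∎
    where
    open ≤-Reasoning hiding (start)
    len : ℕ
    len = 2 * m + 3
    B T : Fin size → Fin n × Fin n → Bool
    B i (v , w) = branch D v ∧ adj (graph i) v w
    T i (p , q) = (D p ≡ᵇ 2) ∧ adj (graph i) p q
    T≤ : ∀ i → # (fin n ⊗ fin n) (T i) ≤ 2 * n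
    T≤ i = deg2-darts D (graph i) (degrees i)
    source target : Code
    source = fin size ⊗ (fin m ⊗ fin m) ⊗ (fin n ⊗ fin n)
    target = fin size ⊗ (fin n ⊗ fin n) ⊗ (fin n ⊗ fin n)
    P : El source → Bool
    P (i , a , b) = C i ∧ (true ∧ B i b)
    Q : El target → Bool
    Q (j , a , b) = true ∧ (T j a ∧ T j b)
    all : 1 * # (fin m ⊗ fin m) (λ _ → true) ≡ m * m
    all = trans (*-identityˡ _) (trans (∑-cong (fin m) λ _ → trans (∑-const m 1) (*-identityʳ m)) (∑-const m m))

    W : Fin size → ℕ → Fin n
    W i = Walk.walk D (graph i) (degrees i) (a₀ i) (a₁ i)

    module Switched (i : Fin size) (v w : Fin n) (k j : Fin m) (ci : C i ≡ true) (b : B i (v , w) ≡ true) where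
      G : Graph n
      G = graph i
      open Walk D G (degrees i) (a₀ i) (a₁ i) hiding (walk)
      ba : branch D (a₀ i) ≡ true
      ba = ∧-conicalˡ _ _ (spec i ci)
      start : adj G (a₀ i) (a₁ i) ≡ true
      start = ∧-conicalˡ _ _ (∧-conicalʳ (branch D (a₀ i)) _ (spec i ci))
      r : run len ≡ true
      r = ∧-conicalʳ (adj G (a₀ i) (a₁ i)) _ (∧-conicalʳ (branch D (a₀ i)) _ (spec i ci))
      bv : D v ≢ 2
      bv = branch-elim D v (∧-conicalˡ _ _ b)
      vw : adj G v w ≡ true
      vw = ∧-conicalʳ (branch D v) _ b
      K L : ℕ
      K = toℕ k
      L = toℕ j
      bound : K + L + 5 ≤ len
      bound = begin
        K + L + 5             ≡⟨ e₁ K L ⟩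
        suc K + suc L + 3     ≤⟨ +-monoˡ-≤ 3 (+-mono-≤ (FP.toℕ<n k) (FP.toℕ<n j)) ⟩
        m + m + 3             ≡⟨ e₂ m ⟩
        2 * m + 3 ∎
        where
        e₁ : ∀ K L → K + L + 5 ≡ suc K + suc L + 3
        e₁ = solve-∀
        e₂ : ∀ m → m + m + 3 ≡ 2 * m + 3
        e₂ = solve-∀
      bound′ : ∀ c t → t ≤ L → c ≤ 5 → c + (K + t) ≤ len
      bound′ c t tj c5 = ≤-trans (≤-trans (+-mono-≤ c5 (+-monoʳ-≤ K tj)) (≤-reflexive (+-comm 5 _))) bound
      deg2 : ∀ t → suc t ≤ len → D (W i (suc t)) ≡ 2
      deg2 t = run-deg len t r
      at : ∀ c → c ≤ 5 → c + K ≤ len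
      at c c5 = ≤-trans (≤-reflexive (cong (c +_) (sym (+-identityʳ K)))) (bound′ c 0 z≤n c5)
      x y : Fin n
      x = W i (3 + K)
      y = W i (4 + K)
      far : ∀ t → 2 + t + 1 ≤ len → ¬ adj G v (W i (2 + t)) ≡ true
      far t le e with walk-neighbour start len r (suc t) (≤-trans (m≤m+n _ 1) le) v (adj-flip G e)
      ... | inj₁ q = bv (trans (cong D q) (deg2 t (≤-trans (≤-trans (n≤1+n _) (m≤m+n _ 1)) le)))
      ... | inj₂ q = bv (trans (cong D q) (deg2 (2 + t) (≤-trans (≤-reflexive (+-comm 1 _)) le)))
      c≤5 : ∀ {c} d → c + d ≡ 5 → c ≤ 5
      c≤5 {c} d e = subst (c ≤_) e (m≤m+n c d)
      far₂ : ¬ adj G v (W i (2 + K)) ≡ true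
      far₂ = far K (≤-trans (≤-reflexive (+-comm _ 1)) (at 3 (c≤5 2 refl)))
      far₃ : ¬ adj G v x ≡ true
      far₃ = far (1 + K) (≤-trans (≤-reflexive (+-comm _ 1)) (at 4 (c≤5 1 refl)))
      far₄ : ¬ adj G v y ≡ true
      far₄ = far (2 + K) (≤-trans (≤-reflexive (+-comm _ 1)) (at 5 ≤-refl))
      s : Switchable G v w x y
      s = record
        { vw = vw
        ; xy = walk-adj start len r (3 + K) (at 3 (c≤5 2 refl))
        ; ¬vy = ¬-not far₄
        ; ¬xw = ¬-not λ e → [ (λ q → far₂ (subst (λ u → adj G v u ≡ true) q vw))
                            , (λ q → far₄ (subst (λ u → adj G v u ≡ true) q vw)) ]′
                            (walk-neighbour start len r (2 + K) (at 3 (c≤5 2 refl)) w e)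
        ; v≢x = λ e → bv (trans (cong D e) (deg2 (2 + K) (at 3 (c≤5 2 refl))))
        ; w≢y = λ e → far₄ (subst (λ u → adj G v u ≡ true) e vw)
        ; v≢y = λ e → bv (trans (cong D e) (deg2 (3 + K) (at 4 (c≤5 1 refl))))
        ; x≢w = λ e → far₃ (subst (λ u → adj G v u ≡ true) (sym e) vw)
        }
      H : Graph n
      H = sw G v w x y
      p q : Fin n
      p = W i (4 + (K + L))
      q = W i (5 + (K + L))
      trail : Trail D H v y (suc L) p q
      trail = subst₂ (λ u r → Trail D H v u (suc L) p r) (cong (λ t → W i (4 + t)) (+-identityʳ K)) (f-suc L)
        (trail-along D H v f (suc L)
          (subst (λ t → adj H v (W i (4 + t)) ≡ true) (sym (+-identityʳ K)) (sw-vy s)) steps)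
        where
        f : ℕ → Fin n
        f t = W i (4 + (K + t))
        f-suc : ∀ t → f (suc t) ≡ W i (5 + (K + t))
        f-suc t = cong (λ u → W i (4 + u)) (+-suc K t)
        steps : ∀ t → t < suc L → D (f t) ≡ 2 × adj H (f t) (f (suc t)) ≡ true × f (suc t) ≢ before D v f t
        steps t (s≤s tj) = d₁ , subst (λ u → adj H (f t) u ≡ true) (sym (f-suc t)) kept , fwd t tj
          where
          d₁ : D (f t) ≡ 2
          d₁ = deg2 (3 + (K + t)) (bound′ 4 t tj (c≤5 1 refl))
          d₂ : D (W i (5 + (K + t))) ≡ 2
          d₂ = deg2 (4 + (K + t)) (bound′ 5 t tj ≤-refl)
          x≢ : ∀ c → c + (K + t) ≤ len → 3 < c → x ≢ W i (c + (K + t))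
          x≢ c le l = walk-distinct start len r ba (c + (K + t)) (3 + K)
            (+-mono-≤ {4} l (m≤m+n K t)) le
          kept : adj H (f t) (W i (5 + (K + t))) ≡ true
          kept = sw-kept G v w x y (f t) (W i (5 + (K + t)))
            (walk-adj start len r (4 + (K + t)) (bound′ 4 t tj (c≤5 1 refl)))
            (λ e → [ (λ z → bv (trans (cong D (sym (proj₁ z))) d₁)) , (λ z → bv (trans (cong D (sym (proj₂ z))) d₂)) ]′
                     (pr-true v w (f t) _ e))
            (λ e → [ (λ z → x≢ 4 (bound′ 4 t tj (c≤5 1 refl)) ≤-refl (sym (proj₁ z)))
                   , (λ z → x≢ 5 (bound′ 5 t tj ≤-refl) (s≤s (s≤s (s≤s (s≤s z≤n)))) (sym (proj₂ z))) ]′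
                     (pr-true x y (f t) _ e))
          fwd : ∀ t → t ≤ L → f (suc t) ≢ before D v f t
          fwd zero    tj e = bv (trans (cong D (sym e)) (trans (cong D (f-suc 0)) (deg2 (4 + (K + 0)) (bound′ 5 0 tj ≤-refl))))
          fwd (suc t) tj e = walk-forward start len r (4 + (K + t)) (bound′ 5 t (≤-trans (n≤1+n t) tj) ≤-refl)
            (trans (sym (trans (f-suc (suc t)) (cong (λ u → W i (5 + u)) (+-suc K t)))) e)
      p-deg2 : D p ≡ 2
      p-deg2 = deg2 (3 + (K + L)) (bound′ 4 L ≤-refl (c≤5 1 refl))
      x-deg2 : D x ≡ 2
      x-deg2 = deg2 (2 + K) (at 3 (c≤5 2 refl))
      degs : HasDegSeq D H
      degs = sw-degseq pos Ω i s

    C′ : ∀ {i k v w} → P (i , k , (v , w)) ≡ true → C i ≡ true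
    C′ = ∧-conicalˡ _ _
    B′ : ∀ {i k v w} → P (i , k , (v , w)) ≡ true → B i (v , w) ≡ true
    B′ {i} = ∧-conicalʳ (C i) _
    f : ∀ e → P e ≡ true → El target
    f (i , (k , j) , (v , w)) e = index H degs , (p , q) , (x , w)
      where open Switched i v w k j (C′ {i} {k , j} {v} {w} e) (B′ {i} {k , j} {v} {w} e)
    f-in : ∀ e pe → Q (f e pe) ≡ true
    f-in (i , (k , j) , (v , w)) e = ∧-intro
        (∧-intro (deg2-intro D p p-deg2) (trans (sym (index-same H degs p q)) (trail-adj D trail)))
        (∧-intro (deg2-intro D x x-deg2) (trans (sym (index-same H degs x w)) (sw-xw s)))
      where open Switched i v w k j (C′ {i} {k , j} {v} {w} e) (B′ {i} {k , j} {v} {w} e)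
    f-inj : ∀ e e′ pe pe′ → f e pe ≡ f e′ pe′ → e ≡ e′
    f-inj (i , (k , j) , (v , w)) (i′ , (k′ , j′) , (v′ , w′)) pe pe′ eq =
      go (X.v≡ , X.y≡) X.x≡ X.w≡ X.L≡ X.same
      where
      module A = Switched i v w k j (C′ {i} {k , j} {v} {w} pe) (B′ {i} {k , j} {v} {w} pe)
      module A′ = Switched i′ v′ w′ k′ j′ (C′ {i′} {k′ , j′} {v′} {w′} pe′) (B′ {i′} {k′ , j′} {v′} {w′} pe′)
      module X where
        same : SameGraph A.H A′.H
        same = index-≡ pos Ω (cong proj₁ eq)
        x≡ : A.x ≡ A′.x
        x≡ = cong (proj₁ ∘ proj₂ ∘ proj₂) eq
        w≡ : w ≡ w′
        w≡ = cong (proj₂ ∘ proj₂ ∘ proj₂) eq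
        trail′ : Trail D A.H v′ A′.y (suc A′.L) A.p A.q
        trail′ = trail-same D (λ a b → sym (same a b))
          (subst₂ (Trail D A′.H v′ A′.y (suc A′.L)) (cong (proj₁ ∘ proj₁ ∘ proj₂) (sym eq)) (cong (proj₂ ∘ proj₁ ∘ proj₂) (sym eq)) A′.trail)
        uniq : (v ≡ v′ × A.y ≡ A′.y) × suc A.L ≡ suc A′.L
        uniq = trail-unique D A.degs A.bv A′.bv A.trail trail′
        v≡ = proj₁ (proj₁ uniq)
        y≡ = proj₂ (proj₁ uniq)
        L≡ : j ≡ j′
        L≡ = FP.toℕ-injective (suc-injective (proj₂ uniq))
      go : v ≡ v′ × A.y ≡ A′.y → A.x ≡ A′.x → w ≡ w′ → j ≡ j′ → SameGraph A.H A′.H →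
           (i , (k , j) , (v , w)) ≡ (i′ , (k′ , j′) , (v′ , w′))
      go (refl , y≡) x≡ refl refl same with distinct i i′ (sw-injective A.s
           (subst₂ (Switchable (graph i′) v w) (sym x≡) (sym y≡) A′.s)
           (λ a b → trans (same a b) (cong₂ (λ x y → adj (sw (graph i′) v w x y) a b) (sym x≡) (sym y≡))))
      ... | refl with FP.toℕ-injective {i = k} {k′} (+-cancelˡ-≡ 3 _ _ (Walk.walk-injective D (graph i) (degrees i) (a₀ i) (a₁ i)
                        A.start len A.r A.ba (3 + A.K) (3 + A′.K) (A.at 3 (A.c≤5 2 refl)) (A′.at 3 (A.c≤5 2 refl)) x≡))
      ...   | refl = refl

  long-run-bound : ∀ m → # (fin size) (hasLongRun (2 * m + 3)) * (m * m * M D) ≤ size * ((2 * n) * (2 * n))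
  long-run-bound m = long-run-count m (hasLongRun len) a₀ a₁ λ i c →
      choose-spec o (λ a′ → longRun len i (a₀ i) a′) (choose-spec o (λ a → anyF λ a′ → longRun len i a a′) c)
    where
    len : ℕ
    len = 2 * m + 3
    a₀ a₁ : Fin size → Fin n
    a₀ i = choose o λ a → anyF λ a′ → longRun len i a a′
    a₁ i = choose o λ a′ → longRun len i (a₀ i) a′

module _ {n : ℕ} (D : DegSeq n) where

  light : ℕ → ℕ → Graph n → Fin n → Bool
  light t μ G a = branch D a ∧ (does (t ≤? # (fin n) (component G a)) ∧ does (mass D (component G a) ≤? μ))

  record Light (t μ : ℕ) (G : Graph n) (a : Fin n) : Set where
    constructor light-of
    field
      is-branch : branch D a ≡ true
      is-large  : t ≤ # (fin n) (component G a)
      is-light  : mass D (component G a) ≤ μ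

  light-elim : ∀ {t μ} G a → light t μ G a ≡ true → Light t μ G a
  light-elim {t} {μ} G a e = light-of (∧-conicalˡ _ _ e)
    (does-true (t ≤? _) (∧-conicalˡ _ _ e′)) (does-true (mass D (component G a) ≤? μ) (∧-conicalʳ (does (t ≤? # (fin n) (component G a))) _ e′))
    where e′ = ∧-conicalʳ (branch D a) _ e

  light-intro : ∀ {t μ} G a → Light t μ G a → light t μ G a ≡ true
  light-intro {t} {μ} G a (light-of b l m) =
    ∧-intro b (∧-intro (true-does (t ≤? _) l) (true-does (mass D (component G a) ≤? μ) m))

  mass-mono : ∀ S T → (∀ x → S x ≡ true → T x ≡ true) → mass D S ≤ mass D T
  mass-mono S T sub = ∑-mono (fin n) λ x → *-monoˡ-≤ (if D x ≡ᵇ 2 then 0 else D x) (bit-mono (sub x))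

  light-same : ∀ {t μ} G H a → SameGraph G H → Light t μ G a → Light t μ H a
  light-same G H a e (light-of b l m) = light-of b
    (≤-trans l (#-mono (fin n) (comp-same G H e a)))
    (≤-trans (mass-mono (component H a) (component G a) (comp-same H G (λ p q → sym (e p q)) a)) m)

  -- Detaches the chunk walk 1, …, walk (k + 1) from its end a and inserts it behind the dart (v , w).
  module Move (G : Graph n) (h : HasDegSeq D G) (z a a′ v w : Fin n) (k : ℕ)
    (sa : component G z a ≡ true) (ba : branch D a ≡ true) (start : adj G a a′ ≡ true)
    (r : Walk.run D G h a a′ (3 + k) ≡ true)
    (sv : component G z v ≡ false) (bv : branch D v ≡ true) (vw : adj G v w ≡ true) where

    open Walk D G h a a′

    S : Fin n → Bool
    S = component G z

    c : Closed G S
    c = comp-closed G z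

    sw′ : S w ≡ false
    sw′ = ¬-not λ e → true≢false (trans (sym (c w v e (adj-flip G vw))) sv)

    in-S : ∀ t → t ≤ 4 + k → S (walk t) ≡ true
    in-S zero    le = trans (cong S walk-zero) sa
    in-S (suc t) le = c (walk t) (walk (suc t)) (in-S t (≤-trans (n≤1+n t) le)) (walk-adj start (3 + k) r t (s≤s⁻¹ le))

    ≢-of-S : ∀ {p q} → S p ≡ true → S q ≡ false → p ≢ q
    ≢-of-S sp sq refl = true≢false (trans (sym sp) sq)

    ≢-of-D : ∀ {p q} → branch D p ≡ true → D q ≡ 2 → p ≢ q
    ≢-of-D {p} bp dq refl = branch-elim D p bp dq

    deg2 : ∀ t → t ≤ 2 + k → D (walk (suc t)) ≡ 2
    deg2 t le = run-deg (3 + k) t r (s≤s le)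

    distinct′ : ∀ i j → i < j → j ≤ 3 + k → walk i ≢ walk j
    distinct′ i j = walk-distinct start (3 + k) r ba j i

    up : ∀ {t} d → t ≤ k → t ≤ d + k
    up d le = ≤-trans le (m≤n+m k d)

    s s⁺ : Fin n
    s  = walk (1 + k)
    s⁺ = walk (2 + k)

    Ss : S s ≡ true
    Ss = in-S (1 + k) (+-monoˡ-≤ k {1} {4} (s≤s z≤n))
    Ss⁺ : S s⁺ ≡ true
    Ss⁺ = in-S (2 + k) (+-monoˡ-≤ k {2} {4} (s≤s (s≤s z≤n)))
    Ds : D s ≡ 2
    Ds = deg2 k (up 2 ≤-refl)
    Ds⁺ : D s⁺ ≡ 2
    Ds⁺ = deg2 (1 + k) (n≤1+n _)

    first : Switchable G v w a a′
    first = across-switchable {G = G} c record { sx = sa ; xy = start ; sv = sv ; vw = vw }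

    G₁ : Graph n
    G₁ = sw G v w a a′

    step-adj : ∀ t → t ≤ 3 + k → adj G (walk t) (walk (suc t)) ≡ true
    step-adj = walk-adj start (3 + k) r

    v≢w : v ≢ w
    v≢w = adj-distinct G vw

    kept₁ : ∀ {p q} → adj G p q ≡ true → S p ≡ true → S q ≡ true → ¬ pr a a′ p q ≡ true → adj G₁ p q ≡ true
    kept₁ {p} {q} e sp sq ne = sw-kept G v w a a′ p q e
      (λ x → [ (λ y → ≢-of-S sp sv (proj₁ y)) , (λ y → ≢-of-S sq sv (proj₂ y)) ]′ (pr-true v w p q x)) ne

    not-a : ∀ {p q} → D p ≡ 2 → D q ≡ 2 → ¬ pr a a′ p q ≡ true
    not-a {p} {q} dp dq x = [ (λ y → ≢-of-D ba dp (sym (proj₁ y))) , (λ y → ≢-of-D ba dq (sym (proj₂ y))) ]′ (pr-true a a′ p q x)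

    ¬a-s⁺ : ¬ adj G a s⁺ ≡ true
    ¬a-s⁺ e with walk-neighbour start (3 + k) r (1 + k) (n≤1+n _) a (adj-flip G e)
    ... | inj₁ x = ≢-of-D ba Ds x
    ... | inj₂ x = ≢-of-D ba (deg2 (2 + k) ≤-refl) x

    second : Switchable G₁ a w s s⁺
    second = record
      { vw  = sw-xw first
      ; xy  = kept₁ (step-adj (1 + k) (+-monoˡ-≤ k {1} {3} (s≤s z≤n))) Ss Ss⁺ (not-a Ds Ds⁺)
      ; ¬vy = ¬-not λ e → [ ¬a-s⁺ , [ (λ x → [ (λ y → ≢-of-S sa sv (proj₁ y)) , (λ y → adj-distinct G start (proj₁ y)) ]′ (pr-true v a′ a s⁺ x))
                                    , (λ x → [ (λ y → ≢-of-S Ss⁺ sw′ (proj₂ y)) , (λ y → ≢-of-S sa sw′ (proj₁ y)) ]′ (pr-true a w a s⁺ x)) ]′ ]′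
                           (sw-new G v w a a′ a s⁺ e)
      ; ¬xw = ¬-not λ e → [ (λ x → ≢-of-S (c s w Ss x) sw′ refl)
                          , [ (λ x → [ (λ y → ≢-of-S Ss sv (proj₁ y)) , (λ y → v≢w (sym (proj₂ y))) ]′ (pr-true v a′ s w x))
                            , (λ x → [ (λ y → ≢-of-D ba Ds (sym (proj₁ y))) , (λ y → ≢-of-S Ss sw′ (proj₁ y)) ]′ (pr-true a w s w x)) ]′ ]′
                           (sw-new G v w a a′ s w e)
      ; v≢x = ≢-of-D ba Ds
      ; w≢y = ≢-of-S Ss⁺ sw′ ∘ sym
      ; v≢y = ≢-of-D ba Ds⁺
      ; x≢w = ≢-of-S Ss sw′ }

    H : Graph n
    H = sw G₁ a w s s⁺

    degs : HasDegSeq D H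
    degs p = trans (sw-degree second p) (trans (sw-degree first p) (h p))

    kept₂ : ∀ {p q} → adj G p q ≡ true → S p ≡ true → S q ≡ true → ¬ pr a a′ p q ≡ true → ¬ pr s s⁺ p q ≡ true → adj H p q ≡ true
    kept₂ {p} {q} e sp sq ne ne′ = sw-kept G₁ a w s s⁺ p q (kept₁ e sp sq ne)
      (λ x → [ (λ y → ≢-of-S sq sw′ (proj₂ y)) , (λ y → ≢-of-S sp sw′ (proj₁ y)) ]′ (pr-true a w p q x)) ne′

    trail : Trail D H v a′ (suc k) s w
    trail = next (subst (λ u → Trail D H v u k (before D v f k) s) walk-one
              (trail-along D H v f k (subst (λ u → adj H v u ≡ true) (sym walk-one) v-a′) steps)) Ds (sw-xw second) (last k ≤-refl)
      where
      f : ℕ → Fin n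
      f t = walk (suc t)
      v-a′ : adj H v a′ ≡ true
      v-a′ = sw-kept G₁ a w s s⁺ v a′ (sw-vy first)
        (λ x → [ (λ y → ≢-of-S sa sv (sym (proj₁ y))) , (λ y → v≢w (proj₁ y)) ]′ (pr-true a w v a′ x))
        (λ x → [ (λ y → ≢-of-S Ss sv (sym (proj₁ y))) , (λ y → ≢-of-S Ss⁺ sv (sym (proj₁ y))) ]′ (pr-true s s⁺ v a′ x))
      last : ∀ k′ → k′ ≤ k → w ≢ before D v f k′
      last zero     _  = v≢w ∘ sym
      last (suc k′) le = ≢-of-S (in-S (suc k′) (≤-trans le (m≤n+m k 4))) sw′ ∘ sym
      steps : ∀ t → t < k → D (f t) ≡ 2 × adj H (f t) (f (suc t)) ≡ true × f (suc t) ≢ before D v f t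
      steps t lt = deg2 t (up 2 (<⇒≤ lt)) ,
        kept₂ (step-adj (suc t) (s≤s (up 2 (<⇒≤ lt)))) (in-S (suc t) (s≤s (up 3 (<⇒≤ lt)))) (in-S (2 + t) (s≤s (s≤s (up 2 (<⇒≤ lt)))))
          (not-a (deg2 t (up 2 (<⇒≤ lt))) (deg2 (1 + t) (s≤s (up 1 (<⇒≤ lt)))))
          (λ x → [ (λ y → distinct′ (suc t) (suc k) (s≤s lt) (s≤s (up 2 ≤-refl)) (proj₁ y))
                 , (λ y → distinct′ (suc t) (2 + k) (s≤s (≤-trans lt (n≤1+n k))) (n≤1+n _) (proj₁ y)) ]′ (pr-true s s⁺ (f t) (f (suc t)) x)) ,
        fwd t lt
        where
        fwd : ∀ t → t < k → f (suc t) ≢ before D v f t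
        fwd zero    lt = ≢-of-S (in-S 2 (s≤s (s≤s z≤n))) sv
        fwd (suc t) lt = walk-forward start (3 + k) r (suc t) (s≤s (up 2 (<⇒≤ lt)))

    occurs : Fin n → Fin (suc k) → Bool
    occurs p t = does (walk (suc (toℕ t)) ≟ p)

    chunk : Fin n → Bool
    chunk p = anyF (occurs p)

    chunk-intro : ∀ t → t ≤ k → chunk (walk (suc t)) ≡ true
    chunk-intro t le = anyF-intro (occurs (walk (suc t))) (fromℕ< (s≤s le))
      (true-does (_ ≟ _) (cong (λ x → walk (suc x)) (FP.toℕ-fromℕ< (s≤s le))))

    chunk-elim : ∀ p → chunk p ≡ true → ∃ λ t → t ≤ k × walk (suc t) ≡ p
    chunk-elim p e = let (t , x) = anyF-elim (occurs p) e in
      toℕ t , s≤s⁻¹ (FP.toℕ<n t) , does-true (_ ≟ p) x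

    chunk-size : # (fin n) chunk ≤ suc k
    chunk-size = begin
      # (fin n) chunk ≤⟨ ∑-mono (fin n) (λ p → pw p _ refl) ⟩
      ∑ (fin n) (λ p → ∑ (fin (suc k)) λ t → δ t p) ≡⟨ ∑-swap (fin n) (fin (suc k)) (λ p t → δ t p) ⟩
      ∑ (fin (suc k)) (λ t → ∑ (fin n) (δ t)) ≡⟨ ∑-cong (fin (suc k)) (λ t → #-singleton (fin n) (walk (suc (toℕ t)))) ⟩
      ∑ (fin (suc k)) (λ _ → 1) ≡⟨ trans (∑-const (suc k) 1) (*-identityʳ (suc k)) ⟩
      suc k ∎
      where
      open ≤-Reasoning hiding (start)
      δ : Fin (suc k) → Fin n → ℕ
      δ t p = bit (does (walk (suc (toℕ t)) ≟ p))
      pw : ∀ p b → chunk p ≡ b → bit b ≤ ∑ (fin (suc k)) (λ t → δ t p)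
      pw p false e = z≤n
      pw p true  e = let (t , x) = anyF-elim (occurs p) e in
        ≤-trans (≤-reflexive (cong bit (sym x))) (∑-term (fin (suc k)) (λ t → δ t p) t)

    chunk-neighbour : ∀ t → t ≤ k → ∀ q → adj G (walk (suc t)) q ≡ true → (q ≡ a × t ≡ 0) ⊎ chunk q ≡ true ⊎ (q ≡ s⁺ × t ≡ k)
    chunk-neighbour t le q e with walk-neighbour start (3 + k) r t (s≤s (up 2 le)) q e
    chunk-neighbour zero    le q e | inj₁ x = inj₁ (trans x walk-zero , refl)
    chunk-neighbour (suc t) le q e | inj₁ x = inj₂ (inj₁ (trans (cong chunk x) (chunk-intro t (≤-trans (n≤1+n t) le))))
    ... | inj₂ x with m≤n⇒m<n∨m≡n le
    ...   | inj₁ lt   = inj₂ (inj₁ (trans (cong chunk x) (chunk-intro (suc t) lt)))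
    ...   | inj₂ refl = inj₂ (inj₂ (x , refl))

    comp-large : ∀ {t} → t ≤ # (fin n) S → t ≤ # (fin n) (component H a) + suc k
    comp-large le = ≤-trans le (≤-trans (∑-mono (fin n) λ u → pw u _ refl)
        (≤-trans (≤-reflexive (∑-+ (fin n) (bit ∘ component H a) (bit ∘ chunk))) (+-monoʳ-≤ _ chunk-size)))
      where
      Rest : Fin n → Set
      Rest u = S u ≡ true × (component H a u ≡ true ⊎ chunk u ≡ true)
      ca : component H a a ≡ true
      ca = comp-refl H a
      cs⁺ : component H a s⁺ ≡ true
      cs⁺ = comp-closed H a a s⁺ ca (sw-vy second)
      step : ∀ p q → Rest p → adj G p q ≡ true → Rest q
      step p q (sp , inj₂ ch) e with chunk-elim p ch
      ... | t , le , refl with chunk-neighbour t le q e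
      ...   | inj₁ (refl , _)        = c p q sp e , inj₁ ca
      ...   | inj₂ (inj₁ x)          = c p q sp e , inj₂ x
      ...   | inj₂ (inj₂ (refl , _)) = c p q sp e , inj₁ cs⁺
      step p q (sp , inj₁ cp) e = c p q sp e , from (pr a a′ p q B.≟ true) (pr s s⁺ p q B.≟ true)
        where
        from : Dec (pr a a′ p q ≡ true) → Dec (pr s s⁺ p q ≡ true) → component H a q ≡ true ⊎ chunk q ≡ true
        from (yes x) _ with pr-true a a′ p q x
        ... | inj₁ (_ , refl) = inj₂ (subst (λ u → chunk u ≡ true) walk-one (chunk-intro 0 z≤n))
        ... | inj₂ (_ , refl) = inj₁ ca
        from (no _) (yes x) with pr-true s s⁺ p q x
        ... | inj₁ (_ , refl) = inj₁ cs⁺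
        ... | inj₂ (_ , refl) = inj₂ (chunk-intro k ≤-refl)
        from (no x) (no y) = inj₁ (comp-closed H a p q cp (kept₂ e sp (c p q sp e) x y))
      all : ∀ u → S u ≡ true → component H a u ≡ true ⊎ chunk u ≡ true
      all u su = proj₂ (comp-ind G Rest a (sa , inj₁ ca) step u (comp-trans G a z u (comp-sym G z a sa) su))
      pw : ∀ u b → S u ≡ b → bit b ≤ bit (component H a u) + bit (chunk u)
      pw u false e = z≤n
      pw u true  e with all u e
      ... | inj₁ x rewrite x = s≤s z≤n
      ... | inj₂ x rewrite x = m≤n+m 1 (bit (component H a u))

    comp-inside : ∀ u → component H a u ≡ true → S u ≡ true
    comp-inside u e = ∧-conicalˡ _ _ (comp-least H rest a closed′ (∧-intro sa (cong not a∉chunk)) u e)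
      where
      rest : Fin n → Bool
      rest p = S p ∧ not (chunk p)
      deg2∉ : ∀ {p} → (∀ t → t ≤ k → walk (suc t) ≢ p) → chunk p ≡ false
      deg2∉ {p} f = ¬-not λ e → let (t , le , x) = chunk-elim p e in f t le x
      a∉chunk : chunk a ≡ false
      a∉chunk = deg2∉ λ t le x → ≢-of-D ba (deg2 t (up 2 le)) (sym x)
      s⁺∉chunk : chunk s⁺ ≡ false
      s⁺∉chunk = deg2∉ λ t le → distinct′ (suc t) (2 + k) (s≤s (s≤s le)) (n≤1+n _)
      a-a′ : ¬ adj H a a′ ≡ true
      a-a′ e = [ (λ x → true≢false (trans (sym x) (sw-¬xy first)))
               , [ (λ x → [ (λ y → distinct′ 1 (2 + k) (s≤s (s≤s z≤n)) (n≤1+n _) (trans walk-one (proj₂ y)))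
                          , (λ y → ≢-of-D ba Ds⁺ (proj₁ y)) ]′ (pr-true a s⁺ a a′ x))
                 , (λ x → [ (λ y → ≢-of-D ba Ds (proj₁ y)) , (λ y → ≢-of-S sa sw′ (proj₁ y)) ]′ (pr-true s w a a′ x)) ]′ ]′
               (sw-new G₁ a w s s⁺ a a′ e)
      closed′ : Closed H rest
      closed′ p q rp e = cases (sw-new G₁ a w s s⁺ p q e)
        where
        sp : S p ≡ true
        sp = ∧-conicalˡ _ _ rp
        p∉chunk : chunk p ≡ false
        p∉chunk = not-true (∧-conicalʳ (S p) _ rp)
        old : adj G p q ≡ true → rest q ≡ true
        old x = ∧-intro (c p q sp x) (cong not (¬-not λ ch → bad ch))
          where
          bad : ¬ chunk q ≡ true
          bad ch with chunk-elim q ch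
          ... | t , le , refl with chunk-neighbour t le p (adj-flip G x)
          ...   | inj₁ (refl , refl) = a-a′ (subst (λ u → adj H a u ≡ true) walk-one e)
          ...   | inj₂ (inj₁ y)      = true≢false (trans (sym y) p∉chunk)
          ...   | inj₂ (inj₂ (refl , refl)) = true≢false (trans (sym (adj-flip H {s⁺} {s} e)) (sw-¬xy second))
        cases₁ : adj G p q ≡ true ⊎ pr v a′ p q ≡ true ⊎ pr a w p q ≡ true → rest q ≡ true
        cases₁ (inj₁ x) = old x
        cases₁ (inj₂ (inj₁ x)) with pr-true v a′ p q x
        ... | inj₁ (refl , _) = contradiction (trans (sym sp) sv) true≢false
        ... | inj₂ (refl , _) = contradiction (trans (sym (subst (λ u → chunk u ≡ true) walk-one (chunk-intro 0 z≤n))) p∉chunk) true≢false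
        cases₁ (inj₂ (inj₂ x)) with pr-true a w p q x
        ... | inj₁ (refl , refl) = contradiction (trans (sym e) (sw-¬vw second)) true≢false
        ... | inj₂ (refl , _) = contradiction (trans (sym sp) sw′) true≢false
        cases : adj G₁ p q ≡ true ⊎ pr a s⁺ p q ≡ true ⊎ pr s w p q ≡ true → rest q ≡ true
        cases (inj₁ x) = cases₁ (sw-new G v w a a′ p q x)
        cases (inj₂ (inj₁ x)) with pr-true a s⁺ p q x
        ... | inj₁ (_ , refl) = ∧-intro Ss⁺ (cong not s⁺∉chunk)
        ... | inj₂ (_ , refl) = ∧-intro sa (cong not a∉chunk)
        cases (inj₂ (inj₂ x)) with pr-true s w p q x
        ... | inj₁ (refl , _) = contradiction (trans (sym (chunk-intro k ≤-refl)) p∉chunk) true≢false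
        ... | inj₂ (refl , _) = contradiction (trans (sym sp) sw′) true≢false

    still-light : ∀ {t τ μ ℓ} → τ + ℓ ≤ t → k < ℓ → t ≤ # (fin n) S → mass D S ≤ μ → Light τ μ H a
    still-light {t} {τ} {μ} {ℓ} τℓ kℓ ts ms = light-of ba
      (+-cancelʳ-≤ ℓ τ _ (≤-trans τℓ (≤-trans (comp-large ts) (+-monoʳ-≤ _ kℓ))))
      (≤-trans (mass-mono (component H a) S comp-inside) ms)

∑-shift : ∀ ℓ (φ : ℕ → ℕ) → ∑ (fin ℓ) (φ ∘ toℕ) + φ ℓ ≡ φ 0 + ∑ (fin ℓ) (φ ∘ suc ∘ toℕ)
∑-shift zero    φ = +-comm 0 _
∑-shift (suc ℓ) φ = trans (+-assoc (φ 0) _ _) (cong (φ 0 +_) (∑-shift ℓ (φ ∘ suc)))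

module _ {n : ℕ} (D : DegSeq n) where

  -- Each dart is charged to the at least τ vertices of its component; a vertex u then receives at most
  -- the mass of its own component, which is at most μ.
  light-darts : ∀ τ μ G → HasDegSeq D G → τ * # (fin n ⊗ fin n) (λ (a , b) → light D τ μ G a ∧ adj G a b) ≤ n * μ
  light-darts τ μ G h = begin
    τ * # (fin n ⊗ fin n) (λ (a , b) → light D τ μ G a ∧ adj G a b) ≡⟨ cong (τ *_) (∑-darts G h (light D τ μ G)) ⟩
    τ * ∑ (fin n) (λ a → bit (L a) * D a)                          ≡⟨ *-comm τ _ ⟩
    ∑ (fin n) (λ a → bit (L a) * D a) * τ                          ≡⟨ sym (∑-* (fin n) (λ a → bit (L a) * D a) τ) ⟩
    ∑ (fin n) (λ a → bit (L a) * D a * τ)                          ≤⟨ ∑-mono (fin n) (λ a → row a (L a) refl) ⟩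
    ∑ (fin n) (λ a → ∑ (fin n) λ u → bit (L a ∧ component G a u) * D a) ≡⟨ ∑-swap (fin n) (fin n) (λ a u → bit (L a ∧ component G a u) * D a) ⟩
    ∑ (fin n) (λ u → ∑ (fin n) λ a → bit (L a ∧ component G a u) * D a) ≤⟨ ∑-mono (fin n) col ⟩
    ∑ (fin n) (λ _ → μ)                                            ≡⟨ ∑-const n μ ⟩
    n * μ ∎
    where
    open ≤-Reasoning
    L : Fin n → Bool
    L = light D τ μ G
    row : ∀ a b → L a ≡ b → bit b * D a * τ ≤ ∑ (fin n) (λ u → bit (b ∧ component G a u) * D a)
    row a false e = z≤n
    row a true  e = begin
      1 * D a * τ                              ≡⟨ cong (_* τ) (*-identityˡ (D a)) ⟩
      D a * τ                                  ≤⟨ *-monoʳ-≤ (D a) (Light.is-large (light-elim D G a e)) ⟩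
      D a * # (fin n) (component G a)          ≡⟨ *-comm (D a) _ ⟩
      # (fin n) (component G a) * D a          ≡⟨ sym (∑-* (fin n) (bit ∘ component G a) (D a)) ⟩
      ∑ (fin n) (λ u → bit (component G a u) * D a) ∎
    col : ∀ u → ∑ (fin n) (λ a → bit (L a ∧ component G a u) * D a) ≤ μ
    col u = go _ refl
      where
      T : Fin n → ℕ
      T a = bit (L a ∧ component G a u) * D a
      go : ∀ m → ∑ (fin n) T ≡ m → ∑ (fin n) T ≤ μ
      go zero    e = ≤-trans (≤-reflexive e) z≤n
      go (suc m) e with ∑-pos (fin n) T (subst (0 <_) (sym e) (s≤s z≤n))
      ... | a₀ , 0<T = ≤-trans (∑-mono (fin n) λ a → pw a _ refl) (Light.is-light (light-elim D {τ} {μ} G a₀ (∧-conicalˡ _ _ both)))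
        where
        both : L a₀ ∧ component G a₀ u ≡ true
        both = pos* _ 0<T
          where
          pos* : ∀ b → 0 < bit b * D a₀ → b ≡ true
          pos* true _ = refl
        pw : ∀ a b → L a ∧ component G a u ≡ b → bit b * D a ≤ bit (component G a₀ a) * (if D a ≡ᵇ 2 then 0 else D a)
        pw a false e = z≤n
        pw a true  e = ≤-reflexive (trans (*-identityˡ (D a)) (sym (trans (cong (λ b → bit b * (if D a ≡ᵇ 2 then 0 else D a)) inside)
            (trans (*-identityˡ _) (trans (sym (branch-degree D a)) (trans (cong (λ b → bit b * D a) br) (*-identityˡ (D a))))))))
          where
          br : branch D a ≡ true
          br = Light.is-branch (light-elim D {τ} {μ} G a (∧-conicalˡ _ _ e))
          inside : component G a₀ a ≡ true
          inside = comp-trans G a₀ u a (∧-conicalʳ (L a₀) _ both) (comp-sym G a u (∧-conicalʳ (L a) _ e))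

  module Tags (pos : ∀ i → 1 ≤ D i) (G : Graph n) (h : HasDegSeq D G) (z : Fin n) (bz : branch D z ≡ true)
    (ℓ : ℕ) (ℓ≥1 : 1 ≤ ℓ)
    (short : ∀ a a′ → branch D a ≡ true → adj G a a′ ≡ true → Walk.run D G h a a′ (suc ℓ) ≡ false) where

    S base : Fin n → Bool
    S = component G z
    base a = S a ∧ branch D a

    run′ : Fin n → Fin n → ℕ → Bool
    run′ a a′ k = Walk.run D G h a a′ k

    tag : ℕ → (Fin n × Fin n) × Fin ℓ → Bool
    tag c ((a , a′) , k) = base a ∧ (adj G a a′ ∧ run′ a a′ (c + toℕ k))

    private
      tags : ℕ → ℕ
      tags c = # ((fin n ⊗ fin n) ⊗ fin ℓ) (tag c)

    mass-darts : # (fin n ⊗ fin n) (λ (a , a′) → base a ∧ adj G a a′) ≡ mass D S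
    mass-darts = trans (∑-darts G h base) (∑-cong (fin n) λ x → trans (cong (_* D x) (bit-∧ (S x) (branch D x)))
      (trans (*-assoc (bit (S x)) _ _) (cong (bit (S x) *_) (branch-degree D x))))

    tags-step : ∀ c → tags c ≤ tags (suc c) + mass D S
    tags-step c = begin
      tags c ≤⟨ ∑-mono (fin n ⊗ fin n) (λ (a , a′) → shift a a′) ⟩
      ∑ (fin n ⊗ fin n) (λ (a , a′) → # (fin ℓ) (λ k → tag (suc c) ((a , a′) , k)) + bit (base a ∧ adj G a a′))
        ≡⟨ ∑-+ (fin n ⊗ fin n) (λ (a , a′) → # (fin ℓ) λ k → tag (suc c) ((a , a′) , k)) (λ (a , a′) → bit (base a ∧ adj G a a′)) ⟩
      tags (suc c) + # (fin n ⊗ fin n) (λ (a , a′) → base a ∧ adj G a a′) ≡⟨ cong (tags (suc c) +_) mass-darts ⟩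
      tags (suc c) + mass D S ∎
      where
      open ≤-Reasoning
      shift : ∀ a a′ → # (fin ℓ) (λ k → tag c ((a , a′) , k)) ≤ # (fin ℓ) (λ k → tag (suc c) ((a , a′) , k)) + bit (base a ∧ adj G a a′)
      shift a a′ = begin
        ∑ (fin ℓ) (φ ∘ toℕ)                 ≤⟨ m≤m+n _ (φ ℓ) ⟩
        ∑ (fin ℓ) (φ ∘ toℕ) + φ ℓ           ≡⟨ ∑-shift ℓ φ ⟩
        φ 0 + ∑ (fin ℓ) (φ ∘ suc ∘ toℕ)     ≡⟨ +-comm (φ 0) _ ⟩
        ∑ (fin ℓ) (φ ∘ suc ∘ toℕ) + φ 0     ≤⟨ +-mono-≤
             (≤-reflexive (∑-cong (fin ℓ) λ k → cong (λ t → bit (base a ∧ (adj G a a′ ∧ run′ a a′ t))) (+-suc c (toℕ k))))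
             (bit-mono {base a ∧ (adj G a a′ ∧ run′ a a′ (c + 0))} λ e →
               ∧-intro (∧-conicalˡ _ _ e) (∧-conicalˡ (adj G a a′) _ (∧-conicalʳ (base a) _ e))) ⟩
        # (fin ℓ) (λ k → tag (suc c) ((a , a′) , k)) + bit (base a ∧ adj G a a′) ∎
        where
        φ : ℕ → ℕ
        φ t = bit (base a ∧ (adj G a a′ ∧ run′ a a′ (c + t)))

    tip : (Fin n × Fin n) × Fin ℓ → Fin n
    tip ((a , a′) , k) = Walk.walk D G h a a′ (suc (toℕ k))

    TaggedBy : Fin n → (Fin n × Fin n) × Fin ℓ → Set
    TaggedBy u e = tag 1 e ≡ true × tip e ≡ u

    Covered : Fin n → Set
    Covered u = branch D u ≡ true ⊎ ∃ (TaggedBy u)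

    covered : ∀ u → S u ≡ true → Covered u
    covered u su = proj₂ (comp-ind G (λ u → S u ≡ true × Covered u) z (comp-refl G z , inj₁ bz)
        (λ p q (sp , cp) e → comp-closed G z p q sp e , step p q sp cp e (branch D q) refl) u su)
      where
      make : ∀ a a′ k → k < ℓ → base a ≡ true → adj G a a′ ≡ true → run′ a a′ (suc k) ≡ true →
             ∀ q → Walk.walk D G h a a′ (suc k) ≡ q → Covered q
      make a a′ k lt b s r q e = inj₂ (((a , a′) , fromℕ< lt) ,
        ∧-intro b (∧-intro s (trans (cong (λ t → run′ a a′ (suc t)) (FP.toℕ-fromℕ< lt)) r)) ,
        trans (cong (λ t → Walk.walk D G h a a′ (suc t)) (FP.toℕ-fromℕ< lt)) e)
      step : ∀ p q → S p ≡ true → Covered p → adj G p q ≡ true → ∀ b → branch D q ≡ b → Covered q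
      step p q sp cp e true  bq = inj₁ bq
      step p q sp (inj₁ bp) e false bq = make p q 0 ℓ≥1 (∧-intro sp bp) e
          (∧-intro refl (trans (cong (λ u → D u ≡ᵇ 2) (Walk.walk-one D G h p q)) dq)) q (Walk.walk-one D G h p q)
        where
        dq : (D q ≡ᵇ 2) ≡ true
        dq = not-false bq
      step p q sp (inj₂ (((a , a′) , k) , t , refl)) e false bq = via (toℕ k) (FP.toℕ<n k) r e
        where
        open Walk D G h a a′
        b : base a ≡ true
        b = ∧-conicalˡ _ _ t
        s : adj G a a′ ≡ true
        s = ∧-conicalˡ _ _ (∧-conicalʳ (base a) _ t)
        r : run (suc (toℕ k)) ≡ true
        r = ∧-conicalʳ (adj G a a′) _ (∧-conicalʳ (base a) _ t)
        dq : (D q ≡ᵇ 2) ≡ true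
        dq = not-false bq
        via : ∀ k → k < ℓ → run (suc k) ≡ true → adj G (walk (suc k)) q ≡ true → Covered q
        via k lt r e with walk-neighbour s (suc k) r k ≤-refl q e
        via zero    lt r e | inj₁ x = inj₁ (trans (cong (branch D) (trans x walk-zero)) (∧-conicalʳ (S a) _ b))
        via (suc k) lt r e | inj₁ x = make a a′ k (≤-trans (n≤1+n _) lt) b s (run-prefix (2 + k) (suc k) r (n≤1+n _)) q (sym x)
        via k lt r e | inj₂ x = extend (m≤n⇒m<n∨m≡n lt)
          where
          r′ : run (2 + k) ≡ true
          r′ = ∧-intro r (trans (cong (λ u → D u ≡ᵇ 2) (sym x)) dq)
          extend : suc k < ℓ ⊎ suc k ≡ ℓ → Covered q
          extend (inj₁ lt′)  = make a a′ (suc k) lt′ b s r′ q (sym x)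
          extend (inj₂ refl) = contradiction (trans (sym r′) (short a a′ (∧-conicalʳ (S a) _ b) s)) true≢false

    tags-count : # (fin n) S ≤ # ((fin n ⊗ fin n) ⊗ fin ℓ) (tag 3) + 3 * mass D S
    tags-count = begin
      # (fin n) S                            ≤⟨ ∑-mono (fin n) (λ u → split u) ⟩
      ∑ (fin n) (λ u → bit (S u) * low u + bit (S u ∧ deg2 u)) ≡⟨ ∑-+ (fin n) (λ u → bit (S u) * low u) (λ u → bit (S u ∧ deg2 u)) ⟩
      m + # (fin n) (λ u → S u ∧ deg2 u)     ≤⟨ +-monoʳ-≤ m (#-injection (fin n) ((fin n ⊗ fin n) ⊗ fin ℓ) _ (tag 1) f f-in f-inj) ⟩
      m + tags 1                             ≤⟨ +-monoʳ-≤ m (≤-trans (tags-step 1) (+-monoˡ-≤ m (tags-step 2))) ⟩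
      m + ((tags 3 + m) + m)                 ≡⟨ collect m (tags 3) ⟩
      tags 3 + 3 * m ∎
      where
      open ≤-Reasoning
      m : ℕ
      m = mass D S
      deg2 : Fin n → Bool
      deg2 u = D u ≡ᵇ 2
      low : Fin n → ℕ
      low u = if D u ≡ᵇ 2 then 0 else D u
      collect : ∀ m t → m + ((t + m) + m) ≡ t + 3 * m
      collect = solve-∀
      split : ∀ u → bit (S u) ≤ bit (S u) * low u + bit (S u ∧ deg2 u)
      split u = go (S u) (D u ≡ᵇ 2)
        where
        go : ∀ s b → bit s ≤ bit s * (if b then 0 else D u) + bit (s ∧ b)
        go false b     = z≤n
        go true  true  = s≤s z≤n
        go true  false = ≤-trans (pos u) (≤-trans (m≤m+n _ 0) (m≤m+n _ 0))
      pick : ∀ u → S u ∧ deg2 u ≡ true → ∃ (TaggedBy u)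
      pick u e with covered u (∧-conicalˡ _ _ e)
      ... | inj₂ x = x
      ... | inj₁ b = contradiction (deg2-elim D u (∧-conicalʳ (S u) _ e)) (branch-elim D u b)
      f : ∀ u → S u ∧ deg2 u ≡ true → (Fin n × Fin n) × Fin ℓ
      f u e = proj₁ (pick u e)
      f-in : ∀ u e → tag 1 (f u e) ≡ true
      f-in u e = proj₁ (proj₂ (pick u e))
      f-inj : ∀ u u′ e e′ → f u e ≡ f u′ e′ → u ≡ u′
      f-inj u u′ e e′ x = trans (sym (proj₂ (proj₂ (pick u e))))
        (trans (cong tip x) (proj₂ (proj₂ (pick u′ e′))))

module _ {n : ℕ} {D : DegSeq n} (pos : ∀ i → 1 ≤ D i) (o : Fin n) (Ω : Space D) (μ : ℕ) where
  open Space Ω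

  someLight : ℕ → Fin size → Bool
  someLight t i = anyF (light D t μ (graph i))

  level-count : ∀ ℓ τ t α β → 1 ≤ ℓ → τ + ℓ ≤ t → α + 3 * μ ≤ t → β + μ ≤ M D →
    (C : Fin size → Bool) (z : Fin size → Fin n) → (∀ i → C i ≡ true → light D t μ (graph i) (z i) ≡ true) →
    (∀ i → C i ≡ true → hasLongRun pos o Ω (suc ℓ) i ≡ false) →
    τ * (# (fin size) C * (α * β)) ≤ # (fin size) (someLight τ) * ((2 * n) * (n * μ))
  level-count ℓ τ t α β ℓ≥1 τℓ αμ βμ C z spec short = begin
    τ * (# (fin size) C * (α * β))  ≤⟨ *-monoʳ-≤ τ (#-lower size ((fin n ⊗ fin n) ⊗ fin ℓ) (fin n ⊗ fin n) C A B 1 1 α β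
                                         (λ i c → ≤-trans (α≤ i c) (≤-reflexive (sym (*-identityˡ _))))
                                         (λ i c → ≤-trans (β≤ i c) (≤-reflexive (sym (*-identityˡ _))))) ⟩
    τ * (1 * 1 * # source P)        ≡⟨ cong (τ *_) (*-identityˡ _) ⟩
    τ * # source P                  ≤⟨ *-monoʳ-≤ τ (#-injection source target P Q f f-in f-inj) ⟩
    τ * # target Q                  ≤⟨ #-upper-scaled size (fin n ⊗ fin n) (fin n ⊗ fin n) T L (someLight τ) τ (2 * n) (n * μ)
                                         (λ i → deg2-darts D (graph i) (degrees i)) (λ i → light-darts D τ μ (graph i) (degrees i)) ⟩
    # (fin size) (someLight τ) * ((2 * n) * (n * μ)) ∎
    where
    open ≤-Reasoning hiding (start)
    S : Fin size → Fin n → Bool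
    S i = component (graph i) (z i)
    lt : ∀ i → C i ≡ true → Light D t μ (graph i) (z i)
    lt i c = light-elim D (graph i) (z i) (spec i c)
    A : Fin size → (Fin n × Fin n) × Fin ℓ → Bool
    A i ((a , a′) , k) = (S i a ∧ branch D a) ∧ (adj (graph i) a a′ ∧ Walk.run D (graph i) (degrees i) a a′ (3 + toℕ k))
    B T L : Fin size → Fin n × Fin n → Bool
    B i (v , w) = (not (S i v) ∧ branch D v) ∧ adj (graph i) v w
    T i (s , w) = (D s ≡ᵇ 2) ∧ adj (graph i) s w
    L i (a , b) = light D τ μ (graph i) a ∧ adj (graph i) a b
    source target : Code
    source = fin size ⊗ ((fin n ⊗ fin n) ⊗ fin ℓ) ⊗ (fin n ⊗ fin n)
    target = fin size ⊗ (fin n ⊗ fin n) ⊗ (fin n ⊗ fin n)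
    P : El source → Bool
    P (i , a , b) = C i ∧ (A i a ∧ B i b)
    Q : El target → Bool
    Q (j , a , b) = someLight τ j ∧ (T j a ∧ L j b)

    α≤ : ∀ i → C i ≡ true → α ≤ # ((fin n ⊗ fin n) ⊗ fin ℓ) (A i)
    α≤ i c = +-cancelʳ-≤ (3 * μ) α _ (≤-trans αμ (≤-trans (Light.is-large (lt i c)) (≤-trans
        (Tags.tags-count D pos (graph i) (degrees i) (z i) (Light.is-branch (lt i c)) ℓ ℓ≥1 none)
        (+-monoʳ-≤ (# ((fin n ⊗ fin n) ⊗ fin ℓ) (A i)) (*-monoʳ-≤ 3 (Light.is-light (lt i c)))))))
      where
      none : ∀ a a′ → branch D a ≡ true → adj (graph i) a a′ ≡ true → Walk.run D (graph i) (degrees i) a a′ (suc ℓ) ≡ false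
      none a a′ b e = ¬-not λ r → true≢false (trans (sym (anyF-intro (λ a → anyF λ a′ → longRun pos o Ω (suc ℓ) i a a′) a
        (anyF-intro (λ a′ → longRun pos o Ω (suc ℓ) i a a′) a′ (∧-intro b (∧-intro e r))))) (short i c))

    β≤ : ∀ i → C i ≡ true → β ≤ # (fin n ⊗ fin n) (B i)
    β≤ i c = +-cancelʳ-≤ μ β _ (begin
      β + μ                                      ≤⟨ βμ ⟩
      M D                                        ≤⟨ ∑-mono (fin n) (λ v → pw v (S i v) (D v ≡ᵇ 2)) ⟩
      ∑ (fin n) (λ v → bit (not (S i v) ∧ branch D v) * D v + bit (S i v) * low v)
        ≡⟨ ∑-+ (fin n) (λ v → bit (not (S i v) ∧ branch D v) * D v) (λ v → bit (S i v) * low v) ⟩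
      ∑ (fin n) (λ v → bit (not (S i v) ∧ branch D v) * D v) + mass D (S i)
        ≤⟨ +-mono-≤ (≤-reflexive (sym (∑-darts (graph i) (degrees i) (λ v → not (S i v) ∧ branch D v)))) (Light.is-light (lt i c)) ⟩
      # (fin n ⊗ fin n) (B i) + μ ∎)
      where
      low : Fin n → ℕ
      low v = if D v ≡ᵇ 2 then 0 else D v
      pw : ∀ v s b → (if b then 0 else D v) ≤ bit (not s ∧ not b) * D v + bit s * (if b then 0 else D v)
      pw v s     true  = z≤n
      pw v true  false = ≤-reflexive (sym (+-identityʳ _))
      pw v false false = ≤-trans (≤-reflexive (sym (+-identityʳ _))) (m≤m+n _ 0)

    module At (i : Fin size) (a a′ v w : Fin n) (k : Fin ℓ) (p : P (i , ((a , a′) , k) , (v , w)) ≡ true) where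
      ci : C i ≡ true
      ci = ∧-conicalˡ _ _ p
      pa : A i ((a , a′) , k) ≡ true
      pa = ∧-conicalˡ _ _ (∧-conicalʳ (C i) _ p)
      pb : B i (v , w) ≡ true
      pb = ∧-conicalʳ (A i ((a , a′) , k)) _ (∧-conicalʳ (C i) _ p)
      base : S i a ∧ branch D a ≡ true
      base = ∧-conicalˡ _ _ pa
      tail : adj (graph i) a a′ ∧ Walk.run D (graph i) (degrees i) a a′ (3 + toℕ k) ≡ true
      tail = ∧-conicalʳ (S i a ∧ branch D a) _ pa
      vout : not (S i v) ∧ branch D v ≡ true
      vout = ∧-conicalˡ _ _ pb
      bv : branch D v ≡ true
      bv = ∧-conicalʳ (not (S i v)) _ vout
      open Move D (graph i) (degrees i) (z i) a a′ v w (toℕ k)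
        (∧-conicalˡ _ _ base) (∧-conicalʳ (S i a) _ base) (∧-conicalˡ _ _ tail) (∧-conicalʳ (adj (graph i) a a′) _ tail)
        (not-true (∧-conicalˡ _ _ vout)) bv (∧-conicalʳ (not (S i v) ∧ branch D v) _ pb)
        public using (H; degs; s; s⁺; trail; first; second; Ds; still-light)
      light-after : Light D τ μ H a
      light-after = still-light τℓ (FP.toℕ<n k) (Light.is-large (lt i ci)) (Light.is-light (lt i ci))

    f : ∀ e → P e ≡ true → El target
    f (i , ((a , a′) , k) , (v , w)) p = index H degs , (s , w) , (a , s⁺)
      where open At i a a′ v w k p
    f-in : ∀ e p → Q (f e p) ≡ true
    f-in (i , ((a , a′) , k) , (v , w)) p = ∧-intro (anyF-intro (light D τ μ (graph (index H degs))) a lit)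
        (∧-intro (∧-intro (deg2-intro D s Ds) (trans (sym (index-same H degs s w)) (sw-xw second)))
                 (∧-intro lit (trans (sym (index-same H degs a s⁺)) (sw-vy second))))
      where
      open At i a a′ v w k p
      lit : light D τ μ (graph (index H degs)) a ≡ true
      lit = light-intro D (graph (index H degs)) a (light-same D H (graph (index H degs)) a (index-same H degs) light-after)
    f-inj : ∀ e e′ p p′ → f e p ≡ f e′ p′ → e ≡ e′
    f-inj (i , ((a , a′) , k) , (v , w)) (j , ((b , b′) , k′) , (v′ , w′)) p p′ eq =
        go (cong (proj₁ ∘ proj₁ ∘ proj₂) eq) (cong (proj₂ ∘ proj₁ ∘ proj₂) eq)
           (cong (proj₁ ∘ proj₂ ∘ proj₂) eq) (cong (proj₂ ∘ proj₂ ∘ proj₂) eq)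
           (proj₁ (proj₁ uniq)) (proj₂ (proj₁ uniq)) (FP.toℕ-injective (suc-injective (proj₂ uniq))) same
      where
      module X = At i a a′ v w k p
      module Y = At j b b′ v′ w′ k′ p′
      same : SameGraph X.H Y.H
      same = index-≡ pos Ω (cong proj₁ eq)
      uniq : (v ≡ v′ × a′ ≡ b′) × suc (toℕ k) ≡ suc (toℕ k′)
      uniq = trail-unique D {X.H} X.degs (branch-elim D v X.bv) (branch-elim D v′ Y.bv) X.trail
        (trail-same D (λ c d → sym (same c d)) (subst₂ (Trail D Y.H v′ b′ (suc (toℕ k′)))
          (cong (proj₁ ∘ proj₁ ∘ proj₂) (sym eq)) (cong (proj₂ ∘ proj₁ ∘ proj₂) (sym eq)) Y.trail))
      go : X.s ≡ Y.s → w ≡ w′ → a ≡ b → X.s⁺ ≡ Y.s⁺ → v ≡ v′ → a′ ≡ b′ → k ≡ k′ → SameGraph X.H Y.H →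
           (i , ((a , a′) , k) , (v , w)) ≡ (j , ((b , b′) , k′) , (v′ , w′))
      go es refl refl es⁺ refl refl refl same
        with distinct i j (sw-injective X.first Y.first (sw-injective X.second
               (subst₂ (Switchable (sw (graph j) v w a a′) a w) (sym es) (sym es⁺) Y.second)
               (λ c d → trans (same c d) (cong₂ (λ x y → adj (sw (sw (graph j) v w a a′) a w x y) c d) (sym es) (sym es⁺)))))
      ... | refl = refl

-- Suppression

infixr 4 _∙_
_∙_ : ∀ {A : Set} {x y z : A} → x ≡ y → y ≡ z → x ≡ z
_∙_ = trans

module _ {n : ℕ} where

  δ : Fin n → Fin n → ℕ
  δ x u = bit (does (x ≟ u))

  δ-same : ∀ u → δ u u ≡ 1
  δ-same u = cong bit (true-does (u ≟ u) refl)

  δ-other : ∀ {x u} → x ≢ u → δ x u ≡ 0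
  δ-other {x} {u} ne = cong bit (dec-false (x ≟ u) ne)

  edgeDeg : List (Fin n × Fin n) → Fin n → ℕ
  edgeDeg []             u = 0
  edgeDeg ((x , y) ∷ es) u = δ x u + δ y u + edgeDeg es u

  edgeDeg-↭ : ∀ {es fs} → es ↭ fs → ∀ u → edgeDeg es u ≡ edgeDeg fs u
  edgeDeg-↭ Perm.refl         u = refl
  edgeDeg-↭ (Perm.prep e p)   u = cong (_ +_) (edgeDeg-↭ p u)
  edgeDeg-↭ (Perm.swap (a , b) (c , d) p) u =
    exchange (δ a u + δ b u) (δ c u + δ d u) _ ∙ cong (λ t → (δ c u + δ d u) + ((δ a u + δ b u) + t)) (edgeDeg-↭ p u)
    where
    exchange : ∀ a b c → a + (b + c) ≡ b + (a + c)
    exchange = solve-∀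
  edgeDeg-↭ (Perm.trans p q)  u = edgeDeg-↭ p u ∙ edgeDeg-↭ q u

  edgeDeg-++ : ∀ es fs u → edgeDeg (es ++ fs) u ≡ edgeDeg es u + edgeDeg fs u
  edgeDeg-++ []             fs u = refl
  edgeDeg-++ ((x , y) ∷ es) fs u = cong (δ x u + δ y u +_) (edgeDeg-++ es fs u) ∙ sym (+-assoc (δ x u + δ y u) _ _)

  edgeDeg-concatMap : ∀ m (g : Fin m → Fin n) (f : Fin n → List (Fin n × Fin n)) u →
    edgeDeg (concatMap f (List.tabulate g)) u ≡ ∑ (fin m) (λ i → edgeDeg (f (g i)) u)
  edgeDeg-concatMap zero    g f u = refl
  edgeDeg-concatMap (suc m) g f u = edgeDeg-++ (f (g F.zero)) _ u ∙ cong (edgeDeg (f (g F.zero)) u +_) (edgeDeg-concatMap m (g ∘ F.suc) f u)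

  ∑-δ : ∀ u (φ : Fin n → ℕ) → ∑ (fin n) (λ i → φ i * δ i u) ≡ φ u
  ∑-δ u φ = ∑-cong (fin n) pw ∙ ∑-* (fin n) (δ u) (φ u) ∙ cong (_* φ u) (#-singleton (fin n) u) ∙ *-identityˡ (φ u)
    where
    pw : ∀ i → φ i * δ i u ≡ δ u i * φ u
    pw i with i ≟ u
    ... | yes refl = *-identityʳ (φ u) ∙ sym (cong (_* φ u) (δ-same u) ∙ *-identityˡ (φ u))
    ... | no ne       = *-zeroʳ (φ i) ∙ sym (cong (_* φ u) (δ-other (ne ∘ sym)))

  edgeDeg-off : ∀ {v} es → All (NotIncident v) es → edgeDeg es v ≡ 0
  edgeDeg-off []             []              = refl
  edgeDeg-off ((x , y) ∷ es) ((p , q) ∷ all) = cong₂ _+_ (cong₂ _+_ (δ-other p) (δ-other q)) (edgeDeg-off es all)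

  incident-deg : ∀ {v a : Fin n} {e} → Incident v a e → ∀ es u → edgeDeg (e ∷ es) u ≡ (δ v u + δ a u) + edgeDeg es u
  incident-deg (left a)      es u = refl
  incident-deg {v} (right a) es u = cong (_+ edgeDeg es u) (+-comm (δ a u) (δ v u))

  suppressed-deg : ∀ {H H′ : MGraph n} (s : Suppress H H′) → edgeDeg (edges H) (Suppress.v s) ≡ 2
  suppressed-deg s = edgeDeg-↭ perm v ∙ incident-deg inc₁ (e₂ ∷ rest) v ∙ cong (δ v v + δ a v +_) (incident-deg inc₂ rest v)
      ∙ cong₂ _+_ (cong₂ _+_ (δ-same v) (δ-other a≢v)) (cong₂ _+_ (cong₂ _+_ (δ-same v) (δ-other b≢v)) (edgeDeg-off rest rest-ok))
    where open Suppress s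

  other-deg : ∀ {H H′ : MGraph n} (s : Suppress H H′) u → u ≢ Suppress.v s → edgeDeg (edges H′) u ≡ edgeDeg (edges H) u
  other-deg s u ne = cong (λ es → edgeDeg es u) edges' ∙ sym (edgeDeg-↭ perm u ∙ incident-deg inc₁ (e₂ ∷ rest) u
      ∙ cong (δ v u + δ a u +_) (incident-deg inc₂ rest u)
      ∙ cong₂ (λ p q → (p + δ a u) + ((q + δ b u) + edgeDeg rest u)) (δ-other (ne ∘ sym)) (δ-other (ne ∘ sym))
      ∙ sym (+-assoc (δ a u) (δ b u) _))
    where open Suppress s

  MAdj-sym : ∀ {H : MGraph n} {x y} → MAdj H x y → MAdj H y x
  MAdj-sym = Any.map λ { (inj₁ e) → inj₂ e ; (inj₂ e) → inj₁ e }

  module _ {H H′ : MGraph n} (s : Suppress H H′) where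
    open Suppress s

    private
      as-edge : ∀ x y → Fin n × Fin n → Set
      as-edge x y e = (e ≡ (x , y)) ⊎ (e ≡ (y , x))

    new-edge : MAdj H′ a b
    new-edge = subst (Any (as-edge a b)) (sym edges') (here (inj₁ refl))

    old-edge : ∀ {x y} → Any (as-edge x y) rest → MAdj H′ x y
    old-edge {x} {y} p = subst (Any (as-edge x y)) (sym edges') (there p)

    ends : ∀ {u e x y} → Incident v u e → as-edge x y e → (x ≡ v × y ≡ u) ⊎ (x ≡ u × y ≡ v)
    ends (left _)  (inj₁ refl) = inj₁ (refl , refl)
    ends (left _)  (inj₂ refl) = inj₂ (refl , refl)
    ends (right _) (inj₁ refl) = inj₂ (refl , refl)
    ends (right _) (inj₂ refl) = inj₁ (refl , refl)

    classify : ∀ {x y} → MAdj H x y →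
      ((x ≡ v × y ≡ a) ⊎ (x ≡ a × y ≡ v)) ⊎ ((x ≡ v × y ≡ b) ⊎ (x ≡ b × y ≡ v)) ⊎ Any (as-edge x y) rest
    classify p with Any-resp-↭ perm p
    ... | here q          = inj₁ (ends inc₁ q)
    ... | there (here q)  = inj₂ (inj₁ (ends inc₂ q))
    ... | there (there q) = inj₂ (inj₂ q)

    rest-avoids : ∀ {x y} → Any (as-edge x y) rest → x ≢ v × y ≢ v
    rest-avoids p = go rest-ok p
      where
      go : ∀ {es x y} → All (NotIncident v) es → Any (as-edge x y) es → x ≢ v × y ≢ v
      go ((p , q) ∷ _) (here (inj₁ refl)) = p , q
      go ((p , q) ∷ _) (here (inj₂ refl)) = q , p
      go (_ ∷ all)     (there r)             = go all r

    reroute : ∀ {p q} → Star (MAdj H) p q → q ≢ v → (p ≢ v → Star (MAdj H′) p q) × (p ≡ v → Star (MAdj H′) a q)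
    reroute Star.ε qv = (λ _ → Star.ε) , λ e → contradiction e qv
    reroute {p} {q} (_◅_ {j = z} e path) qv with reroute path qv | classify e
    ... | IH , IH′ | inj₁ (inj₁ (refl , refl)) = (λ pv → contradiction refl pv) , λ _ → IH a≢v
    ... | IH , IH′ | inj₁ (inj₂ (refl , refl)) = (λ _ → IH′ refl) , λ e → contradiction e a≢v
    ... | IH , IH′ | inj₂ (inj₁ (inj₁ (refl , refl))) = (λ pv → contradiction refl pv) , λ _ → new-edge ◅ IH b≢v
    ... | IH , IH′ | inj₂ (inj₁ (inj₂ (refl , refl))) = (λ _ → MAdj-sym {H′} new-edge ◅ IH′ refl) , λ e → contradiction e b≢v
    ... | IH , IH′ | inj₂ (inj₂ r) = (λ _ → old-edge r ◅ IH (proj₂ (rest-avoids r))) , λ e → contradiction e (proj₁ (rest-avoids r))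

    from-H′ : ∀ {x y} → MAdj H′ x y → as-edge x y (a , b) ⊎ Any (as-edge x y) rest
    from-H′ {x} {y} p with subst (Any (as-edge x y)) edges' p
    ... | here q  = inj₁ q
    ... | there q = inj₂ q

    in-H : ∀ {x y} → Any (as-edge x y) rest → MAdj H x y
    in-H r = Any-resp-↭ (↭-sym perm) (there (there r))

    private
      edge-of : ∀ {u e} → Incident v u e → as-edge v u e
      edge-of (left _)  = inj₁ refl
      edge-of (right _) = inj₂ refl

    va-edge : MAdj H v a
    va-edge = Any-resp-↭ (↭-sym perm) (here (edge-of inc₁))

    vb-edge : MAdj H v b
    vb-edge = Any-resp-↭ (↭-sym perm) (there (here (edge-of inc₂)))

module _ {n : ℕ} (D : DegSeq n) (G : Graph n) (h : HasDegSeq D G) (r : Fin n) (br : branch D r ≡ true) where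

  private
    K : Fin n → Bool
    K = component G r

  record Inv (H : MGraph n) : Set where
    field
      kept      : ∀ u → K u ≡ true → branch D u ≡ true → present H u ≡ true
      deg       : ∀ u → K u ≡ true → branch D u ≡ true → edgeDeg (edges H) u ≡ D u
      same-side : ∀ x y → MAdj H x y → K x ≡ true → K y ≡ true
      connected : ∀ x y → MAdj H x y → K x ≡ true → Star (MAdj H) r x

  inv-step : ∀ {H H′} → Suppress H H′ → Inv H → Inv H′
  inv-step {H} {H′} s inv = record
    { kept = λ u ku bu → present' u ∙ cong₂ _∧_ (kept u ku bu) (distinct-bit (survive u ku bu))
    ; deg  = λ u ku bu → other-deg s u (survive u ku bu) ∙ deg u ku bu
    ; same-side = λ x y m kx → [ (λ e → new-side e kx) , (λ e → same-side x y (in-H s e) kx) ]′ (from-H′ s m)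
    ; connected = λ x y m kx → proj₁ (reroute s (path x y (from-H′ s m) kx) (≢v x y (from-H′ s m))) (survive r (comp-refl G r) br)
    }
    where
    open Suppress s
    open Inv inv
    survive : ∀ u → K u ≡ true → branch D u ≡ true → u ≢ v
    survive u ku bu refl = branch-elim D u bu (sym (deg u ku bu) ∙ suppressed-deg s)
    Old : Fin n → Fin n → Set
    Old x y = ((a , b) ≡ (x , y) ⊎ (a , b) ≡ (y , x)) ⊎ Any (λ e → (e ≡ (x , y)) ⊎ (e ≡ (y , x))) rest
    via : ∀ {x y} → MAdj H v x → MAdj H v y → K x ≡ true → K y ≡ true
    via {x} {y} mx my kx = same-side v y my (same-side x v (MAdj-sym {H = H} mx) kx)
    new-side : ∀ {x y} → (a , b) ≡ (x , y) ⊎ (a , b) ≡ (y , x) → K x ≡ true → K y ≡ true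
    new-side (inj₁ refl) = via (va-edge s) (vb-edge s)
    new-side (inj₂ refl) = via (vb-edge s) (va-edge s)
    ≢v : ∀ x y → Old x y → x ≢ v
    ≢v x y (inj₁ (inj₁ refl)) = a≢v
    ≢v x y (inj₁ (inj₂ refl)) = b≢v
    ≢v x y (inj₂ e)              = proj₁ (rest-avoids s e)
    path : ∀ x y → Old x y → K x ≡ true → Star (MAdj H) r x
    path x y (inj₁ (inj₁ refl)) kx = connected a v (MAdj-sym {H = H} (va-edge s)) kx
    path x y (inj₁ (inj₂ refl)) kx = connected b v (MAdj-sym {H = H} (vb-edge s)) kx
    path x y (inj₂ e)              kx = connected x y (in-H s e) kx

  inv-star : ∀ {H H′} → Star Suppress H H′ → Inv H → Inv H′
  inv-star Star.ε        inv = inv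
  inv-star (s ◅ ss) inv = inv-star ss (inv-step s inv)

  private
    keep : Fin n → Fin n → Bool
    keep i j = adj G i j ∧ (toℕ i <ᵇ toℕ j) ∧ nonCyclic G i

    G₀ : MGraph n
    G₀ = deleteCyclic G

    cell : Fin n → Fin n → List (Fin n × Fin n)
    cell i j = if keep i j then [ (i , j) ] else []

  in-cell : ∀ {P : Fin n × Fin n → Set} i j → keep i j ≡ true → P (i , j) → Any P (edges G₀)
  in-cell i j k p = concatMap⁺ (λ i → concatMap (cell i) (allFin n)) (tabulate⁺ i (concatMap⁺ (cell i) (tabulate⁺ j
    (subst (λ b → Any _ (if b then [ (i , j) ] else [])) (sym k) (here p)))))

  from-cell : ∀ {P : Fin n × Fin n → Set} → Any P (edges G₀) → ∃ λ i → ∃ λ j → keep i j ≡ true × P (i , j)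
  from-cell {P} x with tabulate⁻ (concatMap⁻ (λ i → concatMap (cell i) (allFin n)) {xs = allFin n} x)
  ... | i , y with tabulate⁻ (concatMap⁻ (cell i) {xs = allFin n} y)
  ... | j , z = i , j , go (keep i j) refl z
    where
    go : ∀ b → keep i j ≡ b → Any P (if b then [ (i , j) ] else []) → keep i j ≡ true × P (i , j)
    go true e (here p) = e , p

  noncyclic : ∀ u → K u ≡ true → nonCyclic G u ≡ true
  noncyclic u ku = anyF-intro _ r (∧-intro (comp-sym G r u ku) (cong (λ d → not (d ≡ᵇ 2)) (h r) ∙ br))

  MAdj-adj : ∀ x y → MAdj G₀ x y → adj G x y ≡ true
  MAdj-adj x y m with from-cell m
  ... | i , j , k , inj₁ refl = ∧-conicalˡ _ _ k
  ... | i , j , k , inj₂ refl = adj-flip G (∧-conicalˡ _ _ k)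

  <ᵇ-true : ∀ {i j} → i < j → (i <ᵇ j) ≡ true
  <ᵇ-true lt = true-does (_ <? _) lt

  <ᵇ-false : ∀ {i j} → ¬ i < j → (i <ᵇ j) ≡ false
  <ᵇ-false ge = dec-false (_ <? _) ge

  adj-MAdj : ∀ x y → K x ≡ true → adj G x y ≡ true → MAdj G₀ x y
  adj-MAdj x y kx e with <-cmp (toℕ x) (toℕ y)
  ... | tri< lt _ _ = in-cell x y (∧-intro e (∧-intro (<ᵇ-true lt) (noncyclic x kx))) (inj₁ refl)
  ... | tri≈ _ q _  = contradiction (FP.toℕ-injective q) (adj-distinct G e)
  ... | tri> _ _ gt = in-cell y x (∧-intro (adj-flip G e) (∧-intro (<ᵇ-true gt) (noncyclic y (comp-closed G r x y kx e)))) (inj₂ refl)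

  deg₀ : ∀ u → K u ≡ true → edgeDeg (edges G₀) u ≡ D u
  deg₀ u ku = edgeDeg-concatMap n (λ i → i) (λ i → concatMap (cell i) (allFin n)) u
    ∙ ∑-cong (fin n) (λ i → edgeDeg-concatMap n (λ j → j) (cell i) u ∙ ∑-cong (fin n) (λ j → single i j (keep i j))
        ∙ ∑-+ (fin n) (λ j → bit (keep i j) * δ i u) (λ j → bit (keep i j) * δ j u)
        ∙ cong₂ _+_ (∑-* (fin n) (bit ∘ keep i) (δ i u)) (∑-δ u (bit ∘ keep i)))
    ∙ ∑-+ (fin n) (λ i → # (fin n) (keep i) * δ i u) (λ i → bit (keep i u))
    ∙ cong (_+ # (fin n) (λ i → keep i u)) (∑-δ u (λ i → # (fin n) (keep i)))
    ∙ sym (∑-+ (fin n) (λ j → bit (keep u j)) (λ j → bit (keep j u)))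
    ∙ ∑-cong (fin n) (λ j → both j (adj G u j) refl)
    ∙ sym (degree≡# G u) ∙ h u
    where
    single : ∀ i j b → edgeDeg (if b then [ (i , j) ] else []) u ≡ bit b * δ i u + bit b * δ j u
    single i j true  = +-identityʳ _ ∙ cong₂ _+_ (sym (*-identityˡ (δ i u))) (sym (*-identityˡ (δ j u)))
    single i j false = refl
    both : ∀ j b → adj G u j ≡ b → bit (keep u j) + bit (keep j u) ≡ bit b
    both j false e = cong₂ (λ p q → bit (p ∧ (toℕ u <ᵇ toℕ j) ∧ nonCyclic G u) + bit (q ∧ (toℕ j <ᵇ toℕ u) ∧ nonCyclic G j)) e (adj-flip G e)
    both j true  e = cong₂ (λ p q → bit p + bit q)
        (cong₂ (λ p q → p ∧ (toℕ u <ᵇ toℕ j) ∧ q) e (noncyclic u ku))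
        (cong₂ (λ p q → p ∧ (toℕ j <ᵇ toℕ u) ∧ q) (adj-flip G e) (noncyclic j (comp-closed G r u j ku e)))
      ∙ order
      where
      order : bit ((toℕ u <ᵇ toℕ j) ∧ true) + bit ((toℕ j <ᵇ toℕ u) ∧ true) ≡ 1
      order with <-cmp (toℕ u) (toℕ j)
      ... | tri< lt _ ¬gt = cong₂ (λ p q → bit (p ∧ true) + bit (q ∧ true)) (<ᵇ-true lt) (<ᵇ-false ¬gt)
      ... | tri≈ _ q _    = contradiction (FP.toℕ-injective q) (adj-distinct G e)
      ... | tri> ¬lt _ gt = cong₂ (λ p q → bit (p ∧ true) + bit (q ∧ true)) (<ᵇ-false ¬lt) (<ᵇ-true gt)

  inv₀ : Inv G₀
  inv₀ = record
    { kept = λ u ku _ → noncyclic u ku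
    ; deg  = λ u ku _ → deg₀ u ku
    ; same-side = λ x y m kx → comp-closed G r x y kx (MAdj-adj x y m)
    ; connected = λ x y _ kx → proj₂ (comp-ind G (λ u → K u ≡ true × Star (MAdj G₀) r u) r (comp-refl G r , Star.ε)
        (λ p q (kp , s) e → comp-closed G r p q kp e , s ◅◅ (adj-MAdj p q kp e ◅ Star.ε)) x kx)
    }

  select : (es : List (Fin n × Fin n)) → Subset (length es)
  select []       = V.[]
  select (e ∷ es) = K (proj₁ e) V.∷ select es

  selected : ∀ es p → p ∈ₛ select es → K (proj₁ (lookup es p)) ≡ true
  selected (e ∷ es) F.zero    m with K (proj₁ e) | m
  ... | true | V.here = refl
  selected (e ∷ es) (F.suc p) (V.there m) = selected es p m

  in-K : (Fin n × Fin n) → Set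
  in-K (x , y) = K x ≡ K y

  select-size : ∀ es → All in-K es → ∑ (fin n) (λ u → bit (K u) * edgeDeg es u) ≡ 2 * ∣ select es ∣
  select-size [] [] = ∑-cong (fin n) (λ u → *-zeroʳ (bit (K u))) ∙ ∑-0 (fin n)
  select-size ((x , y) ∷ es) (e ∷ all) = ∑-cong (fin n) (λ u → distr (bit (K u)) (δ x u) (δ y u) (edgeDeg es u))
    ∙ ∑-+ (fin n) (λ u → bit (K u) * δ x u + bit (K u) * δ y u) (λ u → bit (K u) * edgeDeg es u)
    ∙ cong₂ _+_ (∑-+ (fin n) (λ u → bit (K u) * δ x u) (λ u → bit (K u) * δ y u) ∙ cong₂ _+_ (point x) (point y ∙ cong bit (sym e)))
                (select-size es all)
    ∙ count (K x)
    where
    distr : ∀ k a b c → k * (a + b + c) ≡ (k * a + k * b) + k * c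
    distr = solve-∀
    point : ∀ x → ∑ (fin n) (λ u → bit (K u) * δ x u) ≡ bit (K x)
    point x = ∑-cong (fin n) (λ u → cong (λ b → bit (K u) * bit b)
      (true⇔ (λ p → true-does (u ≟ x) (sym (does-true (x ≟ u) p))) (λ p → true-does (x ≟ u) (sym (does-true (u ≟ x) p)))))
      ∙ ∑-δ x (bit ∘ K)
    count : ∀ b → (bit b + bit b) + 2 * ∣ select es ∣ ≡ 2 * ∣ b V.∷ select es ∣
    count true  = sym (*-distribˡ-+ 2 1 ∣ select es ∣)
    count false = refl

  large-component : ∀ {H} → IsH G H → present H r ≡ true × ∃ λ (S : Subset (length (edges H))) →
    (∀ p → p ∈ₛ S → Star (MAdj H) r (proj₁ (lookup (edges H) p))) × mass D K ≤ 2 * ∣ S ∣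
  large-component {H} (chain , _) = kept r (comp-refl G r) br , select (edges H) ,
      (λ p m → connected _ _ (at (edges H) p) (selected (edges H) p m)) ,
      ≤-trans (∑-mono (fin n) low) (≤-reflexive (select-size (edges H) (balanced (edges H) λ x y e m → same-side x y m e)))
    where
    open Inv (inv-star chain inv₀)
    at : ∀ es p → Any (λ e → (e ≡ lookup es p) ⊎ (e ≡ (proj₂ (lookup es p) , proj₁ (lookup es p)))) es
    at (e ∷ es) F.zero    = here (inj₁ refl)
    at (e ∷ es) (F.suc p) = there (at es p)
    balanced : ∀ es → (∀ x y → K x ≡ true → Any (λ e → (e ≡ (x , y)) ⊎ (e ≡ (y , x))) es → K y ≡ true) → All in-K es
    balanced []             f = []
    balanced ((x , y) ∷ es) f = true⇔ (λ k → f x y k (here (inj₁ refl))) (λ k → f y x k (here (inj₂ refl)))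
                             ∷ balanced es λ x y k m → f x y k (there m)
    low : ∀ u → bit (K u) * (if D u ≡ᵇ 2 then 0 else D u) ≤ bit (K u) * edgeDeg (edges H) u
    low u = go (K u) (D u ≡ᵇ 2) refl refl
      where
      go : ∀ k b → K u ≡ k → (D u ≡ᵇ 2) ≡ b → bit k * (if b then 0 else D u) ≤ bit k * edgeDeg (edges H) u
      go false b     _ _ = z≤n
      go true  true  _ _ = z≤n
      go true  false k e = *-monoʳ-≤ 1 (≤-reflexive (sym (deg u k (cong not e))))

module _ {n : ℕ} {D : DegSeq n} (pos : ∀ i → 1 ≤ D i) (o : Fin n) (Ω : Space D) where
  open Space Ω

  level : ∀ μ m b t → 3 * μ ≤ b → 2 * μ ≤ M D → 4 * (n * (n * μ)) ≤ b * (b * M D) → 2 * b ≤ t → 1 ≤ b → 1 ≤ M D →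
    2 * # (fin size) (someLight pos o Ω μ (t + (2 * m + 2)))
      ≤ 2 * # (fin size) (hasLongRun pos o Ω (2 * m + 3)) + # (fin size) (someLight pos o Ω μ t)
  level μ m b t 3μ 2μ key bt b≥1 M≥1 = begin
    2 * # (fin size) B⁺              ≤⟨ *-monoʳ-≤ 2 split ⟩
    2 * (# (fin size) Lg + # (fin size) C) ≡⟨ *-distribˡ-+ 2 (# (fin size) Lg) _ ⟩
    2 * # (fin size) Lg + 2 * # (fin size) C ≤⟨ +-monoʳ-≤ (2 * # (fin size) Lg) half ⟩
    2 * # (fin size) Lg + # (fin size) B₀ ∎
    where
    open ≤-Reasoning
    ℓ : ℕ
    ℓ = 2 * m + 2
    B⁺ B₀ Lg C : Fin size → Bool
    B⁺ = someLight pos o Ω μ (t + ℓ)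
    B₀ = someLight pos o Ω μ t
    Lg = hasLongRun pos o Ω (2 * m + 3)
    C i = B⁺ i ∧ not (Lg i)
    split : # (fin size) B⁺ ≤ # (fin size) Lg + # (fin size) C
    split = ≤-trans (∑-mono (fin size) λ i → pw (B⁺ i) (Lg i)) (≤-reflexive (∑-+ (fin size) (bit ∘ Lg) (bit ∘ C)))
      where
      pw : ∀ a c → bit a ≤ bit c + bit (a ∧ not c)
      pw false _     = z≤n
      pw true  true  = s≤s z≤n
      pw true  false = s≤s z≤n
    z : Fin size → Fin n
    z i = choose o (light D (t + ℓ) μ (graph i))
    counted : t * (# (fin size) C * (b * (M D ∸ μ))) ≤ # (fin size) B₀ * ((2 * n) * (n * μ))
    counted = level-count pos o Ω μ ℓ t (t + ℓ) b (M D ∸ μ) (m≤n+m 1 (2 * m + 1) ▸ +-assoc (2 * m) 1 1) ≤-refl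
      (≤-trans (+-monoʳ-≤ b 3μ) (≤-trans (≤-trans (≤-reflexive (double b)) bt) (m≤m+n t ℓ)))
      (≤-reflexive (m∸n+n≡m (≤-trans (m≤m+n μ (μ + 0)) 2μ))) C z
      (λ i c → choose-spec o (light D (t + ℓ) μ (graph i)) (∧-conicalˡ _ _ c))
      (λ i c → subst (λ k → hasLongRun pos o Ω k i ≡ false) (+-suc (2 * m) 2) (not-true (∧-conicalʳ (B⁺ i) _ c)))
      where
      _▸_ : ∀ {a b c} → a ≤ b → b ≡ c → a ≤ c
      p ▸ refl = p
      double : ∀ b → b + b ≡ 2 * b
      double = solve-∀
    rest : M D ≤ 2 * (M D ∸ μ)
    rest = +-cancelʳ-≤ (2 * μ) (M D) _ (begin
      M D + 2 * μ                 ≤⟨ +-monoʳ-≤ (M D) 2μ ⟩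
      M D + M D                   ≡⟨ double (M D) ⟩
      2 * M D                     ≡⟨ cong (2 *_) (sym (m∸n+n≡m (≤-trans (m≤m+n μ (μ + 0)) 2μ))) ⟩
      2 * ((M D ∸ μ) + μ)         ≡⟨ *-distribˡ-+ 2 (M D ∸ μ) μ ⟩
      2 * (M D ∸ μ) + 2 * μ ∎)
      where
      double : ∀ b → b + b ≡ 2 * b
      double = solve-∀
    half : 2 * # (fin size) C ≤ # (fin size) B₀
    half = *-cancelʳ-≤ _ _ (b * (b * M D)) ⦃ >-nonZero (*-mono-≤ b≥1 (*-mono-≤ b≥1 M≥1)) ⦄ (begin
      2 * c * (b * (b * M D))                ≤⟨ *-monoʳ-≤ (2 * c) (*-monoʳ-≤ b (*-monoʳ-≤ b rest)) ⟩
      2 * c * (b * (b * (2 * (M D ∸ μ))))    ≡⟨ shuffle c b (M D ∸ μ) ⟩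
      2 * ((2 * b) * (c * (b * (M D ∸ μ))))  ≤⟨ *-monoʳ-≤ 2 (≤-trans (*-monoˡ-≤ (c * (b * (M D ∸ μ))) bt) counted) ⟩
      2 * (# (fin size) B₀ * ((2 * n) * (n * μ))) ≡⟨ shuffle′ (# (fin size) B₀) n μ ⟩
      # (fin size) B₀ * (4 * (n * (n * μ)))  ≤⟨ *-monoʳ-≤ (# (fin size) B₀) key ⟩
      # (fin size) B₀ * (b * (b * M D)) ∎)
      where
      c : ℕ
      c = # (fin size) C
      shuffle : ∀ c b x → 2 * c * (b * (b * (2 * x))) ≡ 2 * ((2 * b) * (c * (b * x)))
      shuffle = solve-∀
      shuffle′ : ∀ B n μ → 2 * (B * ((2 * n) * (n * μ))) ≡ B * (4 * (n * (n * μ)))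
      shuffle′ = solve-∀

  descend : ∀ μ m b r → 3 * μ ≤ b → 2 * μ ≤ M D → 4 * (n * (n * μ)) ≤ b * (b * M D) → 1 ≤ b → 1 ≤ M D →
    2 ^ r * # (fin size) (someLight pos o Ω μ (2 * b + r * (2 * m + 2)))
      ≤ 2 ^ r * (2 * # (fin size) (hasLongRun pos o Ω (2 * m + 3))) + size
  descend μ m b zero    _ _ _ _ _ = ≤-trans (≤-reflexive (*-identityˡ _)) (≤-trans (#≤ size _) (m≤n+m size _))
  descend μ m b (suc r) h₁ h₂ h₃ h₄ h₅ = begin
    2 * 2 ^ r * # (fin size) (someLight pos o Ω μ (2 * b + (ℓ + r * ℓ)))
      ≡⟨ cong (λ t → 2 * 2 ^ r * # (fin size) (someLight pos o Ω μ t)) (rearrange (2 * b) ℓ (r * ℓ)) ⟩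
    2 * 2 ^ r * B⁺                    ≡⟨ shuffle (2 ^ r) B⁺ ⟩
    2 ^ r * (2 * B⁺)                  ≤⟨ *-monoʳ-≤ (2 ^ r) (level μ m b (2 * b + r * ℓ) h₁ h₂ h₃ (m≤m+n _ _) h₄ h₅) ⟩
    2 ^ r * (2 * Lg + B₀)             ≡⟨ *-distribˡ-+ (2 ^ r) (2 * Lg) B₀ ⟩
    2 ^ r * (2 * Lg) + 2 ^ r * B₀     ≤⟨ +-monoʳ-≤ (2 ^ r * (2 * Lg)) (descend μ m b r h₁ h₂ h₃ h₄ h₅) ⟩
    2 ^ r * (2 * Lg) + (2 ^ r * (2 * Lg) + size) ≡⟨ collect (2 ^ r) Lg size ⟩
    2 * 2 ^ r * (2 * Lg) + size ∎
    where
    open ≤-Reasoning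
    ℓ B⁺ B₀ Lg : ℕ
    ℓ = 2 * m + 2
    B⁺ = # (fin size) (someLight pos o Ω μ (2 * b + r * ℓ + ℓ))
    B₀ = # (fin size) (someLight pos o Ω μ (2 * b + r * ℓ))
    Lg = # (fin size) (hasLongRun pos o Ω (2 * m + 3))
    rearrange : ∀ a b c → a + (b + c) ≡ a + c + b
    rearrange = solve-∀
    shuffle : ∀ p B → 2 * p * B ≡ p * (2 * B)
    shuffle = solve-∀
    collect : ∀ p L s → p * (2 * L) + (p * (2 * L) + s) ≡ 2 * p * (2 * L) + s
    collect = solve-∀

  dense-case : ∀ g E → 1 ≤ g → 1 ≤ n → 8 * (g * g) * E ≤ n → 16 * n ≤ M D →
    E * # (fin size) (λ i → anyF (bigLight D g (1024 * (g * g)) (graph i))) ≤ size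
  dense-case g E g≥1 n≥1 nE dense = *-cancelˡ-≤ (8 * (g * g)) ⦃ >-nonZero (*-mono-≤ {1} {8} (s≤s z≤n) (*-mono-≤ g≥1 g≥1)) ⦄ (begin
    8 * (g * g) * (E * c)    ≡⟨ sym (*-assoc (8 * (g * g)) E c) ⟩
    8 * (g * g) * E * c      ≤⟨ *-monoˡ-≤ c nE ⟩
    n * c                    ≤⟨ *-cancelʳ-≤ _ _ (n * M D) ⦃ >-nonZero (*-mono-≤ n≥1 M≥1) ⦄ (begin
        n * c * (n * M D)    ≡⟨ shuffle n c (M D) ⟩
        c * (n * n * M D)    ≤⟨ dense-bound pos o Ω g (1024 * (g * g)) R≥16 dense ⟩
        g * g * 2 * 2 * (size * ((M D + 2 * n) * n)) ≤⟨ *-monoʳ-≤ (g * g * 2 * 2) (*-monoʳ-≤ size (*-monoˡ-≤ n (+-monoʳ-≤ (M D)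
                                 (≤-trans (*-monoˡ-≤ n {2} {16} (s≤s (s≤s z≤n))) dense)))) ⟩
        g * g * 2 * 2 * (size * ((M D + M D) * n)) ≡⟨ shuffle′ g size (M D) n ⟩
        8 * (g * g) * size * (n * M D) ∎) ⟩
    8 * (g * g) * size ∎)
    where
    open ≤-Reasoning
    c : ℕ
    c = # (fin size) (λ i → anyF (bigLight D g (1024 * (g * g)) (graph i)))
    M≥1 : 1 ≤ M D
    M≥1 = ≤-trans (*-mono-≤ {1} {16} (s≤s z≤n) n≥1) dense
    R≥16 : 16 ≤ 1024 * (g * g)
    R≥16 = *-mono-≤ {16} {1024} (m≤m+n 16 1008) (*-mono-≤ g≥1 g≥1)
    shuffle : ∀ n c M → n * c * (n * M) ≡ c * (n * n * M)
    shuffle = solve-∀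
    shuffle′ : ∀ g s M n → g * g * 2 * 2 * (s * ((M + M) * n)) ≡ 8 * (g * g) * s * (n * M)
    shuffle′ = solve-∀

  cyclic-case : ∀ g F → 1 ≤ g → 1 ≤ n → 36 * (g * g) * F ≤ M D → M D ≤ 16 * n →
    F * # (fin size) (λ i → anyF (bigCyclic D g (graph i))) ≤ size
  cyclic-case g F g≥1 n≥1 MF sparse = *-cancelˡ-≤ (36 * (g * g)) ⦃ >-nonZero (*-mono-≤ {1} {36} (s≤s z≤n) (*-mono-≤ g≥1 g≥1)) ⦄ (begin
    36 * (g * g) * (F * c)   ≡⟨ sym (*-assoc (36 * (g * g)) F c) ⟩
    36 * (g * g) * F * c     ≤⟨ *-monoˡ-≤ c MF ⟩
    M D * c                  ≤⟨ *-cancelʳ-≤ _ _ (n * n) ⦃ >-nonZero (*-mono-≤ n≥1 n≥1) ⦄ (begin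
        M D * c * (n * n)    ≡⟨ shuffle n c (M D) ⟩
        c * (n * n * M D)    ≤⟨ cyclic-bound pos o Ω g ⟩
        g * g * 2 * 1 * (size * ((M D + 2 * n) * n)) ≤⟨ *-monoʳ-≤ (g * g * 2 * 1) (*-monoʳ-≤ size (*-monoˡ-≤ n (+-monoˡ-≤ (2 * n) sparse))) ⟩
        g * g * 2 * 1 * (size * ((16 * n + 2 * n) * n)) ≡⟨ shuffle′ g size n ⟩
        36 * (g * g) * size * (n * n) ∎) ⟩
    36 * (g * g) * size ∎)
    where
    open ≤-Reasoning
    c : ℕ
    c = # (fin size) (λ i → anyF (bigCyclic D g (graph i)))
    shuffle : ∀ n c M → M * c * (n * n) ≡ c * (n * n * M)
    shuffle = solve-∀
    shuffle′ : ∀ g s n → g * g * 2 * 1 * (s * ((16 * n + 2 * n) * n)) ≡ 36 * (g * g) * s * (n * n)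
    shuffle′ = solve-∀

  long-run-case : ∀ m s F → 1 ≤ s → 1 ≤ m → n ≤ s * m → 4 * (s * s) * F ≤ M D →
    F * # (fin size) (hasLongRun pos o Ω (2 * m + 3)) ≤ size
  long-run-case m s F s≥1 m≥1 ns MF = *-cancelˡ-≤ (4 * (s * s)) ⦃ >-nonZero (*-mono-≤ {1} {4} (s≤s z≤n) (*-mono-≤ s≥1 s≥1)) ⦄ (begin
    4 * (s * s) * (F * c)    ≡⟨ sym (*-assoc (4 * (s * s)) F c) ⟩
    4 * (s * s) * F * c      ≤⟨ *-monoˡ-≤ c MF ⟩
    M D * c                  ≤⟨ *-cancelʳ-≤ _ _ (m * m) ⦃ >-nonZero (*-mono-≤ m≥1 m≥1) ⦄ (begin
        M D * c * (m * m)    ≡⟨ shuffle m c (M D) ⟩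
        c * (m * m * M D)    ≤⟨ long-run-bound pos o Ω m ⟩
        size * ((2 * n) * (2 * n)) ≤⟨ *-monoʳ-≤ size (*-mono-≤ (*-monoʳ-≤ 2 ns) (*-monoʳ-≤ 2 ns)) ⟩
        size * ((2 * (s * m)) * (2 * (s * m))) ≡⟨ shuffle′ s size m ⟩
        4 * (s * s) * size * (m * m) ∎) ⟩
    4 * (s * s) * size ∎)
    where
    open ≤-Reasoning
    c : ℕ
    c = # (fin size) (hasLongRun pos o Ω (2 * m + 3))
    shuffle : ∀ m c M → M * c * (m * m) ≡ c * (m * m * M)
    shuffle = solve-∀
    shuffle′ : ∀ s S m → S * ((2 * (s * m)) * (2 * (s * m))) ≡ 4 * (s * s) * S * (m * m)
    shuffle′ = solve-∀

-- Choice of the parameters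

n<2^n : ∀ k → suc k ≤ 2 ^ k
n<2^n zero    = s≤s z≤n
n<2^n (suc k) = begin
  suc (suc k)         ≤⟨ s≤s (n<2^n k) ⟩
  1 + 2 ^ k           ≤⟨ +-monoˡ-≤ (2 ^ k) (≤-trans (s≤s z≤n) (n<2^n k)) ⟩
  2 ^ k + 2 ^ k       ≡⟨ cong (2 ^ k +_) (sym (+-identityʳ (2 ^ k))) ⟩
  2 * 2 ^ k ∎
  where open ≤-Reasoning

quotient-bounds : ∀ a d → 1 ≤ d → d ≤ a → ∃ λ q → 1 ≤ q × d * q ≤ a × a ≤ 2 * (d * q)
quotient-bounds a (suc d) _ d≤a = q , q≥1 , below , above
  where
  open ≤-Reasoning
  q : ℕ
  q = a / suc d
  below : suc d * q ≤ a
  below = ≤-trans (≤-reflexive (*-comm (suc d) q)) (m/n*n≤m a (suc d))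
  q≥1 : 1 ≤ q
  q≥1 = m≥n⇒m/n>0 d≤a
  above : a ≤ 2 * (suc d * q)
  above = begin
    a                              ≡⟨ m≡m%n+[m/n]*n a (suc d) ⟩
    a % suc d + q * suc d          ≤⟨ +-mono-≤ (<⇒≤ (m%n<n a (suc d))) (≤-reflexive (*-comm q (suc d))) ⟩
    suc d + suc d * q              ≤⟨ +-monoˡ-≤ (suc d * q) (≤-trans (≤-reflexive (sym (*-identityʳ (suc d)))) (*-monoʳ-≤ (suc d) q≥1)) ⟩
    suc d * q + suc d * q          ≡⟨ cong (suc d * q +_) (sym (+-identityʳ (suc d * q))) ⟩
    2 * (suc d * q) ∎

halve : ∀ E cyc lg bt s p → 4 * E ≤ p → 1 ≤ p → 4 * E * cyc ≤ s → 8 * E * lg ≤ s → p * bt ≤ p * (2 * lg) + s → E * (cyc + bt) ≤ s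
halve E cyc lg bt s p Ep p≥1 hc hl hb = *-cancelˡ-≤ 4 (begin
    4 * (E * (cyc + bt))             ≡⟨ e₁ E cyc bt ⟩
    4 * E * cyc + 4 * E * bt         ≤⟨ +-mono-≤ hc four-bt ⟩
    s + 2 * s                        ≤⟨ m≤m+n _ s ⟩
    s + 2 * s + s                    ≡⟨ e₂ s ⟩
    4 * s ∎)
  where
  open ≤-Reasoning
  e₁ : ∀ E c b → 4 * (E * (c + b)) ≡ 4 * E * c + 4 * E * b
  e₁ = solve-∀
  e₂ : ∀ s → s + 2 * s + s ≡ 4 * s
  e₂ = solve-∀
  e₃ : ∀ p E b → p * (4 * E * b) ≡ 4 * E * (p * b)
  e₃ = solve-∀
  e₄ : ∀ p E l s → 4 * E * (p * (2 * l) + s) ≡ p * (8 * E * l) + 4 * E * s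
  e₄ = solve-∀
  e₅ : ∀ p s → p * s + p * s ≡ p * (2 * s)
  e₅ = solve-∀
  four-bt : 4 * E * bt ≤ 2 * s
  four-bt = *-cancelˡ-≤ p ⦃ >-nonZero p≥1 ⦄ (begin
    p * (4 * E * bt)                 ≡⟨ e₃ p E bt ⟩
    4 * E * (p * bt)                 ≤⟨ *-monoʳ-≤ (4 * E) hb ⟩
    4 * E * (p * (2 * lg) + s)       ≡⟨ e₄ p E lg s ⟩
    p * (8 * E * lg) + 4 * E * s     ≤⟨ +-mono-≤ (*-monoʳ-≤ p hl) (*-monoˡ-≤ s Ep) ⟩
    p * s + p * s                    ≡⟨ e₅ p s ⟩
    p * (2 * s) ∎)

module _ {n : ℕ} {D : DegSeq n} (pos : ∀ i → 1 ≤ D i) (o : Fin n) (Ω : Space D) where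
  open Space Ω

  sparse-case : ∀ g E → 1 ≤ g → 1 ≤ E → 16 * (g * (4 * E)) ≤ n → M D ≤ 16 * n →
    36 * (g * g) * (4 * E) ≤ M D → 4 * ((32 * (g * (4 * E))) * (32 * (g * (4 * E)))) * (8 * E) ≤ M D →
    E * # (fin size) (λ i → anyF (bigLight D g (1024 * (g * g)) (graph i))) ≤ size
  sparse-case g E g≥1 E≥1 nr sparse M₁ M₂ =
      conclude (quotient-bounds n (4 * g) (*-mono-≤ {1} {4} (s≤s z≤n) g≥1) 4g≤n)
    where
    open ≤-Reasoning
    r R μ : ℕ
    r = 4 * E
    R = 1024 * (g * g)
    r≥1 : 1 ≤ r
    r≥1 = *-mono-≤ {1} {4} (s≤s z≤n) E≥1
    R≥1 : 1 ≤ R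
    R≥1 = *-mono-≤ {1} {1024} (s≤s z≤n) (*-mono-≤ g≥1 g≥1)
    instance
      R≢0 : NonZero R
      R≢0 = >-nonZero R≥1
    μ = 2 * M D / R
    Rμ : R * μ ≤ 2 * M D
    Rμ = ≤-trans (≤-reflexive (*-comm R μ)) (m/n*n≤m (2 * M D) R)
    to-μ : ∀ x → R * x ≤ 2 * M D → x ≤ μ
    to-μ x le = ≤-trans (≤-reflexive (sym (m*n/n≡m x R))) (/-monoˡ-≤ R (≤-trans (≤-reflexive (*-comm x R)) le))
    4g≤n : 4 * g ≤ n
    4g≤n = ≤-trans (*-mono-≤ {4} {16} (m≤m+n 4 12) (≤-trans (≤-reflexive (sym (*-identityʳ g))) (*-monoʳ-≤ g r≥1))) nr
    n≥1 : 1 ≤ n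
    n≥1 = ≤-trans (*-mono-≤ {1} {4} (s≤s z≤n) g≥1) 4g≤n
    M≥1 : 1 ≤ M D
    M≥1 = ≤-trans (*-mono-≤ {1} {36 * (g * g)} (*-mono-≤ {1} {36} (s≤s z≤n) (*-mono-≤ g≥1 g≥1)) r≥1) M₁

    conclude : (∃ λ b → 1 ≤ b × 4 * g * b ≤ n × n ≤ 2 * (4 * g * b)) →
      E * # (fin size) (λ i → anyF (bigLight D g R (graph i))) ≤ size
    conclude (b , b≥1 , gb≤n , n≤gb) = finish (quotient-bounds b (2 * r) (*-mono-≤ {1} {2} (s≤s z≤n) r≥1) 2r≤b)
      where
      n≤8gb : n ≤ 8 * g * b
      n≤8gb = ≤-trans n≤gb (≤-reflexive (e g b))
        where
        e : ∀ g b → 2 * (4 * g * b) ≡ 8 * g * b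
        e = solve-∀
      2r≤b : 2 * r ≤ b
      2r≤b = *-cancelˡ-≤ (8 * g) ⦃ >-nonZero (*-mono-≤ {1} {8} (s≤s z≤n) g≥1) ⦄
        (≤-trans (≤-reflexive (e g r)) (≤-trans nr n≤8gb))
        where
        e : ∀ g r → 8 * g * (2 * r) ≡ 16 * (g * r)
        e = solve-∀
      3μ≤b : 3 * μ ≤ b
      3μ≤b = ≤-trans (*-monoˡ-≤ μ {3} {4 * g} (≤-trans (n≤1+n 3) (≤-trans (≤-reflexive refl) (*-monoʳ-≤ 4 g≥1))))
        (*-cancelˡ-≤ (256 * g) ⦃ >-nonZero (*-mono-≤ {1} {256} (s≤s z≤n) g≥1) ⦄ (begin
          256 * g * (4 * g * μ)    ≡⟨ e₁ g μ ⟩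
          R * μ                    ≤⟨ Rμ ⟩
          2 * M D                  ≤⟨ *-monoʳ-≤ 2 (≤-trans sparse (*-monoʳ-≤ 16 n≤8gb)) ⟩
          2 * (16 * (8 * g * b))   ≡⟨ e₂ g b ⟩
          256 * g * b ∎))
        where
        e₁ : ∀ g μ → 256 * g * (4 * g * μ) ≡ 1024 * (g * g) * μ
        e₁ = solve-∀
        e₂ : ∀ g b → 2 * (16 * (8 * g * b)) ≡ 256 * g * b
        e₂ = solve-∀
      512μ : 256 * (g * g) * μ ≤ M D
      512μ = *-cancelˡ-≤ 4 (begin
        4 * (256 * (g * g) * μ)   ≡⟨ e g μ ⟩
        R * μ                     ≤⟨ Rμ ⟩
        2 * M D                   ≤⟨ *-monoˡ-≤ (M D) {2} {4} (s≤s (s≤s z≤n)) ⟩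
        4 * M D ∎)
        where
        e : ∀ g μ → 4 * (256 * (g * g) * μ) ≡ 1024 * (g * g) * μ
        e = solve-∀
      2μ≤M : 2 * μ ≤ M D
      2μ≤M = ≤-trans (*-monoˡ-≤ μ {2} {256 * (g * g)} (*-mono-≤ {2} {256} (m≤m+n 2 254) (*-mono-≤ g≥1 g≥1))) 512μ
      key : 4 * (n * (n * μ)) ≤ b * (b * M D)
      key = begin
        4 * (n * (n * μ))                          ≤⟨ *-monoʳ-≤ 4 (*-mono-≤ n≤8gb (*-monoˡ-≤ μ n≤8gb)) ⟩
        4 * (8 * g * b * (8 * g * b * μ))          ≡⟨ e g b μ ⟩
        b * (b * (256 * (g * g) * μ))              ≤⟨ *-monoʳ-≤ b (*-monoʳ-≤ b 512μ) ⟩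
        b * (b * M D) ∎
        where
        e : ∀ g b μ → 4 * (8 * g * b * (8 * g * b * μ)) ≡ b * (b * (256 * (g * g) * μ))
        e = solve-∀

      finish : (∃ λ m → 1 ≤ m × 2 * r * m ≤ b × b ≤ 2 * (2 * r * m)) →
        E * # (fin size) (λ i → anyF (bigLight D g R (graph i))) ≤ size
      finish (m , m≥1 , rm≤b , b≤rm) = ≤-trans (*-monoʳ-≤ E cases)
          (halve E cyc lg bt size (2 ^ r) (≤-trans (n≤1+n r) (n<2^n r)) (≤-trans (s≤s z≤n) (n<2^n r))
            (cyclic-case pos o Ω g (4 * E) g≥1 n≥1 M₁ sparse)
            (long-run-case pos o Ω m (32 * (g * r)) (8 * E) (*-mono-≤ {1} {32} (s≤s z≤n) (*-mono-≤ g≥1 r≥1)) m≥1 n≤sm M₂)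
            (descend pos o Ω μ m b r 3μ≤b 2μ≤M key b≥1 M≥1))
        where
        t : ℕ
        t = 2 * b + r * (2 * m + 2)
        cyc lg bt : ℕ
        cyc = # (fin size) (λ i → anyF (bigCyclic D g (graph i)))
        lg  = # (fin size) (hasLongRun pos o Ω (2 * m + 3))
        bt  = # (fin size) (someLight pos o Ω μ t)
        n≤sm : n ≤ 32 * (g * r) * m
        n≤sm = ≤-trans n≤8gb (≤-trans (*-monoʳ-≤ (8 * g) b≤rm) (≤-reflexive (e g r m)))
          where
          e : ∀ g r m → 8 * g * (2 * (2 * r * m)) ≡ 32 * (g * r) * m
          e = solve-∀
        t≤4b : t ≤ 4 * b
        t≤4b = begin
          2 * b + r * (2 * m + 2)       ≤⟨ +-monoʳ-≤ (2 * b) (*-monoʳ-≤ r (+-monoʳ-≤ (2 * m) (*-monoʳ-≤ 2 m≥1))) ⟩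
          2 * b + r * (2 * m + 2 * m)   ≡⟨ cong (2 * b +_) (e₁ r m) ⟩
          2 * b + 2 * (2 * r * m)       ≤⟨ +-monoʳ-≤ (2 * b) (*-monoʳ-≤ 2 rm≤b) ⟩
          2 * b + 2 * b                 ≡⟨ e₂ b ⟩
          4 * b ∎
          where
          e₁ : ∀ r m → r * (2 * m + 2 * m) ≡ 2 * (2 * r * m)
          e₁ = solve-∀
          e₂ : ∀ b → 2 * b + 2 * b ≡ 4 * b
          e₂ = solve-∀
        t≤ : ∀ k → n ≤ g * k → t ≤ k
        t≤ k nk = *-cancelˡ-≤ g ⦃ >-nonZero g≥1 ⦄ (≤-trans (*-monoʳ-≤ g t≤4b)
          (≤-trans (≤-reflexive (e g b)) (≤-trans gb≤n nk)))
          where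
          e : ∀ g b → g * (4 * b) ≡ 4 * g * b
          e = solve-∀
        either : ∀ i → anyF (bigLight D g R (graph i)) ≡ true →
                 anyF (bigCyclic D g (graph i)) ≡ true ⊎ someLight pos o Ω μ t i ≡ true
        either i e with anyF-elim (bigLight D g R (graph i)) e
        ... | z , bl with mass D (component (graph i) z) ℕ.≟ 0
        ...   | yes m≡0 = inj₁ (anyF-intro (bigCyclic D g (graph i)) z (∧-intro (∧-conicalˡ _ _ bl) (true-does (_ ℕ.≟ 0) m≡0)))
        ...   | no m≢0 with branch-in D (component (graph i) z) m≢0
        ...     | a , za , ba = inj₂ (anyF-intro (light D t μ (graph i)) a (light-intro D (graph i) a (light-of ba
                    (t≤ _ (≤-trans (does-true (n ≤? g * # (fin n) (component (graph i) z)) (∧-conicalˡ _ _ bl))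
                                   (*-monoʳ-≤ g (#-mono (fin n) λ u → comp-trans (graph i) a z u az))))
                    (≤-trans (mass-mono D (component (graph i) a) (component (graph i) z) λ u → comp-trans (graph i) z a u za)
                             (to-μ _ (does-true (_ ≤? _) (∧-conicalʳ (big D g (graph i) z) _ bl)))))))
          where
          az : component (graph i) a z ≡ true
          az = comp-sym (graph i) z a za
        cases : # (fin size) (λ i → anyF (bigLight D g R (graph i))) ≤ cyc + bt
        cases = ≤-trans (∑-mono (fin size) λ i → pw i _ refl) (≤-reflexive (∑-+ (fin size)
            (λ i → bit (anyF (bigCyclic D g (graph i)))) (bit ∘ someLight pos o Ω μ t)))
          where
          pw : ∀ i x → anyF (bigLight D g R (graph i)) ≡ x → bit x ≤ bit (anyF (bigCyclic D g (graph i))) + bit (someLight pos o Ω μ t i)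
          pw i false e = z≤n
          pw i true  e = [ (λ h → ≤-trans (≤-reflexive (cong bit (sym h))) (m≤m+n _ _))
                         , (λ h → ≤-trans (≤-reflexive (cong bit (sym h))) (m≤n+m _ (bit (anyF (bigCyclic D g (graph i)))))) ]′ (either i e)

thinness : ℕ → ℕ
thinness g = 1024 * (g * g)

thinness≥1 : ∀ g → 1 ≤ g → 1 ≤ thinness g
thinness≥1 g g≥1 = *-mono-≤ {1} {1024} (s≤s z≤n) (*-mono-≤ g≥1 g≥1)

minOrder minMass : ℕ → ℕ → ℕ
minOrder g E = 16 * (g * (4 * E)) + 8 * (g * g) * E
minMass  g E = 36 * (g * g) * (4 * E) + 4 * ((32 * (g * (4 * E))) * (32 * (g * (4 * E)))) * (8 * E)

light-rare : ∀ {n} {D : DegSeq (suc n)} (pos : ∀ i → 1 ≤ D i) (Ω : Space D) g E → 1 ≤ g → 1 ≤ E →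
  minOrder g E ≤ suc n → minMass g E ≤ M D →
  E * # (fin (Space.size Ω)) (λ i → anyF (bigLight D g (thinness g) (Space.graph Ω i))) ≤ Space.size Ω
light-rare {n} {D} pos Ω g E g≥1 E≥1 order mass≥ with ≤-total (16 * suc n) (M D)
... | inj₁ dense  = dense-case pos F.zero Ω g E g≥1 (s≤s z≤n)
      (≤-trans (m≤n+m (8 * (g * g) * E) (16 * (g * (4 * E)))) order) dense
... | inj₂ sparse = sparse-case pos F.zero Ω g E g≥1 E≥1
      (≤-trans (m≤m+n (16 * (g * (4 * E))) (8 * (g * g) * E)) order) sparse
      (≤-trans (m≤m+n (36 * (g * g) * (4 * E)) (4 * ((32 * (g * (4 * E))) * (32 * (g * (4 * E)))) * (8 * E))) mass≥)
      (≤-trans (m≤n+m (4 * ((32 * (g * (4 * E))) * (32 * (g * (4 * E)))) * (8 * E)) (36 * (g * g) * (4 * E))) mass≥)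

open import Data.Integer using (+_; +≤+; +<+)

scaled : ∀ p m → toℚᵘ (p ℚ.* toℚ m) ≃ toℚᵘ p ℚᵘ.* mkℚᵘ (+ m) 0
scaled p m = ℚᵘP.≃-trans (ℚP.toℚᵘ-homo-* p (toℚ m)) (ℚᵘP.*-congˡ {toℚᵘ p} (ℚP.toℚᵘ-fromℚᵘ (mkℚᵘ (+ m) 0)))

embed : ∀ m → toℚᵘ (toℚ m) ≃ mkℚᵘ (+ m) 0
embed m = ℚP.toℚᵘ-fromℚᵘ (mkℚᵘ (+ m) 0)

module _ {a d m c : ℕ} where

  cross-elim : mkℚᵘ (+ a) d ℚᵘ.* mkℚᵘ (+ m) 0 ℚᵘ.≤ mkℚᵘ (+ c) 0 → a * m ≤ suc d * c
  cross-elim (*≤* le) = subst₂ _≤_ (*-identityʳ (a * m)) (trans (cong (c *_) (*-identityʳ (suc d))) (*-comm c (suc d)))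
    (ℤP.drop‿+≤+ (subst₂ ℤ._≤_ (trans (cong (ℤ._* + 1) (sym (ℤP.pos-* a m))) (sym (ℤP.pos-* (a * m) 1)))
                               (sym (ℤP.pos-* c (suc d * 1))) le))

  cross-intro : a * m ≤ suc d * c → mkℚᵘ (+ a) d ℚᵘ.* mkℚᵘ (+ m) 0 ℚᵘ.≤ mkℚᵘ (+ c) 0
  cross-intro le = *≤* (subst₂ ℤ._≤_ (sym (trans (cong (ℤ._* + 1) (sym (ℤP.pos-* a m))) (sym (ℤP.pos-* (a * m) 1))))
    (ℤP.pos-* c (suc d * 1))
    (+≤+ (subst₂ _≤_ (sym (*-identityʳ (a * m))) (sym (trans (cong (c *_) (*-identityʳ (suc d))) (*-comm c (suc d)))) le)))

  cross-intro′ : suc d * c ≤ a * m → mkℚᵘ (+ c) 0 ℚᵘ.≤ mkℚᵘ (+ a) d ℚᵘ.* mkℚᵘ (+ m) 0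
  cross-intro′ le = *≤* (subst₂ ℤ._≤_ (ℤP.pos-* c (suc d * 1))
    (sym (trans (cong (ℤ._* + 1) (sym (ℤP.pos-* a m))) (sym (ℤP.pos-* (a * m) 1))))
    (+≤+ (subst₂ _≤_ (sym (trans (cong (c *_) (*-identityʳ (suc d))) (*-comm c (suc d)))) (sym (*-identityʳ (a * m))) le)))

positive-form : ∀ p → 0ℚ ℚ.< p → ∃ λ a → ∃ λ d → toℚᵘ p ≡ mkℚᵘ (+ suc a) d
positive-form (mkℚ (+ suc a) d _) _ = a , d , refl
positive-form (mkℚ (+ zero) d _) (ℚ.*<* (+<+ ()))
positive-form (mkℚ (ℤ.-[1+ a ]) d _) (ℚ.*<* ())

ℚ-lower : ∀ γ → 0ℚ ℚ.< γ → ∃ λ g → 1 ≤ g × (∀ m c → γ ℚ.* toℚ m ℚ.≤ toℚ c → m ≤ g * c)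
ℚ-lower γ 0<γ with positive-form γ 0<γ
... | a , d , e = suc d , s≤s z≤n , λ m c le → ≤-trans (m≤m+n m (a * m)) (cross-elim {suc a} {d} {m} {c}
      (subst (λ q → q ℚᵘ.* mkℚᵘ (+ m) 0 ℚᵘ.≤ mkℚᵘ (+ c) 0) e
        (ℚᵘP.≤-respʳ-≃ (embed c) (ℚᵘP.≤-respˡ-≃ (scaled γ m) (ℚP.toℚᵘ-mono-≤ le)))))

ℚ-upper : ∀ ε → 0ℚ ℚ.< ε → ∃ λ E → 1 ≤ E × (∀ c m → E * c ≤ m → toℚ c ℚ.≤ ε ℚ.* toℚ m)
ℚ-upper ε 0<ε with positive-form ε 0<ε
... | a , d , e = suc d , s≤s z≤n , λ c m le → ℚP.toℚᵘ-cancel-≤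
      (ℚᵘP.≤-respʳ-≃ (ℚᵘP.≃-sym (scaled ε m)) (ℚᵘP.≤-respˡ-≃ (ℚᵘP.≃-sym (embed c))
        (subst (λ q → mkℚᵘ (+ c) 0 ℚᵘ.≤ q ℚᵘ.* mkℚᵘ (+ m) 0) (sym e)
          (cross-intro′ {suc a} {d} {m} {c} (≤-trans le (m≤m+n m (a * m)))))))

unit-fraction : ∀ R → 1 ≤ R → ∃ λ ρ → 0ℚ ℚ.< ρ × (∀ m c → m ≤ R * c → ρ ℚ.* toℚ m ℚ.≤ toℚ c)
unit-fraction (suc k) _ = ρ , ℚP.toℚᵘ-cancel-< (ℚᵘP.<-respʳ-≃ (ℚᵘP.≃-sym ρ≃) (*<* (+<+ (s≤s z≤n)))) ,
    λ m c le → ℚP.toℚᵘ-cancel-≤ (ℚᵘP.≤-respʳ-≃ (ℚᵘP.≃-sym (embed c)) (ℚᵘP.≤-respˡ-≃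
      (ℚᵘP.≃-sym (ℚᵘP.≃-trans (scaled ρ m) (ℚᵘP.*-congʳ {mkℚᵘ (+ m) 0} ρ≃)))
      (cross-intro {1} {k} {m} {c} (≤-trans (≤-reflexive (*-identityˡ m)) le))))
  where
  ρ : ℚ
  ρ = fromℚᵘ (mkℚᵘ (+ 1) k)
  ρ≃ : toℚᵘ ρ ≃ mkℚᵘ (+ 1) k
  ρ≃ = ℚP.toℚᵘ-fromℚᵘ (mkℚᵘ (+ 1) k)

module _ {n : ℕ} where

  same-sym : ∀ {G H : Graph n} → SameGraph G H → SameGraph H G
  same-sym e p q = sym (e p q)

  lookup-distinct : ∀ {T : List (Graph n)} → AllPairs Distinct T → ∀ i j → SameGraph (lookup T i) (lookup T j) → i ≡ j
  lookup-distinct (_ ∷ _)  F.zero    F.zero    _ = refl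
  lookup-distinct (a ∷ _)  F.zero    (F.suc j) e = contradiction e (All.lookup a (∈-lookup j))
  lookup-distinct {H ∷ T} (a ∷ _) (F.suc i) F.zero e = contradiction (same-sym {lookup T i} {H} e) (All.lookup a (∈-lookup i))
  lookup-distinct (_ ∷ ps) (F.suc i) (F.suc j) e = cong F.suc (lookup-distinct ps i j e)

  enumeration-space : ∀ {D : DegSeq n} {T} → IsEnumeration D T → Space D
  enumeration-space {D} {T} (pairs , degs , complete) = record
    { size       = length T
    ; graph      = lookup T
    ; degrees    = λ i → All.lookup degs (∈-lookup i)
    ; index      = λ G h → Any.index (complete G h)
    ; index-same = λ G h → lookup-index (complete G h)
    ; distinct   = lookup-distinct pairs
    }

  length≤# : ∀ {D : DegSeq n} (Ω : Space D) (E : Graph n → Set) (ev : Fin (Space.size Ω) → Bool) →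
    (∀ G → E G → HasDegSeq D G) → (∀ G → E G → ∀ i → SameGraph G (Space.graph Ω i) → ev i ≡ true) →
    (L : List (Graph n)) → AllPairs Distinct L → All E L → length L ≤ # (fin (Space.size Ω)) ev
  length≤# {D} Ω E ev degs hit L pairs bad = ≤-trans (≤-reflexive (sym (trans (∑-const (length L) 1) (*-identityʳ _))))
      (#-injection (fin (length L)) (fin size) (λ _ → true) ev (λ k _ → index (lookup L k) (deg k))
        (λ k _ → hit (lookup L k) (at k) _ (index-same (lookup L k) (deg k)))
        λ i j _ _ e → lookup-distinct pairs i j λ p q → trans (index-same (lookup L i) (deg i) p q)
          (trans (cong (λ x → adj (graph x) p q) e) (sym (index-same (lookup L j) (deg j) p q))))
    where
    open Space Ω
    at : ∀ k → E (lookup L k)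
    at k = All.lookup bad (∈-lookup k)
    deg : ∀ k → HasDegSeq D (lookup L k)
    deg k = degs _ (at k)

  bad-light : ∀ {D : DegSeq n} {γ ρ g R} → (∀ m c → γ ℚ.* toℚ m ℚ.≤ toℚ c → m ≤ g * c) →
    (∀ m c → m ≤ R * c → ρ ℚ.* toℚ m ℚ.≤ toℚ c) →
    ∀ G → BadEvent γ ρ D G → ∃ λ z → n ≤ g * # (fin n) (component G z) × R * mass D (component G z) ≤ 2 * M D
  bad-light {D} {γ} {ρ} {g} {R} lower upper G (h , (z , big) , H , isH , small) =
      z , subst (λ c → n ≤ g * c) (countF≡# (component G z)) (lower n (compOrder G z) big) , ≮⇒≥ heavy
    where
    heavy : ¬ 2 * M D < R * mass D (component G z)
    heavy lt with branch-in D (component G z) (λ e → <⇒≱ lt (≤-trans (≤-reflexive (trans (cong (R *_) e) (*-zeroʳ R))) z≤n))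
    ... | a , za , ba with large-component D G h a ba isH
    ...   | pres , S , reach , le = small (a , pres , S , reach , upper (M D) ∣ S ∣ (*-cancelˡ-≤ 2 (begin
        2 * M D                           ≤⟨ <⇒≤ lt ⟩
        R * mass D (component G z)        ≤⟨ *-monoʳ-≤ R (≤-trans (mass-mono D (component G z) (component G a)
                                               λ u → comp-trans G a z u (comp-sym G z a za)) le) ⟩
        R * (2 * ∣ S ∣)                     ≡⟨ sym (*-assoc R 2 ∣ S ∣) ⟩
        R * 2 * ∣ S ∣                       ≡⟨ cong (_* ∣ S ∣) (*-comm R 2) ⟩
        2 * R * ∣ S ∣                       ≡⟨ *-assoc 2 R ∣ S ∣ ⟩
        2 * (R * ∣ S ∣) ∎)))
      where open ≤-Reasoning

  light-transfer : ∀ (D : DegSeq n) g R (G H : Graph n) → SameGraph G H → ∀ z →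
    n ≤ g * # (fin n) (component G z) → R * mass D (component G z) ≤ 2 * M D → anyF (bigLight D g R H) ≡ true
  light-transfer D g R G H e z big small = anyF-intro (bigLight D g R H) z (∧-intro
    (true-does (n ≤? _) (≤-trans big (*-monoʳ-≤ g (#-mono (fin n) (comp-same G H e z)))))
    (true-does (_ ≤? 2 * M D) (≤-trans (*-monoʳ-≤ R (mass-mono D (component H z) (component G z) (comp-same H G (same-sym {G} {H} e) z))) small)))

theorem4 : (lam : ℕ → ℕ) → (∀ K → ∃ λ N → ∀ n → N ≤ n → K ≤ lam n) →
    (γ : ℚ) → 0ℚ ℚ.< γ →
    Σ ℚ λ ρ → 0ℚ ℚ.< ρ ×
    ((ε : ℚ) → 0ℚ ℚ.< ε → ∃ λ N → ∀ n → N ≤ n →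
    (D : DegSeq n) → (∀ i → 1 ≤ D i) → Feasible D → lam n ≤ M D →
    ProbAtMost D (BadEvent γ ρ D) ε)
theorem4 lam lam→∞ γ 0<γ with ℚ-lower γ 0<γ
... | g , g≥1 , lower with unit-fraction (thinness g) (thinness≥1 g g≥1)
... | ρ , 0<ρ , upper = ρ , 0<ρ , rare
  where
  rare : (ε : ℚ) → 0ℚ ℚ.< ε → ∃ λ N → ∀ n → N ≤ n → (D : DegSeq n) → (∀ i → 1 ≤ D i) → Feasible D → lam n ≤ M D →
         ProbAtMost D (BadEvent γ ρ D) ε
  rare ε 0<ε with ℚ-upper ε 0<ε
  ... | E , E≥1 , conv with lam→∞ (minMass g E)
  ...   | N₀ , large = suc (N₀ + minOrder g E) , bound
    where
    bound : ∀ n → suc (N₀ + minOrder g E) ≤ n → (D : DegSeq n) → (∀ i → 1 ≤ D i) → Feasible D → lam n ≤ M D →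
            ProbAtMost D (BadEvent γ ρ D) ε
    bound (suc n) (s≤s n≥) D pos _ lam≤ T enum L pairs bad = conv (length L) (length T)
      (≤-trans (*-monoʳ-≤ E (length≤# Ω (BadEvent γ ρ D) (λ i → anyF (bigLight D g (thinness g) (Space.graph Ω i))) (λ G → proj₁)
          (λ G b i e → let (z , big , small) = bad-light {D = D} {γ} {ρ} {g} {thinness g} lower upper G b
                       in light-transfer D g (thinness g) G (Space.graph Ω i) e z big small) L pairs bad))
        (light-rare pos Ω g E g≥1 E≥1 (≤-trans (≤-trans (m≤n+m (minOrder g E) N₀) n≥) (n≤1+n n))
          (≤-trans (large (suc n) (≤-trans (≤-trans (m≤m+n N₀ (minOrder g E)) n≥) (n≤1+n n))) lam≤)))
      where
      Ω : Space D
      Ω = enumeration-space enum
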